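{- Let $k\ge 0$ and $\delta\ge k+2$ be integers, and let $n$ be sufficiently large (i.e. $n\ge n_0(k,\delta)$ for some $n_0$ depending only on $k$ and $\delta$). If $G$ is an $n$-vertex graph with minimum degree $\delta(G)\ge\delta$ and $$\lambda(G)\ge n-\delta+k-1,$$ then $G$ is $k$-edge-Hamiltonian unless $G=H_{n,k,\delta}$ or $G=L_{n,k,\delta}$.
   Context: All graphs are finite and simple; equality of graphs means isomorphism. $\lambda(G)$ denotes the spectral radius of $G$, i.e. the largest eigenvalue of the adjacency matrix $A(G)$. $K_s$ is the complete graph on $s$ vertices, $I_t$ is the edgeless graph on $t$ vertices, $G\cup H$ is the disjoint union, and $G\vee H$ is the join (obtained from $G\cup H$ by adding all edges between $G$ and $H$). A Hamilton cycle is a cycle through all vertices. A graph $G$ is $k$-edge-Hamiltonian if any collection of vertex-disjoint paths in $G$ with at most $k$ edges altogether is contained in a Hamilton cycle of $G$ (so $0$-edge-Hamiltonian means Hamiltonian). Define $$H_{n,k,\delta}:=K_\delta\vee(K_{n-2\delta+k}\cup I_{\delta-k}),\qquad L_{n,k,\delta}:=K_{k+1}\vee(K_{n-\delta-1}\cup K_{\delta-k}).$$ -}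

module Defs where

open import Algebra.Bundles.Raw using (RawMonoid)
import Algebra.Definitions.RawMonoid as RawMonoidOps
open import Data.Bool.Base using (Bool; true; false; not; if_then_else_)
open import Data.Empty using (⊥-elim)
open import Data.Fin.Base using (Fin; splitAt)
import Data.Fin.Properties as Fin
open import Data.Integer.Base using (ℤ)
open import Data.List.Base as List using (List; []; _∷_; _++_; length; allFin)
import Data.List.Extrema.Nat as Extrema
open import Data.List.Membership.Propositional using (_∈_)
open import Data.List.Relation.Binary.Disjoint.Propositional using (Disjoint)
open import Data.List.Relation.Unary.All using (All)
open import Data.List.Relation.Unary.AllPairs using (AllPairs)
open import Data.List.Relation.Unary.Linked using (Linked)
open import Data.List.Relation.Unary.Unique.Propositional using (Unique)
open import Data.Nat.Base as ℕ using (ℕ; _⊔_; _∸_)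
import Data.Nat.Properties as ℕ
open import Data.Nat.ListAction using (sum)
open import Data.Product.Base using (Σ-syntax; ∃-syntax; _×_; _,_; uncurry)
open import Data.Rational.Base as ℚ using (ℚ; 0ℚ; 1ℚ; ½)
import Data.Rational.Properties as ℚ
open import Data.Rational.Solver using (module +-*-Solver)
open import Data.Sum.Base using (_⊎_; inj₁; inj₂)
open import Function.Bundles using (_↔_; Inverse)
open import Level using (0ℓ)
open import Relation.Binary.PropositionalEquality
  using (_≡_; refl; sym; trans; cong; subst)
open import Relation.Nullary using (¬_; yes; no)
open import Relation.Nullary.Decidable using (⌊_⌋)

-- Real numbers are Cauchy sequences of rationals (with modulus), compared
-- by the setoid equality _≈ʳ_.
IsCauchy : (ℕ → ℚ) → Set
IsCauchy x = ∀ ε → 0ℚ ℚ.< ε →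
  ∃[ N ] ∀ m n → N ℕ.≤ m → N ℕ.≤ n → ℚ.∣ x m ℚ.- x n ∣ ℚ.< ε

record ℝ : Set where
  constructor mkℝ
  field
    seq    : ℕ → ℚ
    cauchy : IsCauchy seq

open ℝ public

infix 4 _≈ʳ_ _≤ʳ_
infixl 6 _+ʳ_
infixl 7 _*ʳ_

_≈ʳ_ : ℝ → ℝ → Set
x ≈ʳ y = ∀ ε → 0ℚ ℚ.< ε →
  ∃[ N ] ∀ n → N ℕ.≤ n → ℚ.∣ seq x n ℚ.- seq y n ∣ ℚ.< ε

_≤ʳ_ : ℝ → ℝ → Set
x ≤ʳ y = ∀ ε → 0ℚ ℚ.< ε →
  ∃[ N ] ∀ n → N ℕ.≤ n → seq x n ℚ.≤ seq y n ℚ.+ ε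

fromℚ : ℚ → ℝ
fromℚ q = mkℝ (λ _ → q) λ ε 0<ε → 0 , λ _ _ _ _ →
  subst (ℚ._< ε) (sym (cong ℚ.∣_∣ (ℚ.+-inverseʳ q))) 0<ε

fromℤ : ℤ → ℝ
fromℤ z = fromℚ (z ℚ./ 1)

0ʳ 1ʳ : ℝ
0ʳ = fromℚ 0ℚ
1ʳ = fromℚ 1ℚ

open +-*-Solver using (solve; _:=_; _:+_; _:*_; _:-_)

split-difference : ∀ p q → p ≡ (p ℚ.- q) ℚ.+ q
split-difference = solve 2 (λ p q → p := (p :- q) :+ q) refl

+-difference : ∀ p q r s →
  (p ℚ.+ q) ℚ.- (r ℚ.+ s) ≡ (p ℚ.- r) ℚ.+ (q ℚ.- s)
+-difference = solve 4 (λ p q r s →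
  (p :+ q) :- (r :+ s) := (p :- r) :+ (q :- s)) refl

*-difference : ∀ p q r s →
  p ℚ.* q ℚ.- r ℚ.* s ≡ p ℚ.* (q ℚ.- s) ℚ.+ s ℚ.* (p ℚ.- r)
*-difference = solve 4 (λ p q r s →
  p :* q :- r :* s := p :* (q :- s) :+ s :* (p :- r)) refl

scale : ∀ b ε → 0ℚ ℚ.< b → 0ℚ ℚ.< ε → ∃[ η ] 0ℚ ℚ.< η × b ℚ.* η ≡ ε
scale b ε 0<b 0<ε = ℚ.1/ b ℚ.* ε , 0<η , eq
  where
  instance
    b-pos : ℚ.Positive b
    b-pos = ℚ.positive 0<b
    b-nonZero : ℚ.NonZero b
    b-nonZero = ℚ.pos⇒nonZero b
    ε-pos : ℚ.Positive ε
    ε-pos = ℚ.positive 0<ε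
    b⁻¹-pos : ℚ.Positive (ℚ.1/ b)
    b⁻¹-pos = ℚ.1/pos⇒pos b
  0<η : 0ℚ ℚ.< ℚ.1/ b ℚ.* ε
  0<η = ℚ.positive⁻¹ _ {{ℚ.pos*pos⇒pos (ℚ.1/ b) ε}}
  eq : b ℚ.* (ℚ.1/ b ℚ.* ε) ≡ ε
  eq = trans (sym (ℚ.*-assoc b (ℚ.1/ b) ε))
      (trans (cong (ℚ._* ε) (ℚ.*-inverseʳ b)) (ℚ.*-identityˡ ε))

halve : ∀ ε → 0ℚ ℚ.< ε → ∃[ η ] 0ℚ ℚ.< η × η ℚ.+ η ≡ ε
halve ε 0<ε = ½ ℚ.* ε , 0<½ε ,
  trans (sym (ℚ.*-distribʳ-+ ε ½ ½)) (ℚ.*-identityˡ ε)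
  where
  0<½ε : 0ℚ ℚ.< ½ ℚ.* ε
  0<½ε = ℚ.positive⁻¹ _ {{ℚ.pos*pos⇒pos ½ ε {{ℚ.positive 0<ε}}}}

bounded : (x : ℝ) → ∃[ b ] 0ℚ ℚ.< b ×
          (∃[ N ] ∀ n → N ℕ.≤ n → ℚ.∣ seq x n ∣ ℚ.≤ b)
bounded x with cauchy x 1ℚ (ℚ.positive⁻¹ 1ℚ)
... | N , close = b , 0<b , N , λ n N≤n → begin
    ℚ.∣ seq x n ∣
      ≡⟨ cong ℚ.∣_∣ (split-difference (seq x n) (seq x N)) ⟩
    ℚ.∣ (seq x n ℚ.- seq x N) ℚ.+ seq x N ∣
      ≤⟨ ℚ.∣p+q∣≤∣p∣+∣q∣ (seq x n ℚ.- seq x N) (seq x N) ⟩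
    ℚ.∣ seq x n ℚ.- seq x N ∣ ℚ.+ ℚ.∣ seq x N ∣
      ≤⟨ ℚ.+-monoˡ-≤ ℚ.∣ seq x N ∣ (ℚ.<⇒≤ (close n N N≤n ℕ.≤-refl)) ⟩
    b ∎
  where
  open ℚ.≤-Reasoning
  b : ℚ
  b = 1ℚ ℚ.+ ℚ.∣ seq x N ∣
  0<b : 0ℚ ℚ.< b
  0<b = ℚ.+-mono-<-≤ (ℚ.positive⁻¹ 1ℚ) (ℚ.0≤∣p∣ (seq x N))

∣*∣-< : ∀ p q {b η} → 0ℚ ℚ.< b → ℚ.∣ p ∣ ℚ.≤ b → ℚ.∣ q ∣ ℚ.< η →
        ℚ.∣ p ℚ.* q ∣ ℚ.< b ℚ.* η
∣*∣-< p q {b} {η} 0<b p≤b q<η = begin-strict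
    ℚ.∣ p ℚ.* q ∣
      ≡⟨ ℚ.∣p*q∣≡∣p∣*∣q∣ p q ⟩
    ℚ.∣ p ∣ ℚ.* ℚ.∣ q ∣
      ≤⟨ ℚ.*-monoʳ-≤-nonNeg ℚ.∣ q ∣ {{ℚ.∣-∣-nonNeg q}} p≤b ⟩
    b ℚ.* ℚ.∣ q ∣
      <⟨ ℚ.*-monoʳ-<-pos b {{ℚ.positive 0<b}} q<η ⟩
    b ℚ.* η ∎
  where open ℚ.≤-Reasoning

+-close : ∀ p q r s {η ε} → η ℚ.+ η ≡ ε →
  ℚ.∣ p ℚ.- r ∣ ℚ.< η → ℚ.∣ q ℚ.- s ∣ ℚ.< η →
  ℚ.∣ (p ℚ.+ q) ℚ.- (r ℚ.+ s) ∣ ℚ.< ε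
+-close p q r s {η} {ε} η+η≡ε p-r q-s = begin-strict
    ℚ.∣ (p ℚ.+ q) ℚ.- (r ℚ.+ s) ∣
      ≡⟨ cong ℚ.∣_∣ (+-difference p q r s) ⟩
    ℚ.∣ (p ℚ.- r) ℚ.+ (q ℚ.- s) ∣
      ≤⟨ ℚ.∣p+q∣≤∣p∣+∣q∣ (p ℚ.- r) (q ℚ.- s) ⟩
    ℚ.∣ p ℚ.- r ∣ ℚ.+ ℚ.∣ q ℚ.- s ∣
      <⟨ ℚ.+-mono-< p-r q-s ⟩
    η ℚ.+ η
      ≡⟨ η+η≡ε ⟩
    ε ∎
  where open ℚ.≤-Reasoning

*-close : ∀ p q r s {b c η θ ζ ε} → 0ℚ ℚ.< b → 0ℚ ℚ.< c →
  b ℚ.* η ≡ ζ → c ℚ.* θ ≡ ζ → ζ ℚ.+ ζ ≡ ε →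
  ℚ.∣ p ∣ ℚ.≤ b → ℚ.∣ s ∣ ℚ.≤ c →
  ℚ.∣ q ℚ.- s ∣ ℚ.< η → ℚ.∣ p ℚ.- r ∣ ℚ.< θ →
  ℚ.∣ p ℚ.* q ℚ.- r ℚ.* s ∣ ℚ.< ε
*-close p q r s {ε = ε} 0<b 0<c refl cθ≡ζ ζ+ζ≡ε p≤b s≤c q-s p-r = begin-strict
    ℚ.∣ p ℚ.* q ℚ.- r ℚ.* s ∣
      ≡⟨ cong ℚ.∣_∣ (*-difference p q r s) ⟩
    ℚ.∣ p ℚ.* (q ℚ.- s) ℚ.+ s ℚ.* (p ℚ.- r) ∣
      ≤⟨ ℚ.∣p+q∣≤∣p∣+∣q∣ (p ℚ.* (q ℚ.- s)) (s ℚ.* (p ℚ.- r)) ⟩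
    ℚ.∣ p ℚ.* (q ℚ.- s) ∣ ℚ.+ ℚ.∣ s ℚ.* (p ℚ.- r) ∣
      <⟨ ℚ.+-mono-<
           (∣*∣-< p (q ℚ.- s) 0<b p≤b q-s)
           (subst (ℚ.∣ s ℚ.* (p ℚ.- r) ∣ ℚ.<_) cθ≡ζ (∣*∣-< s (p ℚ.- r) 0<c s≤c p-r)) ⟩
    _ ≡⟨ ζ+ζ≡ε ⟩
    ε ∎
  where open ℚ.≤-Reasoning

+-cauchy : ∀ x y → IsCauchy (λ n → seq x n ℚ.+ seq y n)
+-cauchy x y ε 0<ε =
  let η , 0<η , η+η≡ε = halve ε 0<ε
      M , close-x = cauchy x η 0<η
      N , close-y = cauchy y η 0<η
  in M ⊔ N , λ m n m≥ n≥ →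
    +-close (seq x m) (seq y m) (seq x n) (seq y n) η+η≡ε
      (close-x m n (ℕ.m⊔n≤o⇒m≤o M N m≥) (ℕ.m⊔n≤o⇒m≤o M N n≥))
      (close-y m n (ℕ.m⊔n≤o⇒n≤o M N m≥) (ℕ.m⊔n≤o⇒n≤o M N n≥))

*-cauchy : ∀ x y → IsCauchy (λ n → seq x n ℚ.* seq y n)
*-cauchy x y ε 0<ε =
  let b , 0<b , K , x≤b = bounded x
      c , 0<c , L , y≤c = bounded y
      ζ , 0<ζ , ζ+ζ≡ε = halve ε 0<ε
      η , 0<η , bη≡ζ = scale b ζ 0<b 0<ζ
      θ , 0<θ , cθ≡ζ = scale c ζ 0<c 0<ζ
      M , close-y = cauchy y η 0<η
      N , close-x = cauchy x θ 0<θ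
  in (K ⊔ L) ⊔ (M ⊔ N) , λ m n m≥ n≥ →
    let m≥KL = ℕ.m⊔n≤o⇒m≤o (K ⊔ L) (M ⊔ N) m≥
        n≥KL = ℕ.m⊔n≤o⇒m≤o (K ⊔ L) (M ⊔ N) n≥
        m≥MN = ℕ.m⊔n≤o⇒n≤o (K ⊔ L) (M ⊔ N) m≥
        n≥MN = ℕ.m⊔n≤o⇒n≤o (K ⊔ L) (M ⊔ N) n≥
    in *-close (seq x m) (seq y m) (seq x n) (seq y n)
         0<b 0<c bη≡ζ cθ≡ζ ζ+ζ≡ε
         (x≤b m (ℕ.m⊔n≤o⇒m≤o K L m≥KL)) (y≤c n (ℕ.m⊔n≤o⇒n≤o K L n≥KL))
         (close-y m n (ℕ.m⊔n≤o⇒m≤o M N m≥MN) (ℕ.m⊔n≤o⇒m≤o M N n≥MN))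
         (close-x m n (ℕ.m⊔n≤o⇒n≤o M N m≥MN) (ℕ.m⊔n≤o⇒n≤o M N n≥MN))

_+ʳ_ : ℝ → ℝ → ℝ
x +ʳ y = mkℝ (λ n → seq x n ℚ.+ seq y n) (+-cauchy x y)

_*ʳ_ : ℝ → ℝ → ℝ
x *ʳ y = mkℝ (λ n → seq x n ℚ.* seq y n) (*-cauchy x y)

+ʳ-0ʳ-rawMonoid : RawMonoid 0ℓ 0ℓ
+ʳ-0ʳ-rawMonoid = record { Carrier = ℝ ; _≈_ = _≈ʳ_ ; _∙_ = _+ʳ_ ; ε = 0ʳ }

∑ʳ : ∀ {n} → (Fin n → ℝ) → ℝ
∑ʳ = RawMonoidOps.sum +ʳ-0ʳ-rawMonoid

Matrix : ℕ → Set
Matrix n = Fin n → Fin n → ℝ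

IsEigenvalue : ∀ {n} → Matrix n → ℝ → Set
IsEigenvalue {n} A μ = Σ[ v ∈ (Fin n → ℝ) ]
  ¬ (∀ i → v i ≈ʳ 0ʳ) × (∀ i → ∑ʳ (λ j → A i j *ʳ v j) ≈ʳ μ *ʳ v i)

IsLargestEigenvalue : ∀ {n} → Matrix n → ℝ → Set
IsLargestEigenvalue A μ = IsEigenvalue A μ × (∀ ν → IsEigenvalue A ν → ν ≤ʳ μ)

record Graph (n : ℕ) : Set where
  field
    adj         : Fin n → Fin n → Bool
    symmetric   : ∀ u v → adj u v ≡ adj v u
    irreflexive : ∀ v → adj v v ≡ false

  Adj : Fin n → Fin n → Set
  Adj u v = adj u v ≡ true

open Graph public

infix 4 _≅_

_≅_ : ∀ {m n} → Graph m → Graph n → Set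
_≅_ {m} {n} G H = Σ[ f ∈ Fin m ↔ Fin n ]
  (∀ u v → adj G u v ≡ adj H (Inverse.to f u) (Inverse.to f v))

complete : ∀ n → Graph n
complete n = record { adj = adjK ; symmetric = sym-K ; irreflexive = irr-K }
  where
  adjK : Fin n → Fin n → Bool
  adjK u v = not ⌊ u Fin.≟ v ⌋
  sym-K : ∀ u v → adjK u v ≡ adjK v u
  sym-K u v with u Fin.≟ v | v Fin.≟ u
  ... | yes _ | yes _ = refl
  ... | no _  | no _  = refl
  ... | yes p | no q  = ⊥-elim (q (sym p))
  ... | no p  | yes q = ⊥-elim (p (sym q))
  irr-K : ∀ v → adjK v v ≡ false
  irr-K v with v Fin.≟ v
  ... | yes _ = refl
  ... | no p  = ⊥-elim (p refl)

edgeless : ∀ n → Graph n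
edgeless n = record
  { adj = λ _ _ → false ; symmetric = λ _ _ → refl ; irreflexive = λ _ → refl }

-- G and H side by side, with all cross pairs adjacent iff `cross` holds.
combine : Bool → ∀ {m n} → Graph m → Graph n → Graph (m ℕ.+ n)
combine cross {m} {n} G H = record
  { adj         = λ u v → adj⊎ (splitAt m u) (splitAt m v)
  ; symmetric   = λ u v → sym⊎ (splitAt m u) (splitAt m v)
  ; irreflexive = λ v → irr⊎ (splitAt m v)
  }
  where
  adj⊎ : Fin m ⊎ Fin n → Fin m ⊎ Fin n → Bool
  adj⊎ (inj₁ u) (inj₁ v) = adj G u v
  adj⊎ (inj₂ u) (inj₂ v) = adj H u v
  adj⊎ (inj₁ _) (inj₂ _) = cross
  adj⊎ (inj₂ _) (inj₁ _) = cross
  sym⊎ : ∀ s t → adj⊎ s t ≡ adj⊎ t s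
  sym⊎ (inj₁ u) (inj₁ v) = symmetric G u v
  sym⊎ (inj₂ u) (inj₂ v) = symmetric H u v
  sym⊎ (inj₁ _) (inj₂ _) = refl
  sym⊎ (inj₂ _) (inj₁ _) = refl
  irr⊎ : ∀ s → adj⊎ s s ≡ false
  irr⊎ (inj₁ v) = irreflexive G v
  irr⊎ (inj₂ v) = irreflexive H v

infixr 6 _∪_
infixr 5 _∨_

_∪_ : ∀ {m n} → Graph m → Graph n → Graph (m ℕ.+ n)
_∪_ = combine false

_∨_ : ∀ {m n} → Graph m → Graph n → Graph (m ℕ.+ n)
_∨_ = combine true

degree : ∀ {n} → Graph n → Fin n → ℕ
degree {n} G v = sum (List.map (λ u → if adj G v u then 1 else 0) (allFin n))

-- The starting value n of the minimum exceeds every degree, so it only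
-- matters for the graph without vertices.
minDegree : ∀ {n} → Graph n → ℕ
minDegree {n} G = Extrema.min n (List.map (degree G) (allFin n))

adjacencyMatrix : ∀ {n} → Graph n → Matrix n
adjacencyMatrix G u v = if adj G u v then 1ʳ else 0ʳ

-- ρ = λ(G), as a relation: it determines ρ up to _≈ʳ_.
IsSpectralRadius : ∀ {n} → Graph n → ℝ → Set
IsSpectralRadius G = IsLargestEigenvalue (adjacencyMatrix G)

consecutive : ∀ {A : Set} → List A → List (A × A)
consecutive (x ∷ y ∷ xs) = (x , y) ∷ consecutive (y ∷ xs)
consecutive (_ ∷ [])     = []
consecutive []           = []

record Path {n} (G : Graph n) : Set where
  field
    start    : Fin n
    rest     : List (Fin n)
    linked   : Linked (Adj G) (start ∷ rest)
    distinct : Unique (start ∷ rest)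

  vertices : List (Fin n)
  vertices = start ∷ rest

  edges : List (Fin n × Fin n)
  edges = consecutive vertices

record Cycle {n} (G : Graph n) : Set where
  field
    start    : Fin n
    rest     : List (Fin n)
    length≥3 : 3 ℕ.≤ length (start ∷ rest)
    linked   : Linked (Adj G) (start ∷ rest ++ start ∷ [])
    distinct : Unique (start ∷ rest)

  vertices : List (Fin n)
  vertices = start ∷ rest

  edges : List (Fin n × Fin n)
  edges = consecutive (start ∷ rest ++ start ∷ [])

module _ {n} {G : Graph n} where

  IsHamilton : Cycle G → Set
  IsHamilton C = ∀ v → v ∈ Cycle.vertices C

  VertexDisjoint : Path G → Path G → Set
  VertexDisjoint P Q = Disjoint (Path.vertices P) (Path.vertices Q)

  -- Edges are unordered: an edge listed as (u , v) may be traversed as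
  -- (v , u) by the cycle.
  _⊑_ : Path G → Cycle G → Set
  P ⊑ C = All (_∈ Cycle.vertices C) (Path.vertices P) ×
          All (uncurry onCycle) (Path.edges P)
    where
    onCycle : Fin n → Fin n → Set
    onCycle u v = (u , v) ∈ Cycle.edges C ⊎ (v , u) ∈ Cycle.edges C

EdgeHamiltonian : ∀ {n} → ℕ → Graph n → Set
EdgeHamiltonian k G = (Ps : List (Path G)) →
  AllPairs VertexDisjoint Ps →
  sum (List.map (λ P → length (Path.edges P)) Ps) ℕ.≤ k →
  Σ[ C ∈ Cycle G ] IsHamilton C × All (_⊑ C) Ps

-- n - 2δ + k is written (n + k) ∸ 2δ so that truncation never interferes
-- when the integer n - 2δ + k is nonnegative.
H : ∀ n k δ → Graph (δ ℕ.+ (((n ℕ.+ k) ∸ 2 ℕ.* δ) ℕ.+ (δ ∸ k)))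
H n k δ = complete δ ∨ (complete ((n ℕ.+ k) ∸ 2 ℕ.* δ) ∪ edgeless (δ ∸ k))

L : ∀ n k δ → Graph ((k ℕ.+ 1) ℕ.+ ((n ∸ (δ ℕ.+ 1)) ℕ.+ (δ ∸ k)))
L n k δ = complete (k ℕ.+ 1) ∨ (complete (n ∸ (δ ℕ.+ 1)) ∪ complete (δ ∸ k))

{-# OPTIONS --safe #-}
module Submission where

-- Write s = δ - k and r = n - s - 1, so that the hypothesis reads λ(G) ≥ r.
-- By Collatz–Wielandt no vector y of natural numbers satisfies A y < r y.
-- Applied to two-valued vectors this bounds by 3s the number of vertices of
-- degree below 2r/3, and by s the number of vertices of degree below r/(s+2);
-- let T be the set of the latter and B its complement.  Bondy–Chvátal closure
-- (adding uv when d(u) + d(v) ≥ n + k preserves k-edge-Hamiltonicity backwards)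
-- turns B into a clique, and then everything into a complete graph, unless
-- |T| = s and every vertex of T has degree exactly δ.  In that case a missing
-- edge inside B would again produce a vector with A y < r y, so B is a clique
-- of G; the closure still applies unless all vertices of T have the same
-- neighbours in B.  If T is neither edgeless nor complete, adding an edge uv
-- between T and B closes the graph while d(u) + d(v) = n + k - 1, so a
-- Hamilton path from u to v is extremal for the crossing argument; two
-- rotations contradict this rigidity.  T edgeless gives H, T complete gives L.

open import Defs

-- The number r is the spectral radius of a complete graph on r + 1 vertices, and n = r + 1 + s. So
-- the hypothesis allows G to be little more than a clique on r + 1 vertices with s further vertices
-- of small degree, and both exceptional graphs have this shape. Crude test vectors are enough to
-- find the clique up to closure. They cannot see one missing edge, which changes the spectral
-- radius by very little; that step needs a finely balanced vector, and it can be balanced because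
-- the s vertices outside the clique then have bounded degree.
--
-- The test vectors have natural entries for a reason. Real numbers are Cauchy sequences here, so an
-- eigenvector is only available approximately, at a finite stage and with unknown signs. Taking
-- absolute values gets rid of the signs, and a strict inequality between natural numbers leaves a
-- gap of 1, which absorbs the approximation errors.

module Proof where

  open import Algebra.Bundles using (CommutativeRing)
  import Algebra.Properties.Semiring.Mult as SemiringMult
  import Algebra.Properties.Semiring.Sum as SemiringSum
  open import Data.Bool.Base using (Bool; T; true; false; not; _∧_; if_then_else_) renaming (_∨_ to _or_)
  import Data.Bool.Properties as Bool
  open import Data.Empty using (⊥; ⊥-elim)
  open import Data.Fin.Base using (Fin; zero; suc; splitAt; join)
  import Data.Fin.Properties as Fin
  open import Data.Fin.Properties using (_≟_; any?)
  import Data.Integer.Base as ℤ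
  import Data.Integer.Properties as ℤ
  import Data.Integer.Solver as ℤ-Solver
  open import Data.List.Base as List
    using (List; []; _∷_; _++_; reverse; length; allFin; concat; map; filter; cartesianProduct)
  import Data.List.Extrema.Nat as Extrema
  import Data.List.Membership.DecPropositional as DecMembership
  open import Data.List.Membership.Propositional using (_∈_; _∉_)
  open import Data.List.Membership.Propositional.Properties
  open import Data.List.Membership.Propositional.Properties.WithK using (unique∧set⇒bag)
  import Data.List.Properties as List
  open import Data.List.Relation.Binary.BagAndSetEquality using (∼bag⇒↭)
  open import Data.List.Relation.Binary.Permutation.Propositional
    using (_↭_; ↭-sym; ↭-trans; ↭-reflexive; ↭⇒↭ₛ)
  open import Data.List.Relation.Binary.Permutation.Propositional.Properties
    using (↭-reverse; ↭-length; ∈-resp-↭; ++⁺ʳ; ++-comm) renaming (map⁺ to ↭-map⁺)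
  import Data.List.Relation.Binary.Permutation.Setoid.Properties as ↭ₛ
  open import Data.List.Relation.Unary.All as All using (All; []; _∷_)
  import Data.List.Relation.Unary.All.Properties as All
  open import Data.List.Relation.Unary.AllPairs as AllPairs using (AllPairs; []; _∷_)
  import Data.List.Relation.Unary.AllPairs.Properties as AllPairs
  open import Data.List.Relation.Unary.Any using (here; there)
  open import Data.List.Relation.Unary.Linked using (Linked; []; [-]; _∷_)
  open import Data.List.Relation.Unary.Unique.Propositional using (Unique)
  import Data.List.Relation.Unary.Unique.Propositional.Properties as Unique
  open import Data.Nat.Base as ℕ
    using (ℕ; zero; suc; _+_; _*_; _∸_; _⊔_; _≤_; _<_; _<ᵇ_; z≤n; s≤s)
  import Data.Nat.Properties as ℕ
  open import Data.Nat.ListAction using (sum)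
  open import Data.Nat.ListAction.Properties using (sum-↭)
  open import Data.Nat.Properties hiding (_≟_)
  open import Data.Nat.Solver using (module +-*-Solver)
  open import Data.Product.Base using (Σ-syntax; ∃-syntax; _×_; _,_; proj₁; proj₂)
  open import Data.Rational.Base as ℚ using (ℚ; 0ℚ; 1ℚ; ½)
  import Data.Rational.Properties as ℚ
  import Data.Rational.Solver as ℚ-Solver
  import Data.Rational.Unnormalised.Base as ℚᵘ
  import Data.Rational.Unnormalised.Properties as ℚᵘ
  open import Data.Sum.Base as Sum using (_⊎_; inj₁; inj₂; [_,_]′)
  open import Data.Sum.Function.Propositional using (_⊎-↔_)
  open import Data.Sum.Properties using (inj₁-injective; inj₂-injective)
  open import Function.Base using (_∘_; id)
  open import Function.Bundles using (_↔_; Inverse; mk⇔; mk↔ₛ′)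
  open import Function.Properties.Inverse using (↔-refl; ↔-sym; ↔-trans)
  open import Relation.Binary.PropositionalEquality
  open import Relation.Nullary using (Dec; ¬_; yes; no; ¬?; _×-dec_)
  open import Relation.Nullary.Decidable using (⌊_⌋)

  -- The spectral hypothesis

  module ℕΣ = SemiringSum ℕ.+-*-semiring
  module ℚΣ = SemiringSum (CommutativeRing.semiring ℚ.+-*-commutativeRing)
  module ℚ× = SemiringMult (CommutativeRing.semiring ℚ.+-*-commutativeRing)

  open ℕΣ using () renaming (sum to ∑)

  𝟙 : Bool → ℕ
  𝟙 b = if b then 1 else 0

  ι : ℕ → ℚ
  ι n = n ℚ×.× 1ℚ

  ι-+ : ∀ m n → ι (m ℕ.+ n) ≡ ι m ℚ.+ ι n
  ι-+ = ℚ×.×-homo-+ 1ℚ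

  ι-* : ∀ m n → ι (m ℕ.* n) ≡ ι m ℚ.* ι n
  ι-* = ℚ×.×1-homo-*

  0≤ι : ∀ n → 0ℚ ℚ.≤ ι n
  0≤ι zero    = ℚ.≤-refl
  0≤ι (suc n) = ℚ.+-mono-≤ (ℚ.nonNegative⁻¹ 1ℚ) (0≤ι n)

  ι-mono-≤ : ∀ {m n} → m ℕ.≤ n → ι m ℚ.≤ ι n
  ι-mono-≤ {n = n} ℕ.z≤n = 0≤ι n
  ι-mono-≤ (ℕ.s≤s m≤n) = ℚ.+-monoʳ-≤ 1ℚ (ι-mono-≤ m≤n)

  /1≡ι : ∀ n → (ℤ.+ n) ℚ./ 1 ≡ ι n
  /1≡ι zero    = refl
  /1≡ι (suc n) = trans (ℚ.toℚᵘ-injective eq) (cong (1ℚ ℚ.+_) (/1≡ι n))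
    where
    open ℚᵘ.≃-Reasoning
    eq : ℚ.toℚᵘ ((ℤ.+ suc n) ℚ./ 1) ℚᵘ.≃ ℚ.toℚᵘ (1ℚ ℚ.+ (ℤ.+ n) ℚ./ 1)
    eq = begin
      ℚ.toℚᵘ ((ℤ.+ suc n) ℚ./ 1)
        ≈⟨ ℚ.toℚᵘ-fromℚᵘ (ℚᵘ.mkℚᵘ (ℤ.+ suc n) 0) ⟩
      ℚᵘ.mkℚᵘ (ℤ.+ suc n) 0
        ≈⟨ ℚᵘ.*≡* (cong (λ i → (ℤ.+ 1 ℤ.+ i) ℤ.* ℤ.+ 1) (sym (ℤ.*-identityʳ (ℤ.+ n)))) ⟩
      ℚ.toℚᵘ 1ℚ ℚᵘ.+ ℚᵘ.mkℚᵘ (ℤ.+ n) 0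
        ≈⟨ ℚᵘ.+-congʳ (ℚ.toℚᵘ 1ℚ) (ℚ.toℚᵘ-fromℚᵘ (ℚᵘ.mkℚᵘ (ℤ.+ n) 0)) ⟨
      ℚ.toℚᵘ 1ℚ ℚᵘ.+ ℚ.toℚᵘ ((ℤ.+ n) ℚ./ 1)
        ≈⟨ ℚ.toℚᵘ-homo-+ 1ℚ ((ℤ.+ n) ℚ./ 1) ⟨
      ℚ.toℚᵘ (1ℚ ℚ.+ (ℤ.+ n) ℚ./ 1) ∎

  ι-∑ : ∀ {n} (f : Fin n → ℕ) → ι (∑ f) ≡ ℚΣ.sum (ι ∘ f)
  ι-∑ {zero}  f = refl
  ι-∑ {suc n} f = trans (ι-+ (f zero) _) (cong (ι (f zero) ℚ.+_) (ι-∑ (f ∘ suc)))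

  ℚ∑-mono-≤ : ∀ {n} {f g : Fin n → ℚ} → (∀ i → f i ℚ.≤ g i) → ℚΣ.sum f ℚ.≤ ℚΣ.sum g
  ℚ∑-mono-≤ {zero}  f≤g = ℚ.≤-refl
  ℚ∑-mono-≤ {suc n} f≤g = ℚ.+-mono-≤ (f≤g zero) (ℚ∑-mono-≤ (f≤g ∘ suc))

  ℚ∑-nonNeg : ∀ {n} {f : Fin n → ℚ} → (∀ i → 0ℚ ℚ.≤ f i) → 0ℚ ℚ.≤ ℚΣ.sum f
  ℚ∑-nonNeg {zero}  0≤f = ℚ.≤-refl
  ℚ∑-nonNeg {suc n} 0≤f = ℚ.+-mono-≤ (0≤f zero) (ℚ∑-nonNeg (0≤f ∘ suc))

  term≤ℚ∑ : ∀ {n} {f : Fin n → ℚ} → (∀ i → 0ℚ ℚ.≤ f i) → ∀ i → f i ℚ.≤ ℚΣ.sum f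
  term≤ℚ∑ {suc n} {f} 0≤f zero = begin
      f zero           ≡⟨ ℚ.+-identityʳ (f zero) ⟨
      f zero ℚ.+ 0ℚ    ≤⟨ ℚ.+-monoʳ-≤ (f zero) (ℚ∑-nonNeg (0≤f ∘ suc)) ⟩
      ℚΣ.sum f         ∎
    where open ℚ.≤-Reasoning
  term≤ℚ∑ {suc n} {f} 0≤f (suc i) = begin
      f (suc i)                       ≤⟨ term≤ℚ∑ (0≤f ∘ suc) i ⟩
      ℚΣ.sum (f ∘ suc)                ≡⟨ ℚ.+-identityˡ _ ⟨
      0ℚ ℚ.+ ℚΣ.sum (f ∘ suc)         ≤⟨ ℚ.+-monoˡ-≤ _ (0≤f zero) ⟩
      ℚΣ.sum f                        ∎
    where open ℚ.≤-Reasoning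

  ∣ℚ∑∣≤ℚ∑∣∣ : ∀ {n} (f : Fin n → ℚ) → ℚ.∣ ℚΣ.sum f ∣ ℚ.≤ ℚΣ.sum (λ i → ℚ.∣ f i ∣)
  ∣ℚ∑∣≤ℚ∑∣∣ {zero}  f = ℚ.≤-refl
  ∣ℚ∑∣≤ℚ∑∣∣ {suc n} f = ℚ.≤-trans (ℚ.∣p+q∣≤∣p∣+∣q∣ (f zero) _)
    (ℚ.+-monoʳ-≤ ℚ.∣ f zero ∣ (∣ℚ∑∣≤ℚ∑∣∣ (f ∘ suc)))

  *-monoˡ-≤₀ : ∀ {r p q} → 0ℚ ℚ.≤ r → p ℚ.≤ q → r ℚ.* p ℚ.≤ r ℚ.* q
  *-monoˡ-≤₀ {r} 0≤r = ℚ.*-monoˡ-≤-nonNeg r {{ℚ.nonNegative 0≤r}}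

  *-monoʳ-≤₀ : ∀ {r p q} → 0ℚ ℚ.≤ r → p ℚ.≤ q → p ℚ.* r ℚ.≤ q ℚ.* r
  *-monoʳ-≤₀ {r} 0≤r = ℚ.*-monoʳ-≤-nonNeg r {{ℚ.nonNegative 0≤r}}

  p≤∣p∣ : ∀ p → p ℚ.≤ ℚ.∣ p ∣
  p≤∣p∣ p with ℚ.≤-total 0ℚ p
  ... | inj₁ 0≤p = ℚ.≤-reflexive (sym (ℚ.0≤p⇒∣p∣≡p 0≤p))
  ... | inj₂ p≤0 = ℚ.≤-trans p≤0 (ℚ.0≤∣p∣ p)

  cancel-+ : ∀ a {b c} → a ℚ.+ b ℚ.≤ a ℚ.+ c → b ℚ.≤ c
  cancel-+ a {b} {c} a+b≤a+c = begin
      b                       ≡⟨ eq a b ⟩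
      ℚ.- a ℚ.+ (a ℚ.+ b)     ≤⟨ ℚ.+-monoʳ-≤ (ℚ.- a) a+b≤a+c ⟩
      ℚ.- a ℚ.+ (a ℚ.+ c)     ≡⟨ eq a c ⟨
      c                       ∎
    where
    open ℚ.≤-Reasoning
    open ℚ-Solver.+-*-Solver
    eq : ∀ a b → b ≡ ℚ.- a ℚ.+ (a ℚ.+ b)
    eq = solve 2 (λ a b → b := :- a :+ (a :+ b)) refl

  -- Integer test vectors against approximate eigenvectors

  _·_ : ∀ {n} → Graph n → (Fin n → ℕ) → Fin n → ℕ
  (G · y) i = ∑ λ j → 𝟙 (adj G i j) ℕ.* y j

  module _ {n} (G : Graph n) (r : ℕ) (y : Fin n → ℕ)
           (y-super : ∀ i → (G · y) i ℕ.< r ℕ.* y i)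
           (v : Fin n → ℚ) (ρ θ η : ℚ)
           (0≤θ : 0ℚ ℚ.≤ θ)
           (near : ∀ i → ℚ.∣ ℚΣ.sum (λ j → ι (𝟙 (adj G i j)) ℚ.* v j) ℚ.- ρ ℚ.* v i ∣ ℚ.≤ η)
           (r≤ρ+θ : ι r ℚ.≤ ρ ℚ.+ θ)
           (θ-small : θ ℚ.* ι (∑ y) ℚ.≤ ½)
    where
    private
      open ℚ.≤-Reasoning
      a : Fin n → Fin n → ℚ
      a i j = ι (𝟙 (adj G i j))
      w U : Fin n → ℚ
      w i = ℚ.∣ v i ∣
      U i = ι (y i)
      0≤w : ∀ i → 0ℚ ℚ.≤ w i
      0≤w i = ℚ.0≤∣p∣ (v i)
      Y : ℚ
      Y = ι (∑ y)

      -- The entries of the adjacency matrix are nonnegative, so by the triangle inequality |v|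
      -- satisfies one direction of the eigenvalue equation even if v changes sign.
      ρw≤ : ∀ i → ρ ℚ.* w i ℚ.≤ ℚΣ.sum (λ j → a i j ℚ.* w j) ℚ.+ η
      ρw≤ i = begin
        ρ ℚ.* w i                     ≤⟨ *-monoʳ-≤₀ (0≤w i) (p≤∣p∣ ρ) ⟩
        ℚ.∣ ρ ∣ ℚ.* w i               ≡⟨ ℚ.∣p*q∣≡∣p∣*∣q∣ ρ (v i) ⟨
        ℚ.∣ ρ ℚ.* v i ∣               ≡⟨ cong ℚ.∣_∣ (eq Av (ρ ℚ.* v i)) ⟩
        ℚ.∣ Av ℚ.- (Av ℚ.- ρ ℚ.* v i) ∣ ≤⟨ ℚ.∣p-q∣≤∣p∣+∣q∣ Av _ ⟩
        ℚ.∣ Av ∣ ℚ.+ ℚ.∣ Av ℚ.- ρ ℚ.* v i ∣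
          ≤⟨ ℚ.+-mono-≤ (∣ℚ∑∣≤ℚ∑∣∣ (λ j → a i j ℚ.* v j)) (near i) ⟩
        ℚΣ.sum (λ j → ℚ.∣ a i j ℚ.* v j ∣) ℚ.+ η
          ≡⟨ cong (ℚ._+ η) (ℚΣ.sum-cong-≗ λ j → trans (ℚ.∣p*q∣≡∣p∣*∣q∣ (a i j) (v j))
               (cong (ℚ._* w j) (ℚ.0≤p⇒∣p∣≡p (0≤ι (𝟙 (adj G i j)))))) ⟩
        ℚΣ.sum (λ j → a i j ℚ.* w j) ℚ.+ η ∎
        where
        Av = ℚΣ.sum (λ j → a i j ℚ.* v j)
        open ℚ-Solver.+-*-Solver
        eq : ∀ p q → q ≡ p ℚ.- (p ℚ.- q)
        eq = solve 2 (λ p q → q := p :- (p :- q)) refl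

      rw≤ : ∀ i → ι r ℚ.* w i ℚ.≤ ℚΣ.sum (λ j → a i j ℚ.* w j) ℚ.+ (θ ℚ.* w i ℚ.+ η)
      rw≤ i = begin
        ι r ℚ.* w i                   ≤⟨ *-monoʳ-≤₀ (0≤w i) r≤ρ+θ ⟩
        (ρ ℚ.+ θ) ℚ.* w i             ≡⟨ ℚ.*-distribʳ-+ (w i) ρ θ ⟩
        ρ ℚ.* w i ℚ.+ θ ℚ.* w i       ≤⟨ ℚ.+-monoˡ-≤ _ (ρw≤ i) ⟩
        Aw ℚ.+ η ℚ.+ θ ℚ.* w i        ≡⟨ solve 3 (λ a b c → a :+ b :+ c := a :+ (c :+ b)) refl Aw η (θ ℚ.* w i) ⟩
        Aw ℚ.+ (θ ℚ.* w i ℚ.+ η)      ∎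
        where
        Aw = ℚΣ.sum (λ j → a i j ℚ.* w j)
        open ℚ-Solver.+-*-Solver

      swap : ℚΣ.sum (λ i → U i ℚ.* ℚΣ.sum (λ j → a i j ℚ.* w j)) ≡
             ℚΣ.sum (λ j → ι ((G · y) j) ℚ.* w j)
      swap = begin-equality
        ℚΣ.sum (λ i → U i ℚ.* ℚΣ.sum (λ j → a i j ℚ.* w j))
          ≡⟨ ℚΣ.sum-cong-≗ (λ i → ℚΣ.*-distribˡ-sum (U i) (λ j → a i j ℚ.* w j)) ⟩
        ℚΣ.sum (λ i → ℚΣ.sum (λ j → U i ℚ.* (a i j ℚ.* w j)))
          ≡⟨ ℚΣ.∑-comm (λ i j → U i ℚ.* (a i j ℚ.* w j)) ⟩
        ℚΣ.sum (λ j → ℚΣ.sum (λ i → U i ℚ.* (a i j ℚ.* w j)))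
          ≡⟨ ℚΣ.sum-cong-≗ (λ j → ℚΣ.sum-cong-≗ (λ i → entry i j)) ⟩
        ℚΣ.sum (λ j → ℚΣ.sum (λ i → ι (𝟙 (adj G j i) ℕ.* y i) ℚ.* w j))
          ≡⟨ ℚΣ.sum-cong-≗ (λ j → trans (sym (ℚΣ.*-distribʳ-sum (w j) (λ i → ι (𝟙 (adj G j i) ℕ.* y i))))
               (cong (ℚ._* w j) (sym (ι-∑ (λ i → 𝟙 (adj G j i) ℕ.* y i))))) ⟩
        ℚΣ.sum (λ j → ι ((G · y) j) ℚ.* w j) ∎
        where
        open ℚ-Solver.+-*-Solver
        entry : ∀ i j → U i ℚ.* (a i j ℚ.* w j) ≡ ι (𝟙 (adj G j i) ℕ.* y i) ℚ.* w j
        entry i j rewrite symmetric G i j | ι-* (𝟙 (adj G j i)) (y i) =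
          solve 3 (λ u a w → u :* (a :* w) := (a :* u) :* w) refl (U i) (a j i) (w j)

      -- Strictness between natural numbers means A y + 1 ≤ r y. The extra 1 becomes the term ∑ w
      -- that beats the errors in `upper`.
      lower : ℚΣ.sum (λ j → ι ((G · y) j) ℚ.* w j) ℚ.+ ℚΣ.sum w ℚ.≤
              ℚΣ.sum (λ i → U i ℚ.* (ι r ℚ.* w i))
      lower = begin
        ℚΣ.sum (λ j → ι ((G · y) j) ℚ.* w j) ℚ.+ ℚΣ.sum w
          ≡⟨ ℚΣ.∑-distrib-+ (λ j → ι ((G · y) j) ℚ.* w j) w ⟨
        ℚΣ.sum (λ j → ι ((G · y) j) ℚ.* w j ℚ.+ w j)
          ≤⟨ ℚ∑-mono-≤ entry ⟩
        ℚΣ.sum (λ i → U i ℚ.* (ι r ℚ.* w i)) ∎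
        where
        open ℚ-Solver.+-*-Solver
        entry : ∀ j → ι ((G · y) j) ℚ.* w j ℚ.+ w j ℚ.≤ U j ℚ.* (ι r ℚ.* w j)
        entry j = begin
          ι ((G · y) j) ℚ.* w j ℚ.+ w j
            ≡⟨ solve 2 (λ g w → g :* w :+ w := (con 1ℚ :+ g) :* w) refl (ι ((G · y) j)) (w j) ⟩
          ι (suc ((G · y) j)) ℚ.* w j
            ≤⟨ *-monoʳ-≤₀ (0≤w j) (ι-mono-≤ (y-super j)) ⟩
          ι (r ℕ.* y j) ℚ.* w j
            ≡⟨ cong (ℚ._* w j) (ι-* r (y j)) ⟩
          ι r ℚ.* U j ℚ.* w j
            ≡⟨ solve 3 (λ r u w → r :* u :* w := u :* (r :* w)) refl (ι r) (U j) (w j) ⟩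
          U j ℚ.* (ι r ℚ.* w j) ∎

      upper : ℚΣ.sum (λ i → U i ℚ.* (ι r ℚ.* w i)) ℚ.≤
              ℚΣ.sum (λ j → ι ((G · y) j) ℚ.* w j) ℚ.+ (½ ℚ.* ℚΣ.sum w ℚ.+ Y ℚ.* η)
      upper = begin
        ℚΣ.sum (λ i → U i ℚ.* (ι r ℚ.* w i))
          ≤⟨ ℚ∑-mono-≤ entry ⟩
        ℚΣ.sum (λ i → U i ℚ.* Aw i ℚ.+ (½ ℚ.* w i ℚ.+ U i ℚ.* η))
          ≡⟨ ℚΣ.∑-distrib-+ (λ i → U i ℚ.* Aw i) (λ i → ½ ℚ.* w i ℚ.+ U i ℚ.* η) ⟩
        ℚΣ.sum (λ i → U i ℚ.* Aw i) ℚ.+ ℚΣ.sum (λ i → ½ ℚ.* w i ℚ.+ U i ℚ.* η)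
          ≡⟨ cong₂ ℚ._+_ swap (trans (ℚΣ.∑-distrib-+ (λ i → ½ ℚ.* w i) (λ i → U i ℚ.* η))
               (cong₂ ℚ._+_ (sym (ℚΣ.*-distribˡ-sum ½ w))
                 (trans (sym (ℚΣ.*-distribʳ-sum η U)) (cong (ℚ._* η) (sym (ι-∑ y)))))) ⟩
        ℚΣ.sum (λ j → ι ((G · y) j) ℚ.* w j) ℚ.+ (½ ℚ.* ℚΣ.sum w ℚ.+ Y ℚ.* η) ∎
        where
        open ℚ-Solver.+-*-Solver
        Aw : Fin n → ℚ
        Aw i = ℚΣ.sum (λ j → a i j ℚ.* w j)
        U≤Y : ∀ i → U i ℚ.≤ Y
        U≤Y i = ℚ.≤-trans (term≤ℚ∑ (λ j → 0≤ι (y j)) i) (ℚ.≤-reflexive (sym (ι-∑ y)))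
        entry : ∀ i → U i ℚ.* (ι r ℚ.* w i) ℚ.≤ U i ℚ.* Aw i ℚ.+ (½ ℚ.* w i ℚ.+ U i ℚ.* η)
        entry i = begin
          U i ℚ.* (ι r ℚ.* w i)
            ≤⟨ *-monoˡ-≤₀ (0≤ι (y i)) (rw≤ i) ⟩
          U i ℚ.* (Aw i ℚ.+ (θ ℚ.* w i ℚ.+ η))
            ≡⟨ solve 5 (λ u a t w e → u :* (a :+ (t :* w :+ e)) := u :* a :+ (t :* u :* w :+ u :* e))
                 refl (U i) (Aw i) θ (w i) η ⟩
          U i ℚ.* Aw i ℚ.+ (θ ℚ.* U i ℚ.* w i ℚ.+ U i ℚ.* η)
            ≤⟨ ℚ.+-monoʳ-≤ (U i ℚ.* Aw i) (ℚ.+-monoˡ-≤ (U i ℚ.* η) (*-monoʳ-≤₀ (0≤w i)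
                 (ℚ.≤-trans (*-monoˡ-≤₀ 0≤θ (U≤Y i)) θ-small))) ⟩
          U i ℚ.* Aw i ℚ.+ (½ ℚ.* w i ℚ.+ U i ℚ.* η) ∎

    -- Pairing y with w = |v| and using the symmetry of A, the number ⟨y, r w⟩ lies between ⟨A y, w⟩
    -- + ∑ w and ⟨A y, w⟩ + ½ ∑ w + Y η. As η tends to 0 this forces v to vanish.
    ½∑∣v∣≤ : ½ ℚ.* ℚΣ.sum (λ i → ℚ.∣ v i ∣) ℚ.≤ ι (∑ y) ℚ.* η
    ½∑∣v∣≤ = cancel-+ (½ ℚ.* W) (begin
        ½ ℚ.* W ℚ.+ ½ ℚ.* W   ≡⟨ ℚ.*-distribʳ-+ W ½ ½ ⟨
        1ℚ ℚ.* W              ≡⟨ ℚ.*-identityˡ W ⟩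
        W                     ≤⟨ cancel-+ (ℚΣ.sum (λ j → ι ((G · y) j) ℚ.* w j)) (ℚ.≤-trans lower upper) ⟩
        ½ ℚ.* W ℚ.+ Y ℚ.* η   ∎)
      where W = ℚΣ.sum w

  seq-∑ʳ : ∀ {n} (f : Fin n → ℝ) N → seq (∑ʳ f) N ≡ ℚΣ.sum (λ i → seq (f i) N)
  seq-∑ʳ {zero}  f N = refl
  seq-∑ʳ {suc n} f N = cong (seq (f zero) N ℚ.+_) (seq-∑ʳ (f ∘ suc) N)

  seq-entry : ∀ b N → seq (if b then 1ʳ else 0ʳ) N ≡ ι (𝟙 b)
  seq-entry true  N = refl
  seq-entry false N = refl

  eventually-all : ∀ {n} (P : Fin n → ℕ → Set) →
    (∀ i → ∃[ N ] ∀ m → N ℕ.≤ m → P i m) → ∃[ N ] ∀ m → N ℕ.≤ m → ∀ i → P i m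
  eventually-all {zero}  P ev = 0 , λ _ _ ()
  eventually-all {suc n} P ev =
    let N₁ , p = ev zero
        N₂ , q = eventually-all (P ∘ suc) (ev ∘ suc)
    in N₁ ⊔ N₂ , λ where
         m N≤m zero    → p m (ℕ.m⊔n≤o⇒m≤o N₁ N₂ N≤m)
         m N≤m (suc i) → q m (ℕ.m⊔n≤o⇒n≤o N₁ N₂ N≤m) i

  -- Collatz–Wielandt.
  ¬supersolution : ∀ {n} (G : Graph n) (ρ : ℝ) → IsSpectralRadius G ρ →
    (r : ℕ) → fromℤ (ℤ.+ r) ≤ʳ ρ →
    (y : Fin n → ℕ) → ¬ (∀ i → (G · y) i ℕ.< r ℕ.* y i)
  ¬supersolution {n} G ρ ((v , v≉0 , Av≈ρv) , _) r r≤ρ y y-super = v≉0 v≈0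
    where
    -- The successor makes the divisor in `scale` positive whatever y is.
    Y′ : ℚ
    Y′ = ι (suc (∑ y))
    0<Y′ : 0ℚ ℚ.< Y′
    0<Y′ = ℚ.+-mono-<-≤ (ℚ.positive⁻¹ 1ℚ) (0≤ι (∑ y))
    Y≤Y′ : ι (∑ y) ℚ.≤ Y′
    Y≤Y′ = ι-mono-≤ (ℕ.n≤1+n (∑ y))
    v≈0 : ∀ i → v i ≈ʳ 0ʳ
    v≈0 i ε 0<ε =
      -- θ makes the error from r ≤ ρ + θ cost at most half of ∑ |v|. Since Y′ η = ε / 4, the result
      -- is ∑ |v| ≤ 2 Y′ η = ε / 2 < ε.
      let θ , 0<θ , Y′θ≡½ = scale Y′ ½ 0<Y′ (ℚ.positive⁻¹ ½)
          ε₁ , 0<ε₁ , ε₁+ε₁≡ε = halve ε 0<ε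
          ε₂ , 0<ε₂ , ε₂+ε₂≡ε₁ = halve ε₁ 0<ε₁
          η , 0<η , Y′η≡ε₂ = scale Y′ ε₂ 0<Y′ 0<ε₂
          N₁ , near = eventually-all _ (λ i → Av≈ρv i η 0<η)
          N₂ , r≤ = r≤ρ θ 0<θ
      in N₁ ⊔ N₂ , λ m N≤m →
        let vₘ : Fin n → ℚ
            vₘ = λ j → seq (v j) m
            W = ℚΣ.sum (λ j → ℚ.∣ vₘ j ∣)
            close = λ j → ℚ.<⇒≤ (subst (λ z → ℚ.∣ z ℚ.- seq ρ m ℚ.* vₘ j ∣ ℚ.< η)
              (trans (seq-∑ʳ (λ l → adjacencyMatrix G j l *ʳ v l) m)
                (ℚΣ.sum-cong-≗ λ l → cong (ℚ._* vₘ l) (seq-entry (adj G j l) m)))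
              (near m (ℕ.m⊔n≤o⇒m≤o N₁ N₂ N≤m) j))
            ½W≤ = ½∑∣v∣≤ G r y y-super vₘ (seq ρ m) θ η (ℚ.<⇒≤ 0<θ) close
              (subst (ℚ._≤ seq ρ m ℚ.+ θ) (/1≡ι r) (r≤ m (ℕ.m⊔n≤o⇒n≤o N₁ N₂ N≤m)))
              (begin
                θ ℚ.* ι (∑ y) ≤⟨ *-monoˡ-≤₀ (ℚ.<⇒≤ 0<θ) Y≤Y′ ⟩
                θ ℚ.* Y′      ≡⟨ ℚ.*-comm θ Y′ ⟩
                Y′ ℚ.* θ      ≡⟨ Y′θ≡½ ⟩
                ½             ∎)
        in begin-strict
          ℚ.∣ vₘ i ℚ.- 0ℚ ∣     ≡⟨ cong ℚ.∣_∣ (ℚ.+-identityʳ (vₘ i)) ⟩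
          ℚ.∣ vₘ i ∣            ≤⟨ term≤ℚ∑ (λ j → ℚ.0≤∣p∣ (vₘ j)) i ⟩
          W                     ≡⟨ ℚ.*-identityˡ W ⟨
          1ℚ ℚ.* W              ≡⟨ ℚ.*-distribʳ-+ W ½ ½ ⟩
          ½ ℚ.* W ℚ.+ ½ ℚ.* W   ≤⟨ ℚ.+-mono-≤ ½W≤ ½W≤ ⟩
          ι (∑ y) ℚ.* η ℚ.+ ι (∑ y) ℚ.* η
            ≤⟨ ℚ.+-mono-≤ (*-monoʳ-≤₀ (ℚ.<⇒≤ 0<η) Y≤Y′) (*-monoʳ-≤₀ (ℚ.<⇒≤ 0<η) Y≤Y′) ⟩
          Y′ ℚ.* η ℚ.+ Y′ ℚ.* η ≡⟨ cong₂ ℚ._+_ Y′η≡ε₂ Y′η≡ε₂ ⟩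
          ε₂ ℚ.+ ε₂             ≡⟨ ε₂+ε₂≡ε₁ ⟩
          ε₁                    ≡⟨ ℚ.+-identityʳ ε₁ ⟨
          ε₁ ℚ.+ 0ℚ             <⟨ ℚ.+-monoʳ-< ε₁ 0<ε₁ ⟩
          ε₁ ℚ.+ ε₁             ≡⟨ ε₁+ε₁≡ε ⟩
          ε                     ∎
      where open ℚ.≤-Reasoning

  -- Counting vertices

  infix 7 _==_
  _==_ : ∀ {n} → Fin n → Fin n → Bool
  i == j = ⌊ i ≟ j ⌋

  true≢false : ∀ {b} → b ≡ true → b ≡ false → ⊥
  true≢false refl ()

  not⁻ : ∀ {b} → not b ≡ true → b ≡ false
  not⁻ {false} _ = refl

  ==-refl : ∀ {n} (i : Fin n) → (i == i) ≡ true
  ==-refl i with i ≟ i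
  ... | yes _ = refl
  ... | no ¬p = ⊥-elim (¬p refl)

  ==⇒≡ : ∀ {n} {i j : Fin n} → (i == j) ≡ true → i ≡ j
  ==⇒≡ {i = i} {j} p with i ≟ j
  ... | yes q = q

  ≢⇒== : ∀ {n} {i j : Fin n} → i ≢ j → (i == j) ≡ false
  ≢⇒== {i = i} {j} p with i ≟ j
  ... | yes q = ⊥-elim (p q)
  ... | no _ = refl

  sum-allFin : ∀ {n} (f : Fin n → ℕ) → sum (List.map f (allFin n)) ≡ ∑ f
  sum-allFin {n} f = trans (cong sum (List.map-tabulate (λ i → i) f)) (go f)
    where
    go : ∀ {n} (f : Fin n → ℕ) → sum (List.tabulate f) ≡ ∑ f
    go {zero}  f = refl
    go {suc n} f = cong (f zero +_) (go (f ∘ suc))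

  degree≡∑ : ∀ {n} (G : Graph n) v → degree G v ≡ ∑ (λ u → 𝟙 (adj G v u))
  degree≡∑ G v = sum-allFin (λ u → 𝟙 (adj G v u))

  #_ : ∀ {n} → (Fin n → Bool) → ℕ
  # P = ∑ (𝟙 ∘ P)

  ∑-mono-≤ : ∀ {n} {f g : Fin n → ℕ} → (∀ i → f i ≤ g i) → ∑ f ≤ ∑ g
  ∑-mono-≤ {zero}  f≤g = z≤n
  ∑-mono-≤ {suc n} f≤g = +-mono-≤ (f≤g zero) (∑-mono-≤ (f≤g ∘ suc))

  𝟙*≤ : ∀ b c → 𝟙 b * c ≤ c
  𝟙*≤ true  c = ≤-reflexive (+-identityʳ c)
  𝟙*≤ false c = z≤n

  ∑-const : ∀ n c → ∑ {n} (λ _ → c) ≡ n * c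
  ∑-const zero    c = refl
  ∑-const (suc n) c = cong (c +_) (∑-const n c)

  ∑-point : ∀ {n} i (f : Fin n → ℕ) → ∑ (λ j → 𝟙 (j == i) * f j) ≡ f i
  ∑-point {suc n} zero f = trans
    (cong₂ _+_ (+-identityʳ (f zero)) (∑-const n 0))
    (trans (cong (f zero +_) (*-zeroʳ n)) (+-identityʳ _))
  ∑-point (suc i) f = trans (ℕΣ.sum-cong-≗ λ j → cong (λ b → 𝟙 b * f (suc j)) (suc-== j i))
                            (∑-point i (f ∘ suc))
    where
    suc-== : ∀ {n} (j i : Fin n) → (suc j == suc i) ≡ (j == i)
    suc-== j i with j ≟ i
    ... | yes _ = refl
    ... | no _  = refl

  ∑-+₃ : ∀ {n} (f g h : Fin n → ℕ) → ∑ (λ i → f i + g i + h i) ≡ ∑ f + ∑ g + ∑ h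
  ∑-+₃ f g h = trans (ℕΣ.∑-distrib-+ (λ i → f i + g i) h) (cong (_+ ∑ h) (ℕΣ.∑-distrib-+ f g))

  #-not : ∀ {n} (P : Fin n → Bool) → # P + # (not ∘ P) ≡ n
  #-not {n} P = trans (sym (ℕΣ.∑-distrib-+ (𝟙 ∘ P) (𝟙 ∘ not ∘ P)))
    (trans (ℕΣ.sum-cong-≗ λ i → one (P i)) (trans (∑-const n 1) (*-identityʳ n)))
    where
    one : ∀ b → 𝟙 b + 𝟙 (not b) ≡ 1
    one true  = refl
    one false = refl

  -- Test vectors and vertices of low degree

  NoSupersolution : ∀ {n} → Graph n → ℕ → Set
  NoSupersolution G r = ∀ y → ¬ (∀ i → (G · y) i < r * y i)

  -- Degree below the fraction m / M of r, with the denominator cleared.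
  low : ∀ {n} → Graph n → ℕ → ℕ → ℕ → Fin n → Bool
  low G r m M i = M * degree G i <ᵇ m * r

  low⁺ : ∀ {n} (G : Graph n) r m M i → M * degree G i < m * r → low G r m M i ≡ true
  low⁺ G r m M i p with M * degree G i <ᵇ m * r | <⇒<ᵇ p
  ... | true | _ = refl

  low⁻ : ∀ {n} (G : Graph n) r m M i → low G r m M i ≡ false → m * r ≤ M * degree G i
  low⁻ G r m M i p = ≮⇒≥ λ q → true≢false (low⁺ G r m M i q) p

  -- Otherwise the vector with value m on the low vertices and m + e elsewhere is a supersolution.
  #low≤ : ∀ {r s} (G : Graph (suc (r + s))) → NoSupersolution G r →
          ∀ m e → # low G r m (m + e) * e ≤ s * (m + e)
  #low≤ {r} {s} G none m e = ≮⇒≥ λ many → none y (row many)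
    where
    M = m + e
    ℓ = low G r m M
    weight : Bool → ℕ
    weight b = if b then m else M
    y = weight ∘ ℓ
    M≡ : ∀ b → weight b + 𝟙 b * e ≡ M
    M≡ true  = cong (m +_) (+-identityʳ e)
    M≡ false = +-identityʳ M
    weight≤M : ∀ b → weight b ≤ M
    weight≤M b = ≤-trans (m≤m+n (weight b) _) (≤-reflexive (M≡ b))
    -- Adding the diagonal entry and the deficits e of the low vertices brings each of the r + s + 1
    -- entries of the row to at most M.
    total : ∀ i → (G · y) i + y i + # ℓ * e ≤ suc (r + s) * M
    total i = begin
      (G · y) i + y i + # ℓ * e
        ≡⟨ cong₂ (λ a b → (G · y) i + a + b) (sym (∑-point i y)) (ℕΣ.*-distribʳ-sum e (𝟙 ∘ ℓ)) ⟩
      (G · y) i + ∑ (λ j → 𝟙 (j == i) * y j) + ∑ (λ j → 𝟙 (ℓ j) * e)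
        ≡⟨ ∑-+₃ (λ j → 𝟙 (adj G i j) * y j) (λ j → 𝟙 (j == i) * y j) (λ j → 𝟙 (ℓ j) * e) ⟨
      ∑ (λ j → 𝟙 (adj G i j) * y j + 𝟙 (j == i) * y j + 𝟙 (ℓ j) * e)
        ≤⟨ ∑-mono-≤ pointwise ⟩
      ∑ {suc (r + s)} (λ _ → M)
        ≡⟨ ∑-const (suc (r + s)) M ⟩
      suc (r + s) * M ∎
      where
      open ≤-Reasoning
      pointwise : ∀ j → 𝟙 (adj G i j) * y j + 𝟙 (j == i) * y j + 𝟙 (ℓ j) * e ≤ M
      pointwise j with j ≟ i
      ... | yes refl rewrite irreflexive G j | +-identityʳ (y j) = ≤-reflexive (M≡ (ℓ j))
      ... | no _ rewrite +-identityʳ (𝟙 (adj G i j) * y j) =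
        ≤-trans (+-monoˡ-≤ _ (𝟙*≤ (adj G i j) (y j))) (≤-reflexive (M≡ (ℓ j)))
    row : s * M < # ℓ * e → ∀ i → (G · y) i < r * y i
    row many i with ℓ i in eq | total i
    -- At a vertex of weight M the deficits exceed s M, so `total` leaves less than r M for the row.
    ... | false | t = +-cancelʳ-< (M + s * M) _ _ (begin-strict
        (G · y) i + (M + s * M)   ≡⟨ +-assoc ((G · y) i) M (s * M) ⟨
        (G · y) i + M + s * M     <⟨ +-monoʳ-< ((G · y) i + M) many ⟩
        (G · y) i + M + # ℓ * e   ≤⟨ t ⟩
        suc (r + s) * M           ≡⟨ solve 3 (λ r s M → (con 1 :+ (r :+ s)) :* M := r :* M :+ (M :+ s :* M)) refl r s M ⟩
        r * M + (M + s * M)       ∎)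
      where open ≤-Reasoning
            open +-*-Solver
    -- At a low vertex the degree alone suffices: the row is at most M times the degree.
    ... | true | _ = begin-strict
        (G · y) i                          ≤⟨ ∑-mono-≤ (λ j → *-monoʳ-≤ (𝟙 (adj G i j)) (weight≤M (ℓ j))) ⟩
        ∑ (λ j → 𝟙 (adj G i j) * M)        ≡⟨ ℕΣ.*-distribʳ-sum M (λ j → 𝟙 (adj G i j)) ⟨
        ∑ (λ j → 𝟙 (adj G i j)) * M        ≡⟨ cong (_* M) (degree≡∑ G i) ⟨
        degree G i * M                     ≡⟨ *-comm (degree G i) M ⟩
        M * degree G i                     <⟨ <ᵇ⇒< (M * degree G i) (m * r) (subst T (sym eq) _) ⟩
        m * r                              ≡⟨ *-comm m r ⟩
        r * m ∎
      where open ≤-Reasoning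

  -- The missing edge ab lowers the weights of a and b by x, which outweighs
  -- the total contribution s·D of the vertices outside B.
  module _ {r s} (G : Graph (suc (r + s))) (none : NoSupersolution G r)
           (B : Fin (suc (r + s)) → Bool) (#B : # B ≡ suc r) (D : ℕ)
           (deg≤D : ∀ v → B v ≡ false → degree G v ≤ D)
           (x τ K : ℕ) (sD<x : s * D < x) (τ≤q : τ ≤ suc r) (K≡ : K ≡ suc r * x)
           (τ-large : D * (K + x + s + τ) < r * τ)
    where
    private
      q : ℕ
      q = suc r

      #T : # (not ∘ B) ≡ s
      #T = +-cancelˡ-≡ (suc r) _ _ (trans (cong (_+ # (not ∘ B)) (sym #B)) (#-not B))

      dT : Fin (suc (r + s)) → ℕ
      dT v = ∑ (λ j → 𝟙 (adj G v j) * 𝟙 (not (B j)))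

      dT≤s : ∀ v → dT v ≤ s
      dT≤s v = ≤-trans (∑-mono-≤ λ j → 𝟙*≤ (adj G v j) (𝟙 (not (B j)))) (≤-reflexive #T)

      ∑dT≤ : ∑ dT ≤ s * D
      ∑dT≤ = begin
        ∑ dT
          ≡⟨ ℕΣ.∑-comm (λ v j → 𝟙 (adj G v j) * 𝟙 (not (B j))) ⟩
        ∑ (λ j → ∑ (λ v → 𝟙 (adj G v j) * 𝟙 (not (B j))))
          ≡⟨ ℕΣ.sum-cong-≗ (λ j → ℕΣ.sum-cong-≗ (λ v → trans
               (*-comm (𝟙 (adj G v j)) (𝟙 (not (B j)))) (cong (λ b → 𝟙 (not (B j)) * 𝟙 b) (symmetric G v j)))) ⟩
        ∑ (λ j → ∑ (λ v → 𝟙 (not (B j)) * 𝟙 (adj G j v)))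
          ≡⟨ ℕΣ.sum-cong-≗ (λ j → trans (sym (ℕΣ.*-distribˡ-sum (𝟙 (not (B j))) (λ v → 𝟙 (adj G j v))))
               (cong (𝟙 (not (B j)) *_) (sym (degree≡∑ G j)))) ⟩
        ∑ (λ j → 𝟙 (not (B j)) * degree G j)
          ≤⟨ ∑-mono-≤ bound ⟩
        ∑ (λ j → 𝟙 (not (B j)) * D)
          ≡⟨ ℕΣ.*-distribʳ-sum D (λ j → 𝟙 (not (B j))) ⟨
        # (not ∘ B) * D
          ≡⟨ cong (_* D) #T ⟩
        s * D ∎
        where
        open ≤-Reasoning
        bound : ∀ j → 𝟙 (not (B j)) * degree G j ≤ 𝟙 (not (B j)) * D
        bound j with B j in eq
        ... | true  = z≤n
        ... | false = *-monoʳ-≤ 1 (deg≤D j eq)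

      module Missing {a b} (a≢b : a ≢ b) (Ba : B a ≡ true) (Bb : B b ≡ true)
                     (a≁b : adj G a b ≡ false) where

        bonus : Bool → Bool → ℕ
        bonus true  _     = 0
        bonus false true  = 0
        bonus false false = x

        -- A perturbed constant vector on B. A row gains dT τ from the neighbours outside B; raising
        -- the entry by dT pays for this, because τ ≤ q = r + 1. All vertices of B except a and b
        -- also receive the surplus x.
        yB : Fin (suc (r + s)) → ℕ
        yB j = K + (dT j + bonus (j == a) (j == b))

        y : Fin (suc (r + s)) → ℕ
        y j = if B j then yB j else τ

        S : ℕ
        S = ∑ (λ j → 𝟙 (B j) * y j)

        bonus≤x : ∀ b c → bonus b c ≤ x
        bonus≤x true  _     = z≤n
        bonus≤x false true  = z≤n
        bonus≤x false false = ≤-refl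

        S-entry : ∀ β α₁ α₂ d → (α₁ ≡ true → β ≡ true) → (α₂ ≡ true → β ≡ true) →
          (α₁ ≡ true → α₂ ≡ true → ⊥) →
          𝟙 β * (if β then K + (d + bonus α₁ α₂) else τ) + 𝟙 α₁ * x + 𝟙 α₂ * x ≤ 𝟙 β * (K + x) + d
        S-entry true true true d _ _ f = ⊥-elim (f refl refl)
        S-entry true true false d _ _ _ = ≤-reflexive (solve 3
          (λ K d x → con 1 :* (K :+ (d :+ con 0)) :+ con 1 :* x :+ con 0 := con 1 :* (K :+ x) :+ d)
          refl K d x)
          where open +-*-Solver
        S-entry true false true d _ _ _ = ≤-reflexive (solve 3
          (λ K d x → con 1 :* (K :+ (d :+ con 0)) :+ con 0 :+ con 1 :* x := con 1 :* (K :+ x) :+ d)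
          refl K d x)
          where open +-*-Solver
        S-entry true false false d _ _ _ = ≤-reflexive (solve 3
          (λ K d x → con 1 :* (K :+ (d :+ x)) :+ con 0 :+ con 0 := con 1 :* (K :+ x) :+ d)
          refl K d x)
          where open +-*-Solver
        S-entry false true _ d f _ _ with () ← f refl
        S-entry false false true d _ f _ with () ← f refl
        S-entry false false false d _ _ _ = z≤n

        S-bound : S + x + x ≤ q * (K + x) + s * D
        S-bound = begin
          S + x + x
            ≡⟨ cong₂ (λ c d → S + c + d) (∑-point a (λ _ → x)) (∑-point b (λ _ → x)) ⟨
          S + ∑ (λ j → 𝟙 (j == a) * x) + ∑ (λ j → 𝟙 (j == b) * x)
            ≡⟨ ∑-+₃ (λ j → 𝟙 (B j) * y j) (λ j → 𝟙 (j == a) * x) (λ j → 𝟙 (j == b) * x) ⟨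
          ∑ (λ j → 𝟙 (B j) * y j + 𝟙 (j == a) * x + 𝟙 (j == b) * x)
            ≤⟨ ∑-mono-≤ pointwise ⟩
          ∑ (λ j → 𝟙 (B j) * (K + x) + dT j)
            ≡⟨ ℕΣ.∑-distrib-+ (λ j → 𝟙 (B j) * (K + x)) dT ⟩
          ∑ (λ j → 𝟙 (B j) * (K + x)) + ∑ dT
            ≡⟨ cong (_+ ∑ dT) (trans (sym (ℕΣ.*-distribʳ-sum (K + x) (𝟙 ∘ B))) (cong (_* (K + x)) #B)) ⟩
          q * (K + x) + ∑ dT
            ≤⟨ +-monoʳ-≤ (q * (K + x)) ∑dT≤ ⟩
          q * (K + x) + s * D ∎
          where
          open ≤-Reasoning
          pointwise : ∀ j → 𝟙 (B j) * y j + 𝟙 (j == a) * x + 𝟙 (j == b) * x ≤ 𝟙 (B j) * (K + x) + dT j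
          pointwise j = S-entry (B j) (j == a) (j == b) (dT j)
            (λ p → subst (λ i → B i ≡ true) (sym (==⇒≡ p)) Ba)
            (λ p → subst (λ i → B i ≡ true) (sym (==⇒≡ p)) Bb)
            (λ p p′ → a≢b (trans (sym (==⇒≡ p)) (==⇒≡ p′)))

        -- Withholding the surplus at a and b saves 2 x, whereas the corrections dT add at most s D
        -- < x in total.
        S< : S < q * (K + x)
        S< = +-cancelʳ-< (s * D) _ _ (begin-strict
          S + s * D         <⟨ +-monoʳ-< S sD<x ⟩
          S + x             ≤⟨ m≤m+n (S + x) x ⟩
          S + x + x         ≤⟨ S-bound ⟩
          q * (K + x) + s * D ∎)
          where open ≤-Reasoning

        row : ∀ v (w : Fin (suc (r + s)) → ℕ) →
              (∀ j → 𝟙 (adj G v j) * y j + w j ≤ 𝟙 (B j) * y j + 𝟙 (adj G v j) * 𝟙 (not (B j)) * τ) →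
              (G · y) v + ∑ w ≤ S + dT v * τ
        row v w pointwise = begin
          (G · y) v + ∑ w
            ≡⟨ ℕΣ.∑-distrib-+ (λ j → 𝟙 (adj G v j) * y j) w ⟨
          ∑ (λ j → 𝟙 (adj G v j) * y j + w j)
            ≤⟨ ∑-mono-≤ pointwise ⟩
          ∑ (λ j → 𝟙 (B j) * y j + 𝟙 (adj G v j) * 𝟙 (not (B j)) * τ)
            ≡⟨ ℕΣ.∑-distrib-+ (λ j → 𝟙 (B j) * y j) (λ j → 𝟙 (adj G v j) * 𝟙 (not (B j)) * τ) ⟩
          S + ∑ (λ j → 𝟙 (adj G v j) * 𝟙 (not (B j)) * τ)
            ≡⟨ cong (S +_) (ℕΣ.*-distribʳ-sum τ (λ j → 𝟙 (adj G v j) * 𝟙 (not (B j)))) ⟨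
          S + dT v * τ ∎
          where open ≤-Reasoning

        entry : ∀ v j → 𝟙 (adj G v j) * y j ≤ 𝟙 (B j) * y j + 𝟙 (adj G v j) * 𝟙 (not (B j)) * τ
        entry v j with adj G v j | B j
        ... | false | _     = z≤n
        ... | true  | true  = m≤m+n _ _
        ... | true  | false = ≤-refl

        B-row : ∀ v → B v ≡ true → (G · y) v + y v ≤ S + dT v * τ
        B-row v Bv = ≤-trans (≤-reflexive (cong ((G · y) v +_) (sym (∑-point v y))))
            (row v (λ j → 𝟙 (j == v) * y j) λ j → pointwise (adj G v j) (B j) (j == v) (y j)
              (λ p → subst (λ i → adj G v i ≡ false) (sym (==⇒≡ p)) (irreflexive G v))
              (λ p → subst (λ i → B i ≡ true) (sym (==⇒≡ p)) Bv) (entry v j))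
          where
          pointwise : ∀ α β γ c {d} → (γ ≡ true → α ≡ false) → (γ ≡ true → β ≡ true) →
            𝟙 α * c ≤ 𝟙 β * c + d → 𝟙 α * c + 𝟙 γ * c ≤ 𝟙 β * c + d
          pointwise α β false c _ _ h = ≤-trans (≤-reflexive (+-identityʳ (𝟙 α * c))) h
          pointwise α β true  c f g _ rewrite f refl | g refl = m≤m+n _ _

        nonadjacent-row : ∀ {v w} → v ≢ w → adj G v w ≡ false → B v ≡ true → B w ≡ true →
                (G · y) v + (y v + y w) ≤ S + dT v * τ
        nonadjacent-row {v} {w} v≢w v≁w Bv Bw = ≤-trans (≤-reflexive (cong ((G · y) v +_)
            (sym (trans (ℕΣ.∑-distrib-+ (λ j → 𝟙 (j == v) * y j) (λ j → 𝟙 (j == w) * y j))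
              (cong₂ _+_ (∑-point v y) (∑-point w y))))))
            (row v (λ j → 𝟙 (j == v) * y j + 𝟙 (j == w) * y j) λ j →
              pointwise (adj G v j) (B j) (j == v) (j == w) (y j)
              (λ p → subst (λ i → adj G v i ≡ false) (sym (==⇒≡ p)) (irreflexive G v))
              (λ p → subst (λ i → adj G v i ≡ false) (sym (==⇒≡ p)) v≁w)
              (λ p → subst (λ i → B i ≡ true) (sym (==⇒≡ p)) Bv)
              (λ p → subst (λ i → B i ≡ true) (sym (==⇒≡ p)) Bw)
              (λ p p′ → v≢w (trans (sym (==⇒≡ p)) (==⇒≡ p′))) (entry v j))
          where
          pointwise : ∀ α β γ δ c {d} → (γ ≡ true → α ≡ false) → (δ ≡ true → α ≡ false) →
            (γ ≡ true → β ≡ true) → (δ ≡ true → β ≡ true) → (γ ≡ true → δ ≡ true → ⊥) →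
            𝟙 α * c ≤ 𝟙 β * c + d → 𝟙 α * c + (𝟙 γ * c + 𝟙 δ * c) ≤ 𝟙 β * c + d
          pointwise α β false false c _ _ _ _ _ h = ≤-trans (≤-reflexive (+-identityʳ (𝟙 α * c))) h
          pointwise α β true false c f _ g _ _ _ rewrite f refl | g refl | +-identityʳ (c + 0) = m≤m+n _ _
          pointwise α β false true c _ f _ g _ _ rewrite f refl | g refl = m≤m+n _ _
          pointwise α β true true c _ _ _ _ h _ = ⊥-elim (h refl refl)

        y≤ : ∀ j → y j ≤ K + x + s + τ
        y≤ j with B j
        ... | true  = ≤-trans (+-monoʳ-≤ K (+-mono-≤ (dT≤s j) (bonus≤x (j == a) (j == b))))
                (≤-trans (≤-reflexive (solve 3 (λ K s x → K :+ (s :+ x) := K :+ x :+ s) refl K s x)) (m≤m+n _ τ))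
          where open +-*-Solver
        ... | false = m≤n+m τ (K + x + s)

        T-row : ∀ v → B v ≡ false → (G · y) v < r * τ
        T-row v Bv = begin-strict
          (G · y) v
            ≤⟨ ∑-mono-≤ (λ j → *-monoʳ-≤ (𝟙 (adj G v j)) (y≤ j)) ⟩
          ∑ (λ j → 𝟙 (adj G v j) * (K + x + s + τ))
            ≡⟨ ℕΣ.*-distribʳ-sum (K + x + s + τ) (λ j → 𝟙 (adj G v j)) ⟨
          ∑ (λ j → 𝟙 (adj G v j)) * (K + x + s + τ)
            ≡⟨ cong (_* (K + x + s + τ)) (degree≡∑ G v) ⟨
          degree G v * (K + x + s + τ)
            ≤⟨ *-monoˡ-≤ (K + x + s + τ) (deg≤D v Bv) ⟩
          D * (K + x + s + τ)
            <⟨ τ-large ⟩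
          r * τ ∎
          where open ≤-Reasoning

        -- An end of the missing edge has no surplus, which costs q x in the comparison. In return
        -- its row lacks the entry of the other end, which is at least K; this is why K = q x.
        low-row : ∀ {v w} → v ≢ w → adj G v w ≡ false → B v ≡ true → B w ≡ true →
                  y v ≡ K + (dT v + 0) → K ≤ y w → (G · y) v < r * y v
        low-row {v} {w} v≢w v≁w Bv Bw yv≡ K≤yw = +-cancelʳ-< (y v + y w) _ _ (begin-strict
          (G · y) v + (y v + y w)
            ≤⟨ nonadjacent-row v≢w v≁w Bv Bw ⟩
          S + dT v * τ
            <⟨ +-mono-<-≤ S< (*-monoʳ-≤ (dT v) τ≤q) ⟩
          q * (K + x) + dT v * q
            ≡⟨ solve 4 (λ q K x d → q :* (K :+ x) :+ d :* q := q :* (K :+ (d :+ con 0)) :+ q :* x) refl q K x (dT v) ⟩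
          q * (K + (dT v + 0)) + q * x
            ≡⟨ cong (q * (K + (dT v + 0)) +_) K≡ ⟨
          q * (K + (dT v + 0)) + K
            ≡⟨ cong (λ z → q * z + K) yv≡ ⟨
          q * y v + K
            ≤⟨ +-monoʳ-≤ (q * y v) K≤yw ⟩
          q * y v + y w
            ≡⟨ solve 3 (λ r y z → (con 1 :+ r) :* y :+ z := r :* y :+ (y :+ z)) refl r (y v) (y w) ⟩
          r * y v + (y v + y w) ∎)
          where open ≤-Reasoning
                open +-*-Solver

        y≡yB : ∀ v → B v ≡ true → y v ≡ yB v
        y≡yB v = cong (λ β → if β then yB v else τ)

        K≤y : ∀ v → B v ≡ true → K ≤ y v
        K≤y v Bv = ≤-trans (m≤m+n K _) (≤-reflexive (sym (y≡yB v Bv)))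

        no-bonusʳ : ∀ β → bonus β true ≡ 0
        no-bonusʳ true  = refl
        no-bonusʳ false = refl

        supersolution : ∀ v → (G · y) v < r * y v
        supersolution v = split (v ≟ a) (v ≟ b)
          where
          split : Dec (v ≡ a) → Dec (v ≡ b) → (G · y) v < r * y v
          split (yes refl) _ = low-row a≢b a≁b Ba Bb
            (trans (y≡yB a Ba) (cong (λ z → K + (dT a + z)) (cong (λ β → bonus β (a == b)) (==-refl a))))
            (K≤y b Bb)
          split (no _) (yes refl) = low-row (a≢b ∘ sym) (trans (symmetric G b a) a≁b) Bb Ba
            (trans (y≡yB b Bb) (cong (λ z → K + (dT b + z))
              (trans (cong (bonus (b == a)) (==-refl b)) (no-bonusʳ (b == a)))))
            (K≤y a Ba)
          split (no v≢a) (no v≢b) = generic (B v) refl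
            where
            yv≡ : B v ≡ true → y v ≡ K + (dT v + x)
            yv≡ Bv = trans (y≡yB v Bv) (cong (λ z → K + (dT v + z)) (cong₂ bonus (≢⇒== v≢a) (≢⇒== v≢b)))
            generic : ∀ β → B v ≡ β → (G · y) v < r * y v
            generic false Bv = subst (λ z → (G · y) v < r * z)
              (sym (cong (λ β → if β then yB v else τ) Bv)) (T-row v Bv)
            generic true Bv = +-cancelʳ-< (y v) _ _ (begin-strict
              (G · y) v + y v
                ≤⟨ B-row v Bv ⟩
              S + dT v * τ
                <⟨ +-mono-<-≤ S< (*-monoʳ-≤ (dT v) τ≤q) ⟩
              q * (K + x) + dT v * q
                ≡⟨ solve 4 (λ r K x d → (con 1 :+ r) :* (K :+ x) :+ d :* (con 1 :+ r) :=
                     r :* (K :+ (d :+ x)) :+ (K :+ (d :+ x))) refl r K x (dT v) ⟩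
              r * (K + (dT v + x)) + (K + (dT v + x))
                ≡⟨ cong (λ z → r * z + z) (yv≡ Bv) ⟨
              r * y v + y v ∎)
              where
              open ≤-Reasoning
              open +-*-Solver

    supersolution⇒adjacent : ∀ {a b} → a ≢ b → B a ≡ true → B b ≡ true → Adj G a b
    supersolution⇒adjacent {a} {b} a≢b Ba Bb with adj G a b in a≁b
    ... | true  = refl
    ... | false = ⊥-elim (none _ (Missing.supersolution a≢b Ba Bb a≁b))

  -- The parameters are as small as the argument permits. x exceeds s D, the total of the
  -- corrections. τ exceeds D x, since a row outside B is about D K = D (r + 1) x and must stay
  -- below r τ. For large r the condition τ ≤ r + 1 then holds as well.
  clique : ∀ {r s} (G : Graph (suc (r + s))) → NoSupersolution G r →
    (B : Fin (suc (r + s)) → Bool) → # B ≡ suc r →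
    (D : ℕ) → (∀ v → B v ≡ false → degree G v ≤ D) →
    (let x = suc (s * D); τ = suc (D * x)) → D * x + D * s + suc D * τ < suc r →
    ∀ {a b} → a ≢ b → B a ≡ true → B b ≡ true → Adj G a b
  clique {r} {s} G none B #B D deg≤D large =
    supersolution⇒adjacent G none B #B D deg≤D x τ (suc r * x) (n<1+n (s * D))
      (<⇒≤ (≤-<-trans (≤-trans (m≤m+n τ (D * τ)) (m≤n+m (suc D * τ) (D * x + D * s))) large))
      refl (arith D s r x large)
    where
    open ≤-Reasoning
    open +-*-Solver
    x = suc (s * D)
    τ = suc (D * x)
    arith : ∀ D s r x → D * x + D * s + suc D * suc (D * x) < suc r →
      D * (suc r * x + x + s + suc (D * x)) < r * suc (D * x)
    arith D s r x large = +-cancelʳ-< (suc (D * x)) _ _ (begin-strict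
      D * (suc r * x + x + s + suc (D * x)) + suc (D * x)
        ≡⟨ solve 4 (λ D r x s → let τ = con 1 :+ D :* x in
             D :* ((con 1 :+ r) :* x :+ x :+ s :+ τ) :+ τ :=
             (con 1 :+ r) :* (D :* x) :+ (D :* x :+ D :* s :+ (con 1 :+ D) :* τ)) refl D r x s ⟩
      suc r * (D * x) + (D * x + D * s + suc D * suc (D * x))
        <⟨ +-monoʳ-< (suc r * (D * x)) large ⟩
      suc r * (D * x) + suc r
        ≡⟨ solve 2 (λ r z → (con 1 :+ r) :* z :+ (con 1 :+ r) := r :* (con 1 :+ z) :+ (con 1 :+ z)) refl r (D * x) ⟩
      r * suc (D * x) + suc (D * x) ∎)

  -- Lists of vertices as paths

  -- An inductive predicate rather than positions in the list: paths are cut and joined by pattern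
  -- matching on it.
  data Next {A : Set} (a b : A) : List A → Set where
    here  : ∀ {xs} → Next a b (a ∷ b ∷ xs)
    there : ∀ {x xs} → Next a b xs → Next a b (x ∷ xs)

  data Last {A : Set} (a : A) : List A → Set where
    here  : Last a (a ∷ [])
    there : ∀ {x xs} → Last a xs → Last a (x ∷ xs)

  Next± : {A : Set} → A → A → List A → Set
  Next± a b xs = Next a b xs ⊎ Next b a xs

  module _ {A : Set} where

    Next-source : ∀ {a b} {xs : List A} → Next a b xs → a ∈ xs
    Next-source here      = here refl
    Next-source (there p) = there (Next-source p)

    Next-target : ∀ {a b x} {xs : List A} → Next a b (x ∷ xs) → b ∈ xs
    Next-target here      = here refl
    Next-target {xs = _ ∷ _} (there p) = there (Next-target p)

    Last-∈ : ∀ {a} {xs : List A} → Last a xs → a ∈ xs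
    Last-∈ here      = here refl
    Last-∈ (there p) = there (Last-∈ p)

    Last-functional : ∀ {a b} {xs : List A} → Last a xs → Last b xs → a ≡ b
    Last-functional here      here      = refl
    Last-functional (there p) (there q) = Last-functional p q
    Last-functional here (there ())
    Last-functional (there ()) here

    Last-++⁺ : ∀ {a} xs {ys : List A} → Last a ys → Last a (xs ++ ys)
    Last-++⁺ []       p = p
    Last-++⁺ (x ∷ xs) p = there (Last-++⁺ xs p)

    Last-++⁻ : ∀ {a} xs {y} {ys : List A} → Last a (xs ++ y ∷ ys) → Last a (y ∷ ys)
    Last-++⁻ []            p         = p
    Last-++⁻ (x ∷ [])      (there p) = p
    Last-++⁻ (x ∷ z ∷ xs)  (there p) = Last-++⁻ (z ∷ xs) p

    Last-reverse : ∀ {a} (xs : List A) → Last a (reverse (a ∷ xs))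
    Last-reverse {a} xs = subst (Last a) (sym (List.unfold-reverse a xs)) (Last-++⁺ (reverse xs) here)

    reverse-Last : ∀ {a} (xs : List A) → Last a xs → ∃[ ys ] reverse xs ≡ a ∷ ys
    reverse-Last (x ∷ []) here = [] , refl
    reverse-Last (x ∷ xs) (there p) with reverse-Last xs p
    ... | ys , eq = ys ++ x ∷ [] , trans (List.unfold-reverse x xs) (cong (_++ x ∷ []) eq)

    Last-exists : ∀ x (xs : List A) → ∃[ a ] Last a (x ∷ xs)
    Last-exists x []       = x , here
    Last-exists x (y ∷ xs) with Last-exists y xs
    ... | a , p = a , there p

    Next-++⁺ˡ : ∀ {a b} {xs : List A} ys → Next a b xs → Next a b (xs ++ ys)
    Next-++⁺ˡ ys here      = here
    Next-++⁺ˡ ys (there p) = there (Next-++⁺ˡ ys p)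

    Next-++⁺ʳ : ∀ {a b} xs {ys : List A} → Next a b ys → Next a b (xs ++ ys)
    Next-++⁺ʳ []       p = p
    Next-++⁺ʳ (x ∷ xs) p = there (Next-++⁺ʳ xs p)

    Next-join : ∀ {a y} {xs ys : List A} → Last a xs → Next a y (xs ++ y ∷ ys)
    Next-join here      = here
    Next-join (there p) = there (Next-join p)

    Next-++⁻ : ∀ {a b y} xs {ys : List A} → Next a b (xs ++ y ∷ ys) →
               Next a b xs ⊎ (Last a xs × b ≡ y) ⊎ Next a b (y ∷ ys)
    Next-++⁻ []           p         = inj₂ (inj₂ p)
    Next-++⁻ (x ∷ [])     here      = inj₂ (inj₁ (here , refl))
    Next-++⁻ (x ∷ [])     (there p) = inj₂ (inj₂ p)
    Next-++⁻ (x ∷ z ∷ xs) here      = inj₁ here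
    Next-++⁻ (x ∷ z ∷ xs) (there p) with Next-++⁻ (z ∷ xs) p
    ... | inj₁ q              = inj₁ (there q)
    ... | inj₂ (inj₁ (l , e)) = inj₂ (inj₁ (there l , e))
    ... | inj₂ (inj₂ q)       = inj₂ (inj₂ q)

    Next-reverse : ∀ {a b} {xs : List A} → Next a b xs → Next b a (reverse xs)
    Next-reverse {a} {b} {xs = .a ∷ .b ∷ xs} here =
      subst (Next b a) (sym (List.unfold-reverse a (b ∷ xs))) (Next-join (Last-reverse xs))
    Next-reverse {a} {b} {xs = x ∷ xs} (there p) =
      subst (Next b a) (sym (List.unfold-reverse x xs)) (Next-++⁺ˡ (x ∷ []) (Next-reverse p))

    Next-reverse⁻ : ∀ {a b} {xs : List A} → Next a b (reverse xs) → Next b a xs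
    Next-reverse⁻ {a} {b} {xs} p = subst (Next b a) (List.reverse-involutive xs) (Next-reverse p)

    Next-cut : ∀ {x y u} {ts : List A} → Next x y (u ∷ ts) →
               ∃[ cs ] ∃[ bs ] ts ≡ cs ++ y ∷ bs × Last x (u ∷ cs)
    Next-cut {ts = _ ∷ bs} here = [] , bs , refl , here
    Next-cut {ts = w ∷ ts} (there p) with Next-cut p
    ... | cs , bs , refl , l = w ∷ cs , bs , refl , there l

    successor : ∀ {v w} {xs : List A} → Last v xs → w ∈ xs → w ≢ v → ∃[ z ] Next w z xs
    successor here      (here refl) w≢v = ⊥-elim (w≢v refl)
    successor {xs = _ ∷ z ∷ _} (there l) (here refl) w≢v = z , here
    successor (there l) (there p)   w≢v with successor l p w≢v
    ... | z , q = z , there q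

    predecessor : ∀ {u w} {xs : List A} → w ∈ xs → ∃[ x ] Next x w (u ∷ xs)
    predecessor (here refl) = _ , here
    predecessor (there p) with predecessor p
    ... | x , q = x , there q

    Unique-resp-↭ : ∀ {xs ys : List A} → xs ↭ ys → Unique xs → Unique ys
    Unique-resp-↭ p = ↭ₛ.Unique-resp-↭ (setoid A) (↭⇒↭ₛ p)

    Unique-head : ∀ {x} {xs : List A} → Unique (x ∷ xs) → x ∉ xs
    Unique-head (x∉ ∷ _) x∈ = All.lookup x∉ x∈ refl

  -- Sums over the steps of a path

  module _ {A : Set} where

    pairSum : (A → A → ℕ) → List A → ℕ
    pairSum f (x ∷ y ∷ xs) = f x y + pairSum f (y ∷ xs)
    pairSum f (_ ∷ [])     = 0
    pairSum f []           = 0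

    pairSum-zero : ∀ xs → pairSum (λ _ _ → 0) xs ≡ 0
    pairSum-zero []           = refl
    pairSum-zero (_ ∷ [])     = refl
    pairSum-zero (_ ∷ y ∷ xs) = pairSum-zero (y ∷ xs)

    pairSum-target : ∀ (g : A → ℕ) x xs → pairSum (λ _ y → g y) (x ∷ xs) ≡ sum (List.map g xs)
    pairSum-target g x []       = refl
    pairSum-target g x (y ∷ xs) = cong (g y +_) (pairSum-target g y xs)

    pairSum-source : ∀ (g : A → ℕ) {v xs} → Last v xs →
      pairSum (λ x _ → g x) xs + g v ≡ sum (List.map g xs)
    pairSum-source g here = sym (+-identityʳ _)
    pairSum-source g {v} {x ∷ y ∷ xs} (there l) =
      trans (+-assoc (g x) _ (g v)) (cong (g x +_) (pairSum-source g l))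

    pairSum-+ : ∀ (f g : A → A → ℕ) xs → pairSum (λ x y → f x y + g x y) xs ≡ pairSum f xs + pairSum g xs
    pairSum-+ f g []           = refl
    pairSum-+ f g (_ ∷ [])     = refl
    pairSum-+ f g (x ∷ y ∷ xs) = trans (cong (f x y + g x y +_) (pairSum-+ f g (y ∷ xs)))
      (solve 4 (λ a b c d → a :+ b :+ (c :+ d) := a :+ c :+ (b :+ d)) refl
        (f x y) (g x y) (pairSum f (y ∷ xs)) (pairSum g (y ∷ xs)))
      where open +-*-Solver

    pairSum-mono : ∀ {f g : A → A → ℕ} xs → (∀ {x y} → Next x y xs → f x y ≤ g x y) →
                   pairSum f xs ≤ pairSum g xs
    pairSum-mono []           h = z≤n
    pairSum-mono (_ ∷ [])     h = z≤n
    pairSum-mono (x ∷ y ∷ xs) h = +-mono-≤ (h here) (pairSum-mono (y ∷ xs) (h ∘ there))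

    -- Termwise inequalities whose sums agree leave no slack in any term. This is the source of the
    -- rigidity in `Tight`.
    pairSum-tight : ∀ {f g : A → A → ℕ} xs → (∀ {x y} → Next x y xs → f x y ≤ g x y) →
                    pairSum g xs ≤ pairSum f xs → ∀ {x y} → Next x y xs → g x y ≤ f x y
    pairSum-tight {f} {g} (x ∷ y ∷ xs) h s here =
      +-cancelʳ-≤ (pairSum f (y ∷ xs)) _ _
        (≤-trans (+-monoʳ-≤ (g x y) (pairSum-mono (y ∷ xs) (h ∘ there))) s)
    pairSum-tight {f} {g} (x ∷ y ∷ xs) h s (there p) = pairSum-tight (y ∷ xs) (h ∘ there)
      (+-cancelˡ-≤ (f x y) _ _ (≤-trans (+-monoˡ-≤ (pairSum g (y ∷ xs)) (h here)) s)) p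

    -- The dichotomy of the crossing argument: a and b stand for "y is a neighbour of u" and "x is a
    -- neighbour of v", c for a step that must be kept.
    search : (a b c : A → A → Bool) → ∀ xs →
      (∃[ x ] ∃[ y ] Next x y xs × a x y ≡ true × b x y ≡ true × c x y ≡ false) ⊎
      (∀ {x y} → Next x y xs → 𝟙 (a x y) + 𝟙 (b x y) ≤ 1 + 𝟙 (c x y))
    search a b c [] = inj₂ λ ()
    search a b c (_ ∷ []) = inj₂ λ { (there ()) }
    search a b c (x ∷ y ∷ xs) with search a b c (y ∷ xs)
    ... | inj₁ (x′ , y′ , p , q) = inj₁ (x′ , y′ , there p , q)
    ... | inj₂ rest with decide (a x y) (b x y) (c x y)
      where
      𝟙≤1 : ∀ d → 𝟙 d ≤ 1
      𝟙≤1 true  = ≤-refl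
      𝟙≤1 false = z≤n
      decide : ∀ α β γ → (α ≡ true × β ≡ true × γ ≡ false) ⊎ (𝟙 α + 𝟙 β ≤ 1 + 𝟙 γ)
      decide true  true  false = inj₁ (refl , refl , refl)
      decide true  true  true  = inj₂ ≤-refl
      decide true  false γ     = inj₂ (m≤m+n 1 (𝟙 γ))
      decide false β     γ     = inj₂ (≤-trans (𝟙≤1 β) (m≤m+n 1 (𝟙 γ)))
    ...   | inj₁ q = inj₁ (x , y , here , q)
    ...   | inj₂ q = inj₂ λ { here → q ; (there p) → rest p }

  Edges : ℕ → Set
  Edges n = List (Fin n × Fin n)



  isEdge : ∀ {n} → Fin n × Fin n → Fin n → Fin n → Bool
  isEdge (a , b) x y = (a == x ∧ b == y) or (a == y ∧ b == x)

  inEdges : ∀ {n} → Edges n → Fin n → Fin n → Bool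
  inEdges []      x y = false
  inEdges (e ∷ E) x y = isEdge e x y or inEdges E x y

  isEdge-sym : ∀ {n} (e : Fin n × Fin n) x y → isEdge e x y ≡ isEdge e y x
  isEdge-sym (a , b) x y = Bool.∨-comm (a == x ∧ b == y) (a == y ∧ b == x)

  inEdges-sym : ∀ {n} (E : Edges n) x y → inEdges E x y ≡ inEdges E y x
  inEdges-sym []      x y = refl
  inEdges-sym (e ∷ E) x y = cong₂ _or_ (isEdge-sym e x y) (inEdges-sym E x y)

  ∈⇒inEdges : ∀ {n} {E : Edges n} {a b} → (a , b) ∈ E → inEdges E a b ≡ true
  ∈⇒inEdges {a = a} {b} (here refl) rewrite ==-refl a | ==-refl b = refl
  ∈⇒inEdges {E = e ∷ E} {a} {b} (there p) = trans (cong (isEdge e a b or_) (∈⇒inEdges p)) (Bool.∨-zeroʳ (isEdge e a b))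

  isEdge⁻ : ∀ {n} (a b x y : Fin n) → isEdge (a , b) x y ≡ true → (a ≡ x × b ≡ y) ⊎ (a ≡ y × b ≡ x)
  isEdge⁻ a b x y p with a ≟ x | b ≟ y
  ... | yes a≡x | yes b≡y = inj₁ (a≡x , b≡y)
  ... | yes _   | no _    = inj₂ (both p)
    where
    both : (a == y ∧ b == x) ≡ true → a ≡ y × b ≡ x
    both q with a ≟ y | b ≟ x
    ... | yes a≡y | yes b≡x = a≡y , b≡x
  ... | no _    | _       = inj₂ (both p)
    where
    both : (a == y ∧ b == x) ≡ true → a ≡ y × b ≡ x
    both q with a ≟ y | b ≟ x
    ... | yes a≡y | yes b≡x = a≡y , b≡x

  pairSum-isEdge : ∀ {n} (e : Fin n × Fin n) xs → Unique xs → pairSum (λ x y → 𝟙 (isEdge e x y)) xs ≤ 1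
  pairSum-isEdge e [] _ = z≤n
  pairSum-isEdge e (_ ∷ []) _ = z≤n
  pairSum-isEdge e@(a , b) (x ∷ y ∷ xs) (x∉ ∷ uniq) with isEdge e x y in eq
  ... | false = pairSum-isEdge e (y ∷ xs) uniq
  ... | true  = ≤-reflexive (cong suc (n≤0⇒n≡0 (≤-trans (pairSum-mono (y ∷ xs) zero-pair) (≤-reflexive (pairSum-zero (y ∷ xs))))))
    where
    -- An edge equal to {x , y} contains x, which does not occur again.
    meets : ∀ z w → isEdge e x y ≡ true → isEdge e z w ≡ true → x ≡ z ⊎ x ≡ w
    meets z w p q with isEdge⁻ a b x y p | isEdge⁻ a b z w q
    ... | inj₁ (refl , _) | inj₁ (refl , _) = inj₁ refl
    ... | inj₁ (refl , _) | inj₂ (refl , _) = inj₂ refl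
    ... | inj₂ (_ , refl) | inj₁ (_ , refl) = inj₂ refl
    ... | inj₂ (_ , refl) | inj₂ (_ , refl) = inj₁ refl
    zero-pair : ∀ {z w} → Next z w (y ∷ xs) → 𝟙 (isEdge e z w) ≤ 0
    zero-pair {z} {w} p with isEdge e z w in eq′
    ... | false = z≤n
    ... | true with meets z w eq eq′
    ...   | inj₁ refl = ⊥-elim (All.lookup x∉ (Next-source p) refl)
    ...   | inj₂ refl = ⊥-elim (All.lookup x∉ (there (Next-target p)) refl)

  pairSum-inEdges : ∀ {n} (E : Edges n) xs → Unique xs → pairSum (λ x y → 𝟙 (inEdges E x y)) xs ≤ length E
  pairSum-inEdges [] xs _ = ≤-reflexive (pairSum-zero xs)
  pairSum-inEdges (e ∷ E) xs uniq = ≤-trans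
    (pairSum-mono xs (λ {x} {y} _ → 𝟙-∨ (isEdge e x y) (inEdges E x y)))
    (≤-trans (≤-reflexive (pairSum-+ (λ x y → 𝟙 (isEdge e x y)) (λ x y → 𝟙 (inEdges E x y)) xs))
      (+-mono-≤ (pairSum-isEdge e xs uniq) (pairSum-inEdges E xs uniq)))
    where
    𝟙-∨ : ∀ b c → 𝟙 (b or c) ≤ 𝟙 b + 𝟙 c
    𝟙-∨ true  c = m≤m+n 1 _
    𝟙-∨ false c = ≤-refl

  -- Hamilton cycles

  -- A Hamilton path with its ends in the type, because rotations move the start and fix the end.
  record Spanning {n} (G : Graph n) (u v : Fin n) : Set where
    field
      tail   : List (Fin n)
      last   : Last v (u ∷ tail)
      linked : ∀ {a b} → Next a b (u ∷ tail) → Adj G a b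
      unique : Unique (u ∷ tail)
      full   : ∀ w → w ∈ u ∷ tail

    list : List (Fin n)
    list = u ∷ tail

  open Spanning

  Covers : ∀ {n} → Edges n → List (Fin n) → Set
  Covers E xs = ∀ {a b} → (a , b) ∈ E → Next± a b xs

  full⇒↭ : ∀ {n} {xs : List (Fin n)} → Unique xs → (∀ v → v ∈ xs) → xs ↭ allFin n
  full⇒↭ {n} uniq full = ∼bag⇒↭ (unique∧set⇒bag uniq (Unique.allFin⁺ n) (mk⇔ (λ _ → ∈-allFin _) (λ _ → full _)))

  module _ {n} {G : Graph n} where

    length-list : ∀ {u v} (P : Spanning G u v) → length (list P) ≡ n
    length-list P = trans (↭-length (full⇒↭ (unique P) (full P))) (List.length-tabulate (λ i → i))

    sum-list : ∀ {u v} (P : Spanning G u v) (g : Fin n → ℕ) → sum (List.map g (list P)) ≡ ∑ g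
    sum-list P g = trans (sum-↭ (↭-map⁺ g (full⇒↭ (unique P) (full P)))) (sum-allFin g)

    fromList : ∀ {x v} xs → (∃[ ds ] xs ≡ x ∷ ds) → Last v xs → (∀ {a b} → Next a b xs → Adj G a b) →
               Unique xs → (∀ w → w ∈ xs) → Σ[ Q ∈ Spanning G x v ] list Q ≡ xs
    fromList _ (ds , refl) l link uniq full =
      record { tail = ds ; last = l ; linked = link ; unique = uniq ; full = full } , refl

    reversed : ∀ {u v} (P : Spanning G u v) → Σ[ Q ∈ Spanning G v u ] list Q ≡ reverse (list P)
    reversed P = fromList (reverse (list P)) (reverse-Last (list P) (last P)) (Last-reverse (tail P))
      (λ {a} {b} p → trans (symmetric G a b) (linked P (Next-reverse⁻ p)))
      (Unique-resp-↭ (↭-sym (↭-reverse (list P))) (unique P))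
      (λ w → ∈-resp-↭ (↭-sym (↭-reverse (list P))) (full P w))

    Next-reversed : ∀ {u v a b} (P : Spanning G u v) → Next a b (list P) → Next b a (list (proj₁ (reversed P)))
    Next-reversed {a = a} {b} P p = subst (Next b a) (sym (proj₂ (reversed P))) (Next-reverse p)

    -- `preserve` says that only the step x y is lost, but forgets directions. `first` adds that the
    -- step leaving u is now traversed towards u; the second rotation in `mixed-closable` depends on
    -- that direction.
    record Rotation {u v} (P : Spanning G u v) (x y : Fin n) : Set where
      field
        path     : Spanning G x v
        preserve : ∀ {a b} → Next a b (list P) → (a ≡ x × b ≡ y) ⊎ Next± a b (list path)
        first    : ∀ {b} → Next u b (list P) → u ≡ x ⊎ Next b u (list path)

    -- From u … x y … v and u ~ y to x … u y … v.
    rotate : ∀ {u v} (P : Spanning G u v) {x y} → Next x y (list P) → Adj G u y → Rotation P x y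
    rotate {u} {v} P {x} {y} p u~y with Next-cut p
    ... | cs , bs , refl , lx with fromList {x} {v} (reverse (u ∷ cs) ++ y ∷ bs) front
              (Last-++⁺ (reverse (u ∷ cs)) (Last-++⁻ (u ∷ cs) (last P))) link
              (Unique-resp-↭ (↭-sym perm) (unique P)) (λ w → ∈-resp-↭ (↭-sym perm) (full P w))
      where
      perm : reverse (u ∷ cs) ++ y ∷ bs ↭ (u ∷ cs) ++ y ∷ bs
      perm = ++⁺ʳ (y ∷ bs) (↭-reverse (u ∷ cs))
      front : ∃[ ds ] reverse (u ∷ cs) ++ y ∷ bs ≡ x ∷ ds
      front with reverse-Last (u ∷ cs) lx
      ... | ds , eq = ds ++ y ∷ bs , cong (_++ y ∷ bs) eq
      link : ∀ {a b} → Next a b (reverse (u ∷ cs) ++ y ∷ bs) → Adj G a b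
      link {a} {b} q with Next-++⁻ (reverse (u ∷ cs)) q
      ... | inj₁ r = trans (symmetric G a b) (linked P (Next-++⁺ˡ (y ∷ bs) (Next-reverse⁻ {xs = u ∷ cs} r)))
      ... | inj₂ (inj₁ (l , refl)) = subst (λ c → Adj G c b) (Last-functional (Last-reverse cs) l) u~y
      ... | inj₂ (inj₂ r) = linked P (Next-++⁺ʳ (u ∷ cs) r)
    ...   | Q , eq = record { path = Q ; preserve = preserve ; first = first }
      where
      reversed-part : ∀ {a b} → Next a b (u ∷ cs) → Next b a (list Q)
      reversed-part {a} {b} q = subst (Next b a) (sym eq) (Next-++⁺ˡ (y ∷ bs) (Next-reverse q))
      preserve : ∀ {a b} → Next a b (u ∷ cs ++ y ∷ bs) → (a ≡ x × b ≡ y) ⊎ Next± a b (list Q)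
      preserve {a} {b} q with Next-++⁻ (u ∷ cs) q
      ... | inj₁ r                 = inj₂ (inj₂ (reversed-part r))
      ... | inj₂ (inj₁ (l , refl)) = inj₁ (Last-functional l lx , refl)
      ... | inj₂ (inj₂ r)          = inj₂ (inj₁ (subst (Next a b) (sym eq) (Next-++⁺ʳ (reverse (u ∷ cs)) r)))
      first : ∀ {b} → Next u b (u ∷ cs ++ y ∷ bs) → u ≡ x ⊎ Next b u (list Q)
      first q with Next-++⁻ (u ∷ cs) q
      ... | inj₁ r                 = inj₂ (reversed-part r)
      ... | inj₂ (inj₁ (l , refl)) = inj₁ (Last-functional l lx)
      ... | inj₂ (inj₂ r)          = ⊥-elim (Unique-head (unique P) (∈-++⁺ʳ cs (Next-source r)))

  -- A cycle is stored as a Hamilton path with a closing edge. The closing edge counts for `covers`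
  -- in both directions, so the place where the cycle is cut does not matter.
  record HamCycle {n} (G : Graph n) (E : Edges n) : Set where
    field
      {from to} : Fin n
      path      : Spanning G from to
      closing   : Adj G to from
      covers    : ∀ {a b} → (a , b) ∈ E →
                  Next± a b (list path) ⊎ (a ≡ to × b ≡ from) ⊎ (a ≡ from × b ≡ to)

  module _ {n} {G : Graph n} {E : Edges n} where

    -- On u ... x y ... v the step x y is exchanged for the edges u y and v x: rotating the reversed
    -- path at y x gives a path from y to u, which u ~ y closes. Only x y is lost, and it is not in
    -- E.
    cross : ∀ {u v} (P : Spanning G u v) → Covers E (list P) → ∀ {x y} → Next x y (list P) →
            Adj G u y → Adj G v x → inEdges E x y ≡ false → HamCycle G E
    cross P cov {x} {y} p u~y v~x xy∉E = record
      { path = Rotation.path R ; closing = u~y ; covers = λ e∈E → inj₁ (covers e∈E) }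
      where
      P′ = proj₁ (reversed P)
      R : Rotation P′ y x
      R = rotate P′ (Next-reversed P p) v~x
      keep : ∀ {a b} → (a , b) ∈ E ⊎ (b , a) ∈ E → Next a b (list P′) → Next± a b (list (Rotation.path R))
      keep e q with Rotation.preserve R q
      ... | inj₂ r = r
      keep (inj₁ e) q | inj₁ (refl , refl) = ⊥-elim (true≢false (∈⇒inEdges e) (trans (inEdges-sym E y x) xy∉E))
      keep (inj₂ e) q | inj₁ (refl , refl) = ⊥-elim (true≢false (∈⇒inEdges e) xy∉E)
      covers : ∀ {a b} → (a , b) ∈ E → Next± a b (list (Rotation.path R))
      covers e with cov e
      ... | inj₂ q = keep (inj₁ e) (Next-reversed P q)
      ... | inj₁ q with keep (inj₂ e) (Next-reversed P q)
      ...   | inj₁ r = inj₂ r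
      ...   | inj₂ r = inj₁ r

    module _ {u v} (P : Spanning G u v) where

      private
        α β φ : Fin n → Fin n → ℕ
        α x y = 𝟙 (adj G u y)
        β x y = 𝟙 (adj G v x)
        φ x y = 𝟙 (inEdges E x y)

      -- The targets of the steps are all vertices but u, the sources all but v; irreflexivity
      -- supplies the absent terms as 0.
      ∑α+β : pairSum (λ x y → α x y + β x y) (list P) ≡ degree G u + degree G v
      ∑α+β = trans (pairSum-+ α β (list P)) (cong₂ _+_ ∑α ∑β)
        where
        ∑α : pairSum α (list P) ≡ degree G u
        ∑α = trans (pairSum-target (λ y → 𝟙 (adj G u y)) u (tail P))
          (trans (cong (λ b → 𝟙 b + sum (List.map (λ y → 𝟙 (adj G u y)) (tail P))) (sym (irreflexive G u)))
            (trans (sum-list P (λ y → 𝟙 (adj G u y))) (sym (degree≡∑ G u))))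
        ∑β : pairSum β (list P) ≡ degree G v
        ∑β = trans (sym (+-identityʳ _))
          (trans (cong (λ b → pairSum β (list P) + 𝟙 b) (sym (irreflexive G v)))
            (trans (pairSum-source (λ y → 𝟙 (adj G v y)) (last P))
              (trans (sum-list P (λ y → 𝟙 (adj G v y))) (sym (degree≡∑ G v)))))

      ∑1+φ : suc (pairSum (λ x y → 1 + φ x y) (list P)) ≤ n + length E
      ∑1+φ = begin
        suc (pairSum (λ x y → 1 + φ x y) (list P))
          ≡⟨ cong suc (pairSum-+ (λ _ _ → 1) φ (list P)) ⟩
        suc (pairSum (λ _ _ → 1) (list P)) + pairSum φ (list P)
          ≡⟨ cong (λ m → suc m + pairSum φ (list P))
               (trans (pairSum-target (λ _ → 1) u (tail P)) (ones (tail P))) ⟩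
        length (list P) + pairSum φ (list P)
          ≤⟨ +-mono-≤ (≤-reflexive (length-list P)) (pairSum-inEdges E (list P) (unique P)) ⟩
        n + length E ∎
        where
        open ≤-Reasoning
        ones : ∀ (xs : List (Fin n)) → sum (List.map (λ _ → 1) xs) ≡ length xs
        ones []       = refl
        ones (_ ∷ xs) = cong suc (ones xs)

      -- Equality at every step, as happens when the degree sum is one below the Ore bound and no
      -- crossing exists. Along such a path the neighbours of v together with E determine the
      -- neighbours of u.
      Tight : Set
      Tight = ∀ {x y} → Next x y (list P) → α x y + β x y ≡ 1 + φ x y

      crossing : Covers E (list P) → HamCycle G E ⊎ (∀ {x y} → Next x y (list P) → α x y + β x y ≤ 1 + φ x y)
      crossing cov with search (λ _ y → adj G u y) (λ x _ → adj G v x) (inEdges E) (list P)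
      ... | inj₁ (x , y , p , u~y , v~x , xy∉E) = inj₁ (cross P cov p u~y v~x xy∉E)
      ... | inj₂ h                              = inj₂ h

      -- Without a crossing each of the n - 1 steps contributes at most 1, or 2 if it is in E, so
      -- the degree sum is at most n - 1 + |E|.
      ore : Covers E (list P) → n + length E ≤ degree G u + degree G v → HamCycle G E
      ore cov n+k≤ with crossing cov
      ... | inj₁ C = C
      ... | inj₂ h = ⊥-elim (<-irrefl refl (begin-strict
            degree G u + degree G v                     ≡⟨ ∑α+β ⟨
            pairSum (λ x y → α x y + β x y) (list P)    ≤⟨ pairSum-mono (list P) h ⟩
            pairSum (λ x y → 1 + φ x y) (list P)        <⟨ ∑1+φ ⟩
            n + length E                                ≤⟨ n+k≤ ⟩
            degree G u + degree G v                     ∎))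
        where open ≤-Reasoning

      ore-tight : Covers E (list P) → n + length E ≤ suc (degree G u + degree G v) → HamCycle G E ⊎ Tight
      ore-tight cov n+k≤ with crossing cov
      ... | inj₁ C = inj₁ C
      ... | inj₂ h = inj₂ λ p → ≤-antisym (h p) (pairSum-tight (list P) h
            (≤-pred (≤-trans ∑1+φ (≤-trans n+k≤ (≤-reflexive (cong suc (sym ∑α+β)))))) p)

  -- Adding edges and opening cycles

  infix 4 _⊆_
  _⊆_ : ∀ {n} → Graph n → Graph n → Set
  G ⊆ G′ = ∀ {x y} → Adj G x y → Adj G′ x y

  HamCycle-mono : ∀ {n} {G G′ : Graph n} {E} → G ⊆ G′ → HamCycle G E → HamCycle G′ E
  HamCycle-mono G⊆G′ C = record
    { path = record { tail = tail P ; last = last P ; linked = G⊆G′ ∘ linked P ; unique = unique P ; full = full P }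
    ; closing = G⊆G′ (HamCycle.closing C)
    ; covers = HamCycle.covers C }
    where P = HamCycle.path C

  extend : ∀ {n} → Graph n → (Fin n → Fin n → Bool) → Graph n
  extend {n} G Q = record { adj = adjE ; symmetric = sym-E ; irreflexive = irr-E }
    where
    adjE : Fin n → Fin n → Bool
    adjE x y = adj G x y or (not (x == y) ∧ (Q x y or Q y x))
    ==-sym : ∀ x y → (x == y) ≡ (y == x)
    ==-sym x y with x ≟ y
    ... | yes refl = sym (==-refl x)
    ... | no x≢y   = sym (≢⇒== (x≢y ∘ sym))
    sym-E : ∀ x y → adjE x y ≡ adjE y x
    sym-E x y = cong₂ _or_ (symmetric G x y) (cong₂ _∧_ (cong not (==-sym x y)) (Bool.∨-comm (Q x y) (Q y x)))
    irr-E : ∀ x → adjE x x ≡ false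
    irr-E x rewrite irreflexive G x | ==-refl x = refl

  module _ {n} (G : Graph n) (Q : Fin n → Fin n → Bool) where

    ⊆-extend : G ⊆ extend G Q
    ⊆-extend p rewrite p = refl

    extend⁺ : ∀ {x y} → x ≢ y → Q x y ≡ true → Adj (extend G Q) x y
    extend⁺ {x} {y} x≢y q rewrite ≢⇒== x≢y | q = Bool.∨-zeroʳ (adj G x y)

    extend⁻ : ∀ {x y} → Adj (extend G Q) x y → Adj G x y ⊎ (x ≢ y × (Q x y ≡ true ⊎ Q y x ≡ true))
    extend⁻ {x} {y} p with adj G x y | x ≟ y | Q x y | Q y x
    ... | true  | _      | _    | _    = inj₁ refl
    ... | false | no x≢y | true | _    = inj₂ (x≢y , inj₁ refl)
    ... | false | no x≢y | false | true = inj₂ (x≢y , inj₂ refl)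

  degree-mono : ∀ {n} {G G′ : Graph n} → G ⊆ G′ → ∀ v → degree G v ≤ degree G′ v
  degree-mono {G = G} {G′} G⊆G′ v = subst₂ _≤_ (sym (degree≡∑ G v)) (sym (degree≡∑ G′ v))
    (∑-mono-≤ λ u → 𝟙-mono (adj G v u) (adj G′ v u) G⊆G′)
    where
    𝟙-mono : ∀ b c → (b ≡ true → c ≡ true) → 𝟙 b ≤ 𝟙 c
    𝟙-mono false c h = z≤n
    𝟙-mono true  c h = ≤-reflexive (cong 𝟙 (sym (h refl)))

  pair : ∀ {n} → Fin n → Fin n → Fin n → Fin n → Bool
  pair u v x y = (x == u) ∧ (y == v)

  pair⁻ : ∀ {n} (u v x y : Fin n) → pair u v x y ≡ true → x ≡ u × y ≡ v
  pair⁻ u v x y p with x ≟ u | y ≟ v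
  ... | yes q | yes r = q , r

  pair⁺ : ∀ {n} (u v : Fin n) → pair u v u v ≡ true
  pair⁺ u v rewrite ==-refl u | ==-refl v = refl

  addEdge : ∀ {n} → Graph n → Fin n → Fin n → Graph n
  addEdge G u v = extend G (pair u v)

  module _ {n} {G : Graph n} {E : Edges n} (3≤n : 3 ≤ n) (E⊆G : ∀ {a b} → (a , b) ∈ E → Adj G a b) where

    addEdge⁻ : ∀ {u v x y} → Adj (addEdge G u v) x y → Adj G x y ⊎ (x ≡ u × y ≡ v) ⊎ (x ≡ v × y ≡ u)
    addEdge⁻ {u} {v} {x} {y} p with extend⁻ G (pair u v) p
    ... | inj₁ q            = inj₁ q
    ... | inj₂ (_ , inj₁ q) = inj₂ (inj₁ (pair⁻ u v x y q))
    ... | inj₂ (_ , inj₂ q) = inj₂ (inj₂ (proj₂ (pair⁻ u v y x q) , proj₁ (pair⁻ u v y x q)))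

    -- The list has at least three entries, so its last one does not come second. In `open-cycle`
    -- this excludes that the removed pair reappears in the other direction.
    no-shortcut : ∀ {x y} {zs : List (Fin n)} → Unique (y ∷ zs) → length (y ∷ zs) ≡ n →
                  Last x (y ∷ zs) → ¬ Next y x (y ∷ zs)
    no-shortcut _ len (there here) here = <⇒≱ (n<1+n 2) (subst (3 ≤_) (sym len) 3≤n)
    no-shortcut (_ ∷ uniq) len (there (there l)) here = Unique-head uniq (Last-∈ l)
    no-shortcut uniq len l (there p) = Unique-head uniq (Next-source p)

    Missing : Fin n → Fin n → Set
    Missing u v = Σ[ P ∈ Spanning G u v ] Covers E (list P)

    flip-missing : ∀ {u v} → Missing u v → Missing v u
    flip-missing {u} {v} (P , cov) = proj₁ (reversed P) , cov′
      where
      cov′ : Covers E (list (proj₁ (reversed P)))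
      cov′ e with cov e
      ... | inj₁ q = inj₂ (Next-reversed P q)
      ... | inj₂ q = inj₁ (Next-reversed P q)

    orient : ∀ {u v x y} → (x ≡ u × y ≡ v) ⊎ (x ≡ v × y ≡ u) → Missing x y → Missing u v
    orient (inj₁ (refl , refl)) m = m
    orient (inj₂ (refl , refl)) m = flip-missing m

    -- A cycle avoiding the new pair uv is a cycle of G; otherwise removing uv from it leaves a
    -- Hamilton path of G. No edge of E is lost, since E lies in G and the removed pair does not.
    open-cycle : ∀ {u v} → HamCycle (addEdge G u v) E → HamCycle G E ⊎ Missing u v
    -- The last two tests are constant, so the search is for a step that is not an edge of G.
    open-cycle {u} {v} C with search (λ x y → not (adj G x y)) (λ _ _ → true) (λ _ _ → false) (list (HamCycle.path C))
    ... | inj₂ h = close-up (addEdge⁻ (HamCycle.closing C))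
      where
      P = HamCycle.path C
      x = HamCycle.to C
      y = HamCycle.from C
      P′ : Spanning G y x
      P′ = record { tail = tail P ; last = last P ; linked = λ {a} {b} p → ok (adj G a b) (h p)
                  ; unique = unique P ; full = full P }
        where
        ok : ∀ b → 𝟙 (not b) + 1 ≤ 1 → b ≡ true
        ok true  _ = refl
        ok false (s≤s ())
      close-up : Adj G x y ⊎ (x ≡ u × y ≡ v) ⊎ (x ≡ v × y ≡ u) → HamCycle G E ⊎ Missing u v
      close-up (inj₁ x~y) = inj₁ (record { path = P′ ; closing = x~y ; covers = HamCycle.covers C })
      close-up (inj₂ xy≡uv) with adj G x y in x~y
      ... | true  = inj₁ (record { path = P′ ; closing = x~y ; covers = HamCycle.covers C })
      ... | false = inj₂ (orient xy≡uv (flip-missing (P′ , cov)))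
        where
        cov : Covers E (list P′)
        cov e with HamCycle.covers C e
        ... | inj₁ q = q
        ... | inj₂ (inj₁ (refl , refl)) = ⊥-elim (true≢false (E⊆G e) x~y)
        ... | inj₂ (inj₂ (refl , refl)) = ⊥-elim (true≢false (E⊆G e) (trans (symmetric G y x) x~y))
    -- The new pair lies inside the path f ... x y ... t. As t ~ f closes the cycle, y ... t f ... x
    -- is again a Hamilton path, and the pair x y closes it.
    ... | inj₁ (x , y , p , not-x~y , _) with Next-cut p | addEdge⁻ (linked (HamCycle.path C) p)
    ...   | _ | inj₁ x~y = ⊥-elim (true≢false x~y (not⁻ not-x~y))
    ...   | cs , bs , eq , lx | inj₂ xy≡uv = inj₂ (orient xy≡uv (flip-missing (proj₁ Q , cov)))
      where
      P = HamCycle.path C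
      f = HamCycle.from C
      t = HamCycle.to C
      list≡ : list P ≡ (f ∷ cs) ++ y ∷ bs
      list≡ = cong (f ∷_) eq
      xs = (y ∷ bs) ++ f ∷ cs
      perm : list P ↭ xs
      perm = ↭-trans (↭-reflexive list≡) (++-comm (f ∷ cs) (y ∷ bs))
      uniq : Unique xs
      uniq = Unique-resp-↭ perm (unique P)
      last-xs : Last x xs
      last-xs = Last-++⁺ (y ∷ bs) lx
      last-t : Last t (y ∷ bs)
      last-t = Last-++⁻ (f ∷ cs) (subst (Last t) list≡ (last P))
      x≁y : adj G x y ≡ false
      x≁y = not⁻ not-x~y
      not-xy : ∀ {a b} → Next a b xs → a ≡ x × b ≡ y → ⊥
      not-xy q (refl , refl) = Unique-head uniq (Next-target q)
      not-yx : ∀ {a b} → Next a b xs → a ≡ y × b ≡ x → ⊥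
      not-yx q (refl , refl) =
        no-shortcut uniq (trans (sym (↭-length perm)) (length-list P)) last-xs q
      in-addEdge : ∀ {a b} → Next a b xs → Adj (addEdge G u v) a b
      in-addEdge {a} {b} q with Next-++⁻ (y ∷ bs) q
      ... | inj₁ r = linked P (subst (Next a b) (sym list≡) (Next-++⁺ʳ (f ∷ cs) r))
      ... | inj₂ (inj₁ (l , refl)) rewrite Last-functional l last-t = HamCycle.closing C
      ... | inj₂ (inj₂ r) = linked P (subst (Next a b) (sym list≡) (Next-++⁺ˡ (y ∷ bs) r))
      not-new : ∀ {a b} → Next a b xs → (x ≡ u × y ≡ v) ⊎ (x ≡ v × y ≡ u) →
                (a ≡ u × b ≡ v) ⊎ (a ≡ v × b ≡ u) → ⊥
      not-new q (inj₁ (refl , refl)) (inj₁ e) = not-xy q e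
      not-new q (inj₁ (refl , refl)) (inj₂ e) = not-yx q e
      not-new q (inj₂ (refl , refl)) (inj₁ e) = not-yx q e
      not-new q (inj₂ (refl , refl)) (inj₂ e) = not-xy q e
      link : ∀ {a b} → Next a b xs → Adj G a b
      link q with addEdge⁻ (in-addEdge q)
      ... | inj₁ a~b = a~b
      ... | inj₂ e   = ⊥-elim (not-new q xy≡uv e)
      Q : Σ[ Q ∈ Spanning G y x ] list Q ≡ xs
      Q = fromList xs (_ , refl) last-xs link uniq (λ w → ∈-resp-↭ perm (full P w))
      keep : ∀ {a b} → Next a b (list P) → (a ≡ x × b ≡ y) ⊎ Next a b xs
      keep {a} {b} q with Next-++⁻ (f ∷ cs) (subst (Next a b) list≡ q)
      ... | inj₁ r = inj₂ (Next-++⁺ʳ (y ∷ bs) r)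
      ... | inj₂ (inj₁ (l , b≡y)) = inj₁ (Last-functional l lx , b≡y)
      ... | inj₂ (inj₂ r) = inj₂ (Next-++⁺ˡ (f ∷ cs) r)
      cov-xs : Covers E xs
      cov-xs {a} {b} e with HamCycle.covers C e
      ... | inj₂ (inj₁ (refl , refl)) = inj₁ (Next-join last-t)
      ... | inj₂ (inj₂ (refl , refl)) = inj₂ (Next-join last-t)
      ... | inj₁ (inj₁ q) with keep q
      ...   | inj₂ r = inj₁ r
      ...   | inj₁ (refl , refl) = ⊥-elim (true≢false (E⊆G e) x≁y)
      cov-xs {a} {b} e | inj₁ (inj₂ q) with keep q
      ...   | inj₂ r = inj₂ r
      ...   | inj₁ (refl , refl) = ⊥-elim (true≢false (trans (symmetric G b a) (E⊆G e)) x≁y)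
      cov : Covers E (list (proj₁ Q))
      cov {a} {b} e = subst (Next± a b) (sym (proj₂ Q)) (cov-xs e)

  -- Bondy–Chvátal closure


  addEdges : ∀ {n} → Graph n → Edges n → Graph n
  addEdges G []             = G
  addEdges G ((u , v) ∷ ps) = addEdges (addEdge G u v) ps

  ⊆-addEdges : ∀ {n} (G : Graph n) ps → G ⊆ addEdges G ps
  ⊆-addEdges G []             p = p
  ⊆-addEdges G ((u , v) ∷ ps) p = ⊆-addEdges (addEdge G u v) ps (⊆-extend G (pair u v) p)

  addEdges⁺ : ∀ {n} (G : Graph n) ps {x y} → x ≢ y → (x , y) ∈ ps → Adj (addEdges G ps) x y
  addEdges⁺ G ((u , v) ∷ ps) x≢y (here refl) =
    ⊆-addEdges (addEdge G u v) ps (extend⁺ G (pair u v) x≢y (pair⁺ u v))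
  addEdges⁺ G ((u , v) ∷ ps) x≢y (there p) = addEdges⁺ (addEdge G u v) ps x≢y p

  module _ {n} {E : Edges n} (3≤n : 3 ≤ n) where

    addEdge-back : (G : Graph n) → (∀ {a b} → (a , b) ∈ E → Adj G a b) → ∀ {u v} →
      n + length E ≤ degree G u + degree G v → HamCycle (addEdge G u v) E → HamCycle G E
    addEdge-back G E⊆G n+k≤ C with open-cycle 3≤n E⊆G C
    ... | inj₁ C′        = C′
    ... | inj₂ (P , cov) = ore P cov n+k≤

    -- Degrees only grow while edges are added, so it is enough to know the degree sums in G at the
    -- start.
    addEdges-back : ∀ ps (G : Graph n) → (∀ {a b} → (a , b) ∈ E → Adj G a b) →
      (∀ {x y} → (x , y) ∈ ps → x ≢ y → adj G x y ≡ false → n + length E ≤ degree G x + degree G y) →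
      HamCycle (addEdges G ps) E → HamCycle G E
    addEdges-back [] G E⊆G _ C = C
    addEdges-back ((u , v) ∷ ps) G E⊆G sums C = one (u ≟ v) (adj G u v) refl
      where
      G⊆G+ : G ⊆ addEdge G u v
      G⊆G+ = ⊆-extend G (pair u v)
      degrees : ∀ w → degree G w ≤ degree (addEdge G u v) w
      degrees = degree-mono {G = G} {addEdge G u v} (λ {a} {b} → G⊆G+ {a} {b})
      C+ : HamCycle (addEdge G u v) E
      C+ = addEdges-back ps (addEdge G u v) (λ e → G⊆G+ (E⊆G e))
        (λ {x} {y} xy∈ps x≢y x≁y → ≤-trans
          (sums (there xy∈ps) x≢y (still-missing x≁y))
          (+-mono-≤ (degrees x) (degrees y))) C
        where
        still-missing : ∀ {x y} → adj (addEdge G u v) x y ≡ false → adj G x y ≡ false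
        still-missing {x} {y} x≁y with adj G x y in eq
        ... | false = refl
      -- A listed pair that is a loop or already an edge adds nothing.
      redundant : u ≡ v ⊎ Adj G u v → addEdge G u v ⊆ G
      redundant h {x} {y} p with extend⁻ G (pair u v) p
      ... | inj₁ q = q
      redundant (inj₁ refl) {x} {y} p | inj₂ (x≢y , inj₁ q) with pair⁻ u v x y q
      ... | refl , refl = ⊥-elim (x≢y refl)
      redundant (inj₂ u~v) {x} {y} p | inj₂ (x≢y , inj₁ q) with pair⁻ u v x y q
      ... | refl , refl = u~v
      redundant (inj₁ refl) {x} {y} p | inj₂ (x≢y , inj₂ q) with pair⁻ u v y x q
      ... | refl , refl = ⊥-elim (x≢y refl)
      redundant (inj₂ u~v) {x} {y} p | inj₂ (x≢y , inj₂ q) with pair⁻ u v y x q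
      ... | refl , refl = trans (symmetric G v u) u~v
      one : Dec (u ≡ v) → ∀ b → adj G u v ≡ b → HamCycle G E
      one (yes u≡v) _ _ = HamCycle-mono (redundant (inj₁ u≡v)) C+
      one (no _) true  u~v = HamCycle-mono (redundant (inj₂ u~v)) C+
      one (no u≢v) false u≁v = addEdge-back G E⊆G (sums (here refl) u≢v u≁v) C+

    extend-back : (G : Graph n) (Q : Fin n → Fin n → Bool) → (∀ {a b} → (a , b) ∈ E → Adj G a b) →
      (∀ {x y} → Q x y ≡ true → x ≢ y → adj G x y ≡ false → n + length E ≤ degree G x + degree G y) →
      HamCycle (extend G Q) E → HamCycle G E
    extend-back G Q E⊆G sums C = addEdges-back pairs G E⊆G
      (λ xy∈ → sums (proj₂ (∈-filter⁻ Q? {xs = all} xy∈))) (HamCycle-mono extend⊆ C)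
      where
      Q? : (p : Fin n × Fin n) → Dec (Q (proj₁ p) (proj₂ p) ≡ true)
      Q? (x , y) = Q x y Bool.≟ true
      all pairs : Edges n
      all = cartesianProduct (allFin n) (allFin n)
      pairs = filter Q? all
      member : ∀ {x y} → Q x y ≡ true → (x , y) ∈ pairs
      member {x} {y} q = ∈-filter⁺ Q? (∈-cartesianProduct⁺ (∈-allFin x) (∈-allFin y)) q
      extend⊆ : extend G Q ⊆ addEdges G pairs
      extend⊆ {x} {y} p with extend⁻ G Q p
      ... | inj₁ q = ⊆-addEdges G pairs q
      ... | inj₂ (x≢y , inj₁ q) = addEdges⁺ G pairs x≢y (member q)
      ... | inj₂ (x≢y , inj₂ q) = trans (symmetric (addEdges G pairs) x y)
                                    (addEdges⁺ G pairs (x≢y ∘ sym) (member q))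

  -- From disjoint paths to edge lists and back

  allEdges : ∀ {n} {G : Graph n} → List (Path G) → Edges n
  allEdges Ps = concat (map Path.edges Ps)

  length-allEdges : ∀ {n} {G : Graph n} (Ps : List (Path G)) →
    length (allEdges Ps) ≡ sum (map (λ P → length (Path.edges P)) Ps)
  length-allEdges []       = refl
  length-allEdges (P ∷ Ps) = trans (List.length-++ (Path.edges P))
    (cong (length (Path.edges P) +_) (length-allEdges Ps))

  ∈consecutive⇒Next : ∀ {A : Set} {a b : A} xs → (a , b) ∈ consecutive xs → Next a b xs
  ∈consecutive⇒Next (x ∷ y ∷ xs) (here refl) = here
  ∈consecutive⇒Next (x ∷ y ∷ xs) (there p)   = there (∈consecutive⇒Next (y ∷ xs) p)

  Next⇒∈consecutive : ∀ {A : Set} {a b : A} {xs} → Next a b xs → (a , b) ∈ consecutive xs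
  Next⇒∈consecutive here = here refl
  Next⇒∈consecutive {xs = x ∷ y ∷ xs} (there p) = there (Next⇒∈consecutive p)

  Linked-Next : ∀ {A : Set} {R : A → A → Set} {xs} → Linked R xs → ∀ {a b} → Next a b xs → R a b
  Linked-Next (r ∷ l) here      = r
  Linked-Next (r ∷ l) (there p) = Linked-Next l p
  Linked-Next [-] (there ())

  Next-Linked : ∀ {A : Set} {R : A → A → Set} xs → (∀ {a b} → Next a b xs → R a b) → Linked R xs
  Next-Linked []           h = []
  Next-Linked (x ∷ [])     h = [-]
  Next-Linked (x ∷ y ∷ xs) h = h here ∷ Next-Linked (y ∷ xs) (h ∘ there)

  Unique-Next : ∀ {A : Set} {a b : A} {xs} → Unique xs → Next a b xs → a ≢ b
  Unique-Next (a∉ ∷ _) here      = All.lookup a∉ (here refl)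
  Unique-Next (_ ∷ u)  (there p) = Unique-Next u p

  ∈allEdges⇒∈Path : ∀ {n} {G : Graph n} (Ps : List (Path G)) {a b} → (a , b) ∈ allEdges Ps →
    ∃[ P ] P ∈ Ps × (a , b) ∈ Path.edges P
  ∈allEdges⇒∈Path (P ∷ Ps) p with ∈-++⁻ (Path.edges P) p
  ... | inj₁ q = P , here refl , q
  ... | inj₂ q with ∈allEdges⇒∈Path Ps q
  ...   | P′ , P′∈ , r = P′ , there P′∈ , r

  allEdges⊆ : ∀ {n} {G : Graph n} (Ps : List (Path G)) {a b} → (a , b) ∈ allEdges Ps → Adj G a b
  allEdges⊆ Ps p with ∈allEdges⇒∈Path Ps p
  ... | P , _ , q = Linked-Next (Path.linked P) (∈consecutive⇒Next (Path.vertices P) q)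

  -- In a complete graph any ordering of the vertices is a Hamilton cycle. The disjoint paths
  -- written one after another, followed by the remaining vertices, form an ordering that traverses
  -- every path.
  complete-HamCycle : ∀ {n} {G G′ : Graph n} → 3 ≤ n → (∀ {x y} → x ≢ y → Adj G′ x y) →
    (Ps : List (Path G)) → AllPairs VertexDisjoint Ps → HamCycle G′ (allEdges Ps)
  complete-HamCycle {n} {G} {G′} 3≤n complete Ps disjoint = from-list order
    (trans (↭-length (full⇒↭ uniq spans)) (List.length-tabulate {n = n} (λ i → i))) uniq spans cov
    where
    open DecMembership (_≟_ {n}) using (_∈?_)
    used order : List (Fin n)
    used = concat (map Path.vertices Ps)
    unused? : (v : Fin n) → Dec (¬ v ∈ used)
    unused? v = ¬? (v ∈? used)
    unused : List (Fin n)
    unused = filter unused? (allFin n)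
    order = used ++ unused
    uniq-used : Unique used
    uniq-used = Unique.concat⁺ (All.map⁺ (All.tabulate λ {P} _ → Path.distinct P)) (AllPairs.map⁺ disjoint)
    uniq : Unique order
    uniq = Unique.++⁺ uniq-used (Unique.filter⁺ unused? (Unique.allFin⁺ n))
      (λ (v∈used , v∈unused) → proj₂ (∈-filter⁻ unused? {xs = allFin n} v∈unused) v∈used)
    spans : ∀ v → v ∈ order
    spans v with v ∈? used
    ... | yes p = ∈-++⁺ˡ p
    ... | no ¬p = ∈-++⁺ʳ used (∈-filter⁺ unused? (∈-allFin v) ¬p)
    Next-concat : ∀ {P : Path G} {Ps} → P ∈ Ps → ∀ {a b} → Next a b (Path.vertices P) →
                  Next a b (concat (map Path.vertices Ps))
    Next-concat {Ps = _ ∷ Ps} (here refl) p = Next-++⁺ˡ (concat (map Path.vertices Ps)) p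
    Next-concat {Ps = P ∷ Ps} (there i)   p = Next-++⁺ʳ (Path.vertices P) (Next-concat i p)
    cov : ∀ {a b} → (a , b) ∈ allEdges Ps → Next a b order
    cov e with ∈allEdges⇒∈Path Ps e
    ... | P , P∈ , q = Next-++⁺ˡ unused (Next-concat P∈ (∈consecutive⇒Next (Path.vertices P) q))
    from-list : ∀ xs → length xs ≡ n → Unique xs → (∀ v → v ∈ xs) →
      (∀ {a b} → (a , b) ∈ allEdges Ps → Next a b xs) → HamCycle G′ (allEdges Ps)
    from-list [] len = ⊥-elim (<⇒≱ 3≤n (≤-trans (≤-reflexive (sym len)) z≤n))
    from-list (x ∷ []) len = ⊥-elim (<⇒≱ 3≤n (≤-trans (≤-reflexive (sym len)) (s≤s z≤n)))
    from-list (x ∷ y ∷ ys) _ uniq all-in edges with Last-exists y ys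
    ... | z , l = record
      { path = record { tail = y ∷ ys ; last = there l ; linked = λ p → complete (Unique-Next uniq p)
                      ; unique = uniq ; full = all-in }
      ; closing = complete λ { refl → Unique-head uniq (Last-∈ l) }
      ; covers = λ e → inj₁ (inj₁ (edges e)) }

  HamCycle⇒Hamilton : ∀ {n} {G : Graph n} → 3 ≤ n → (Ps : List (Path G)) → HamCycle G (allEdges Ps) →
    Σ[ C ∈ Cycle G ] IsHamilton C × All (_⊑ C) Ps
  HamCycle⇒Hamilton {n} {G} 3≤n Ps C = cycle , full P , All.tabulate (λ {Q} Q∈ →
      All.tabulate (λ {v} _ → full P v) , All.tabulate (λ {e} e∈ → onCycle Q∈ e∈))
    where
    P = HamCycle.path C
    f = HamCycle.from C
    t = HamCycle.to C
    link : ∀ {a b} → Next a b ((f ∷ tail P) ++ f ∷ []) → Adj G a b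
    link {a} {b} p with Next-++⁻ (f ∷ tail P) p
    ... | inj₁ q = linked P q
    ... | inj₂ (inj₁ (l , refl)) rewrite Last-functional l (last P) = HamCycle.closing C
    ... | inj₂ (inj₂ (there ()))
    cycle : Cycle G
    cycle = record
      { start = f ; rest = tail P
      ; length≥3 = subst (3 ≤_) (sym (length-list P)) 3≤n
      ; linked = Next-Linked ((f ∷ tail P) ++ f ∷ []) link
      ; distinct = unique P }
    into : ∀ {a b} → Next a b ((f ∷ tail P) ++ f ∷ []) → (a , b) ∈ Cycle.edges cycle
    into = Next⇒∈consecutive
    ∈-allEdges : ∀ {Q Qs} → Q ∈ Qs → ∀ {e} → e ∈ Path.edges {G = G} Q → e ∈ allEdges Qs
    ∈-allEdges (here refl) p = ∈-++⁺ˡ p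
    ∈-allEdges {Qs = Q′ ∷ _} (there i) p = ∈-++⁺ʳ (Path.edges Q′) (∈-allEdges i p)
    onCycle : ∀ {Q} → Q ∈ Ps → ∀ {e} → e ∈ Path.edges Q →
      e ∈ Cycle.edges cycle ⊎ (proj₂ e , proj₁ e) ∈ Cycle.edges cycle
    onCycle Q∈ {a , b} e∈ with HamCycle.covers C (∈-allEdges Q∈ e∈)
    ... | inj₁ (inj₁ p) = inj₁ (into (Next-++⁺ˡ (f ∷ []) p))
    ... | inj₁ (inj₂ p) = inj₂ (into (Next-++⁺ˡ (f ∷ []) p))
    ... | inj₂ (inj₁ (refl , refl)) = inj₁ (into (Next-join (last P)))
    ... | inj₂ (inj₂ (refl , refl)) = inj₂ (into (Next-join (last P)))

  -- Closing up around a clique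


  -- E is required to lie in the smaller graph and stays the same for both cycles, so reductions can
  -- be chained.
  Reduces : ∀ {n} → ℕ → Graph n → Graph n → Set
  Reduces k G G′ = ∀ {E} → length E ≤ k → (∀ {a b} → (a , b) ∈ E → Adj G a b) → HamCycle G′ E → HamCycle G E

  Clique : ∀ {n} → Graph n → (Fin n → Bool) → Set
  Clique G B = ∀ {x y} → x ≢ y → B x ≡ true → B y ≡ true → Adj G x y

  neighbours≤degree : ∀ {n} (G : Graph n) (P : Fin n → Bool) u →
    (∀ {j} → u ≢ j → P j ≡ true → Adj G u j) → # P ≤ suc (degree G u)
  neighbours≤degree G P u h = begin
    # P
      ≤⟨ ∑-mono-≤ pointwise ⟩
    ∑ (λ j → 𝟙 (j == u) * 1 + 𝟙 (adj G u j))
      ≡⟨ ℕΣ.∑-distrib-+ (λ j → 𝟙 (j == u) * 1) (λ j → 𝟙 (adj G u j)) ⟩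
    ∑ (λ j → 𝟙 (j == u) * 1) + ∑ (λ j → 𝟙 (adj G u j))
      ≡⟨ cong₂ _+_ (∑-point u (λ _ → 1)) (sym (degree≡∑ G u)) ⟩
    suc (degree G u) ∎
    where
    open ≤-Reasoning
    pointwise : ∀ j → 𝟙 (P j) ≤ 𝟙 (j == u) * 1 + 𝟙 (adj G u j)
    pointwise j with P j in Pj | j ≟ u
    ... | false | _       = z≤n
    ... | true  | yes _   = m≤m+n 1 _
    ... | true  | no j≢u  = ≤-reflexive (cong 𝟙 (sym (h (j≢u ∘ sym) Pj)))

  degree-strict : ∀ {n} {G G′ : Graph n} → G ⊆ G′ → ∀ {u v} → adj G u v ≡ false → Adj G′ u v →
    suc (degree G u) ≤ degree G′ u
  degree-strict {G = G} {G′} G⊆G′ {u} {v} u≁v u~v = begin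
    suc (degree G u)
      ≡⟨ cong₂ _+_ (sym (∑-point v (λ _ → 1))) (degree≡∑ G u) ⟩
    ∑ (λ j → 𝟙 (j == v) * 1) + ∑ (λ j → 𝟙 (adj G u j))
      ≡⟨ ℕΣ.∑-distrib-+ (λ j → 𝟙 (j == v) * 1) (λ j → 𝟙 (adj G u j)) ⟨
    ∑ (λ j → 𝟙 (j == v) * 1 + 𝟙 (adj G u j))
      ≤⟨ ∑-mono-≤ (λ j → pointwise (j == v) (adj G u j) (adj G′ u j)
           (λ p → subst (λ i → adj G u i ≡ false × Adj G′ u i) (sym (==⇒≡ p)) (u≁v , u~v)) G⊆G′) ⟩
    ∑ (λ j → 𝟙 (adj G′ u j))
      ≡⟨ degree≡∑ G′ u ⟨
    degree G′ u ∎
    where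
    open ≤-Reasoning
    pointwise : ∀ α β γ → (α ≡ true → β ≡ false × γ ≡ true) → (β ≡ true → γ ≡ true) → 𝟙 α * 1 + 𝟙 β ≤ 𝟙 γ
    pointwise true β γ f _ with f refl
    ... | refl , refl = ≤-refl
    pointwise false true γ _ g rewrite g refl = ≤-refl
    pointwise false false γ _ _ = z≤n

  #-insert : ∀ {n} (B : Fin n → Bool) {u} → B u ≡ false → # (λ x → B x or (x == u)) ≡ suc (# B)
  #-insert B {u} Bu = trans
    (ℕΣ.sum-cong-≗ (λ j → pointwise (B j) (j == u) (λ p → subst (λ i → B i ≡ false) (sym (==⇒≡ p)) Bu)))
    (trans (ℕΣ.∑-distrib-+ (λ j → 𝟙 (j == u) * 1) (𝟙 ∘ B)) (cong (_+ # B) (∑-point u (λ _ → 1))))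
    where
    pointwise : ∀ β γ → (γ ≡ true → β ≡ false) → 𝟙 (β or γ) ≡ 𝟙 γ * 1 + 𝟙 β
    pointwise true  true  f with () ← f refl
    pointwise true  false f = refl
    pointwise false true  f = refl
    pointwise false false f = refl

  insert⁻ : ∀ {n} (B : Fin n → Bool) {u} x → B x or (x == u) ≡ true → B x ≡ true ⊎ x ≡ u
  insert⁻ B {u} x p with B x | x ≟ u
  ... | true  | _     = inj₁ refl
  ... | false | yes e = inj₂ e

  ∧-split : ∀ {b c} → b ∧ c ≡ true → b ≡ true × c ≡ true
  ∧-split {true} {true} _ = refl , refl

  ∧-join : ∀ {b c} → b ≡ true → c ≡ true → b ∧ c ≡ true
  ∧-join refl refl = refl

  module _ {n} (3≤n : 3 ≤ n) (k : ℕ) where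

    extend-reduces : (G : Graph n) (Q : Fin n → Fin n → Bool) →
      (∀ {x y} → Q x y ≡ true → x ≢ y → adj G x y ≡ false → n + k ≤ degree G x + degree G y) →
      Reduces k G (extend G Q)
    extend-reduces G Q sums E≤k E⊆G = extend-back 3≤n G Q E⊆G
      (λ q x≢y x≁y → ≤-trans (+-monoʳ-≤ n E≤k) (sums q x≢y x≁y))

    -- A vertex of B outside Y and a vertex of Y have degree sum at least (k + 1 + n - |Y|) + (|Y| -
    -- 1) = n + k, so B may be joined to Y. After that all degrees in B are at least |Y| - 1, and 2
    -- |Y| - 2 ≥ n + k turns B into a clique.
    absorb : (G : Graph n) (Y B : Fin n → Bool) → Clique G Y →
      (∀ x → B x ≡ true → Y x ≡ false → k + suc (# (not ∘ Y)) ≤ degree G x) →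
      n + k + 2 ≤ # Y + # Y →
      Σ[ G′ ∈ Graph n ] G ⊆ G′ × Reduces k G G′ × Clique G′ B
    absorb G Y B Y-clique B-degree Y-large = G₂ , (λ p → ⊆-extend G₁ Q₂ (⊆-extend G Q₁ p)) ,
        (λ {E} E≤k E⊆G C → reduces₁ E≤k E⊆G (reduces₂ E≤k (λ e → ⊆-extend G Q₁ (E⊆G e)) C)) ,
        (λ x≢y Bx By → extend⁺ G₁ Q₂ x≢y (∧-join Bx By))
      where
      open ≤-Reasoning
      Q₁ Q₂ : Fin n → Fin n → Bool
      Q₁ x y = B x ∧ Y y
      Q₂ x y = B x ∧ B y
      G₁ G₂ : Graph n
      G₁ = extend G Q₁
      G₂ = extend G₁ Q₂
      n≡ : # Y + # (not ∘ Y) ≡ n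
      n≡ = #-not Y
      sums₁ : ∀ {x y} → Q₁ x y ≡ true → x ≢ y → adj G x y ≡ false → n + k ≤ degree G x + degree G y
      sums₁ {x} {y} q x≢y x≁y with ∧-split {B x} {Y y} q | Y x in Yx
      ... | Bx , Yy | true  = ⊥-elim (true≢false (Y-clique x≢y Yx Yy) x≁y)
      ... | Bx , Yy | false = begin
        n + k                             ≡⟨ cong (_+ k) n≡ ⟨
        # Y + # (not ∘ Y) + k             ≤⟨ +-monoˡ-≤ k (+-monoˡ-≤ (# (not ∘ Y))
                                               (neighbours≤degree G Y y (λ y≢j Yj → Y-clique y≢j Yy Yj))) ⟩
        suc (degree G y) + # (not ∘ Y) + k
          ≡⟨ solve 3 (λ d t k → con 1 :+ d :+ t :+ k := k :+ (con 1 :+ t) :+ d) refl (degree G y) (# (not ∘ Y)) k ⟩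
        k + suc (# (not ∘ Y)) + degree G y  ≤⟨ +-monoˡ-≤ (degree G y) (B-degree x Bx Yx) ⟩
        degree G x + degree G y           ∎
        where open +-*-Solver
      reduces₁ : Reduces k G G₁
      reduces₁ = extend-reduces G Q₁ sums₁
      B-degree₁ : ∀ x → B x ≡ true → # Y ≤ suc (degree G₁ x)
      B-degree₁ x Bx = neighbours≤degree G₁ Y x (λ x≢j Yj → extend⁺ G Q₁ x≢j (∧-join Bx Yj))
      sums₂ : ∀ {x y} → Q₂ x y ≡ true → x ≢ y → adj G₁ x y ≡ false → n + k ≤ degree G₁ x + degree G₁ y
      sums₂ {x} {y} q _ _ with ∧-split {B x} {B y} q
      ... | Bx , By = +-cancelʳ-≤ 2 _ _ (begin
        n + k + 2                               ≤⟨ Y-large ⟩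
        # Y + # Y                               ≤⟨ +-mono-≤ (B-degree₁ x Bx) (B-degree₁ y By) ⟩
        suc (degree G₁ x) + suc (degree G₁ y)
          ≡⟨ solve 2 (λ a b → con 1 :+ a :+ (con 1 :+ b) := a :+ b :+ con 2) refl (degree G₁ x) (degree G₁ y) ⟩
        degree G₁ x + degree G₁ y + 2           ∎)
        where open +-*-Solver
      reduces₂ : Reduces k G₁ G₂
      reduces₂ = extend-reduces G₁ Q₂ sums₂

    -- The type of a path mentions its graph. Here the paths may live in any `G₀` as long as their
    -- edges are in G, so one family of paths serves while the graph grows.
    Closable : Graph n → Set
    Closable G = ∀ {G₀ : Graph n} (Ps : List (Path G₀)) → AllPairs VertexDisjoint Ps →
      length (allEdges Ps) ≤ k → (∀ {a b} → (a , b) ∈ allEdges Ps → Adj G a b) → HamCycle G (allEdges Ps)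

    reduces-closable : ∀ {G G′} → G ⊆ G′ → Reduces k G G′ → Closable G′ → Closable G
    reduces-closable G⊆G′ red c Ps d E≤k E⊆G = red E≤k E⊆G (c Ps d E≤k (λ e → G⊆G′ (E⊆G e)))

    complete-closable : ∀ {G} → (∀ {x y} → x ≢ y → Adj G x y) → Closable G
    complete-closable complete Ps d _ _ = complete-HamCycle 3≤n complete Ps d

    closable⇒edgeHamiltonian : ∀ {G} → Closable G → EdgeHamiltonian k G
    closable⇒edgeHamiltonian c Ps d ∑≤k = HamCycle⇒Hamilton 3≤n Ps
      (c Ps d (≤-trans (≤-reflexive (length-allEdges Ps)) ∑≤k) (allEdges⊆ Ps))

    clique-closable : (G : Graph n) (B : Fin n → Bool) → Clique G B →
      (∀ x → B x ≡ false → k + suc (# (not ∘ B)) ≤ degree G x) →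
      n + k + 2 ≤ # B + # B → Closable G
    clique-closable G B B-clique T-degree B-large with absorb G B (λ _ → true) B-clique (λ x _ → T-degree x) B-large
    ... | G′ , G⊆G′ , red , all = reduces-closable G⊆G′ red (complete-closable (λ x≢y → all x≢y refl refl))

    -- The vertex u joins the clique first.
    clique-closable⁺ : (G : Graph n) (B : Fin n → Bool) → Clique G B →
      (∀ x → B x ≡ false → k + # (not ∘ B) ≤ degree G x) →
      ∀ u → B u ≡ false → k + suc (# (not ∘ B)) ≤ degree G u →
      n + k + 2 ≤ # B + # B → Closable G
    clique-closable⁺ G B B-clique T-degree u Bu u-degree B-large =
      reduces-closable G⊆G₁ reduces₁ (clique-closable G₁ B₁ B₁-clique T₁-degree
        (≤-trans B-large (+-mono-≤ #B≤ #B≤)))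
      where
      open ≤-Reasoning
      Q₁ : Fin n → Fin n → Bool
      Q₁ x y = B x ∧ (y == u)
      G₁ : Graph n
      G₁ = extend G Q₁
      G⊆G₁ : G ⊆ G₁
      G⊆G₁ = ⊆-extend G Q₁
      B₁ : Fin n → Bool
      B₁ x = B x or (x == u)
      #B₁ : # B₁ ≡ suc (# B)
      #B₁ = #-insert B Bu
      #B≤ : # B ≤ # B₁
      #B≤ = ≤-trans (n≤1+n (# B)) (≤-reflexive (sym #B₁))
      -- With u in the clique the complement has one vertex less, so the degree k + |T| now meets
      -- the requirement of `clique-closable`.
      #T₁ : suc (# (not ∘ B₁)) ≡ # (not ∘ B)
      #T₁ = +-cancelˡ-≡ (# B) _ _ (trans (+-suc (# B) _)
        (trans (cong (_+ # (not ∘ B₁)) (sym #B₁)) (trans (#-not B₁) (sym (#-not B)))))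
      sums₁ : ∀ {x y} → Q₁ x y ≡ true → x ≢ y → adj G x y ≡ false → n + k ≤ degree G x + degree G y
      sums₁ {x} {y} q x≢y x≁y with ∧-split {B x} {y == u} q
      ... | Bx , y==u with ==⇒≡ {i = y} y==u
      ...   | refl = begin
        n + k                             ≡⟨ cong (_+ k) (#-not B) ⟨
        # B + # (not ∘ B) + k             ≤⟨ +-monoˡ-≤ k (+-monoˡ-≤ (# (not ∘ B))
                                               (neighbours≤degree G B x (λ x≢j Bj → B-clique x≢j Bx Bj))) ⟩
        suc (degree G x) + # (not ∘ B) + k
          ≡⟨ solve 3 (λ d t k → con 1 :+ d :+ t :+ k := d :+ (k :+ (con 1 :+ t))) refl (degree G x) (# (not ∘ B)) k ⟩
        degree G x + (k + suc (# (not ∘ B)))  ≤⟨ +-monoʳ-≤ (degree G x) u-degree ⟩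
        degree G x + degree G y           ∎
        where open +-*-Solver
      reduces₁ : Reduces k G G₁
      reduces₁ = extend-reduces G Q₁ sums₁
      B₁-clique : Clique G₁ B₁
      B₁-clique {x} {y} x≢y p q with insert⁻ B x p | insert⁻ B y q
      ... | inj₁ Bx   | inj₁ By   = G⊆G₁ (B-clique x≢y Bx By)
      ... | inj₁ Bx   | inj₂ refl = extend⁺ G Q₁ x≢y (∧-join Bx (==-refl y))
      ... | inj₂ refl | inj₁ By   = trans (symmetric G₁ x y) (extend⁺ G Q₁ (x≢y ∘ sym) (∧-join By (==-refl x)))
      ... | inj₂ refl | inj₂ refl = ⊥-elim (x≢y refl)
      T₁-degree : ∀ x → B₁ x ≡ false → k + suc (# (not ∘ B₁)) ≤ degree G₁ x
      T₁-degree x p = begin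
        k + suc (# (not ∘ B₁))   ≡⟨ cong (k +_) #T₁ ⟩
        k + # (not ∘ B)          ≤⟨ T-degree x (or-false (B x) p) ⟩
        degree G x               ≤⟨ degree-mono {G = G} {G₁} (λ {a} {b} → G⊆G₁ {a} {b}) x ⟩
        degree G₁ x              ∎
        where
        or-false : ∀ b {c} → b or c ≡ false → b ≡ false
        or-false false _ = refl

    -- The new edge lifts the degree of u to at least k + |T| + 1, which lets u be the vertex that
    -- joins the clique first.
    addEdge-closable : (G : Graph n) (B : Fin n → Bool) → Clique G B →
      (∀ x → B x ≡ false → k + # (not ∘ B) ≤ degree G x) → n + k + 2 ≤ # B + # B →
      ∀ {u v} → B u ≡ false → u ≢ v → adj G u v ≡ false → Closable (addEdge G u v)
    addEdge-closable G B B-clique T-degree B-large {u} {v} Bu u≢v u≁v =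
      clique-closable⁺ (addEdge G u v) B (λ x≢y Bx By → G⊆G+ (B-clique x≢y Bx By))
        (λ x Bx → ≤-trans (T-degree x Bx) (degree-mono {G = G} {addEdge G u v} (λ {a} {b} → G⊆G+ {a} {b}) x))
        u Bu (≤-trans (≤-reflexive (+-suc k _)) (≤-trans (s≤s (T-degree u Bu))
          (degree-strict {G = G} {addEdge G u v} (λ {a} {b} → G⊆G+ {a} {b}) u≁v
            (extend⁺ G (pair u v) u≢v (pair⁺ u v)))))
        B-large
      where
      G⊆G+ : G ⊆ addEdge G u v
      G⊆G+ = ⊆-extend G (pair u v)

    -- Rotating twice around an edge and a non-edge inside the complement of B contradicts tightness.
    mixed-closable : (G : Graph n) (B : Fin n → Bool) → Clique G B →
      (∀ x → B x ≡ false → k + # (not ∘ B) ≤ degree G x) → n + k + 2 ≤ # B + # B →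
      ∀ {v} → B v ≡ true → (∀ x → B x ≡ false → adj G v x ≡ false) →
      ∀ {u y w} → B u ≡ false → B y ≡ false → B w ≡ false → Adj G u y → w ≢ y → adj G y w ≡ false →
      Closable G
    mixed-closable G B B-clique T-degree B-large {v} Bv v-isolated {u} {y} {w} Bu By Bw u~y w≢y y≁w Ps d E≤k E⊆G =
      from-open (open-cycle 3≤n E⊆G (addEdge-closable G B B-clique T-degree B-large Bu u≢v
        (trans (symmetric G u v) (v-isolated u Bu)) Ps d E≤k (λ e → ⊆-extend G (pair u v) (E⊆G e))))
      where
      E = allEdges Ps
      u≢v : u ≢ v
      u≢v refl = true≢false Bv Bu
      y≢v : y ≢ v
      y≢v refl = true≢false Bv By
      w≢v : w ≢ v
      w≢v refl = true≢false Bv Bw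

      -- v has at least |B| - 1 neighbours and x at least k + |T|, one short of the Ore bound. So a
      -- Hamilton path from such an x to v that covers E either yields the cycle or is tight.
      almost : ∀ {x} → B x ≡ false → n + length E ≤ suc (degree G x + degree G v)
      almost {x} Bx = begin
        n + length E                          ≤⟨ +-monoʳ-≤ n E≤k ⟩
        n + k                                 ≡⟨ cong (_+ k) (#-not B) ⟨
        # B + # (not ∘ B) + k                 ≤⟨ +-monoˡ-≤ k (+-monoˡ-≤ (# (not ∘ B))
                                                   (neighbours≤degree G B v (λ v≢j Bj → B-clique v≢j Bv Bj))) ⟩
        suc (degree G v) + # (not ∘ B) + k
          ≡⟨ solve 3 (λ d t k → con 1 :+ d :+ t :+ k := con 1 :+ (k :+ t :+ d)) refl (degree G v) (# (not ∘ B)) k ⟩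
        suc (k + # (not ∘ B) + degree G v)    ≤⟨ s≤s (+-monoˡ-≤ (degree G v) (T-degree x Bx)) ⟩
        suc (degree G x + degree G v)         ∎
        where open ≤-Reasoning
              open +-*-Solver

      module Step {x} (Bx : B x ≡ false) (P : Spanning G x v) (tight : Tight {E = E} P) where
        -- v has no neighbour outside B, so its term vanishes and the tight equation has a single
        -- solution.
        outside : ∀ {a b} → Next a b (list P) → B a ≡ false → Adj G x b × inEdges E a b ≡ false
        outside {a} {b} p Ba = read (adj G x b) (adj G v a) (inEdges E a b) (v-isolated a Ba) (tight p)
          where
          read : ∀ α β φ → β ≡ false → 𝟙 α + 𝟙 β ≡ 1 + 𝟙 φ → α ≡ true × φ ≡ false
          read true  false false _ _ = refl , refl
        -- Having a successor, a is not the last vertex v, hence it is adjacent to v; with x ~ b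
        -- only membership in E balances the equation.
        inside : ∀ {a b} → Next a b (list P) → B a ≡ true → Adj G x b → inEdges E a b ≡ true
        inside {a} {b} p Ba = read (adj G x b) (adj G v a) (inEdges E a b)
          (B-clique (λ { refl → last-no-next (unique P) (last P) p }) Bv Ba) (tight p)
          where
          last-no-next : ∀ {a b} {xs : List (Fin n)} → Unique xs → Last a xs → Next a b xs → ⊥
          last-no-next uniq (there l) here      = Unique-head uniq (Last-∈ l)
          last-no-next (_ ∷ uniq) (there l) (there p) = last-no-next uniq l p
          read : ∀ α β φ → β ≡ true → 𝟙 α + 𝟙 β ≡ 1 + 𝟙 φ → α ≡ true → φ ≡ true
          read true true true _ _ _ = refl

      rotate-covers : ∀ {x} {P : Spanning G x v} {a b} → Covers E (list P) → inEdges E a b ≡ false →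
        (R : Rotation P a b) → Covers E (list (Rotation.path R))
      rotate-covers {a = a} {b} cov ab∉E R {c} {e} ce∈E with cov ce∈E
      ... | inj₁ p with Rotation.preserve R p
      ...   | inj₁ (refl , refl) = ⊥-elim (true≢false (∈⇒inEdges ce∈E) ab∉E)
      ...   | inj₂ q = q
      rotate-covers {a = a} {b} cov ab∉E R {c} {e} ce∈E | inj₂ p with Rotation.preserve R p
      ...   | inj₁ (refl , refl) = ⊥-elim (true≢false (∈⇒inEdges ce∈E) (trans (inEdges-sym E b a) ab∉E))
      ...   | inj₂ (inj₁ q) = inj₂ q
      ...   | inj₂ (inj₂ q) = inj₁ q

      -- P₀ reads u ... x y z ... v. As y lies outside B, tightness gives u ~ z, and rotating at y z
      -- produces P₁ = y x ... u z ... v.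
      module First (P₀ : Spanning G u v) (cov₀ : Covers E (list P₀)) (tight₀ : Tight {E = E} P₀) where
        y∈tail : y ∈ tail P₀
        y∈tail with full P₀ y
        ... | here refl = ⊥-elim (true≢false u~y (irreflexive G u))
        ... | there p   = p
        x = proj₁ (predecessor {u = u} y∈tail)
        x→y : Next x y (list P₀)
        x→y = proj₂ (predecessor {u = u} y∈tail)
        z = proj₁ (successor (last P₀) (full P₀ y) y≢v)
        y→z : Next y z (list P₀)
        y→z = proj₂ (successor (last P₀) (full P₀ y) y≢v)
        u~z : Adj G u z
        u~z = proj₁ (Step.outside Bu P₀ tight₀ y→z By)
        yz∉E : inEdges E y z ≡ false
        yz∉E = proj₂ (Step.outside Bu P₀ tight₀ y→z By)
        R₁ = rotate P₀ y→z u~z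
        P₁ : Spanning G y v
        P₁ = Rotation.path R₁
        cov₁ : Covers E (list P₁)
        cov₁ = rotate-covers cov₀ yz∉E R₁
        y→x : Next y x (list P₁)
        y→x with Rotation.preserve R₁ x→y
        ... | inj₁ (x≡y , _)  = ⊥-elim (Unique-Next (unique P₀) x→y x≡y)
        ... | inj₂ (inj₁ q)   = ⊥-elim (Unique-head (unique P₁) (Next-target q))
        ... | inj₂ (inj₂ q)   = q

        module Second (tight₁ : Tight {E = E} P₁) where
          yx∉E : inEdges E y x ≡ false
          yx∉E = proj₂ (Step.outside By P₁ tight₁ y→x By)
          -- For x in B, the edge uy and the tightness of P₀ would put xy into E, against the
          -- tightness of P₁ at its first step.
          Bx : B x ≡ false
          Bx with B x in eq
          ... | false = refl
          ... | true  = ⊥-elim (true≢false (Step.inside Bu P₀ tight₀ x→y eq u~y) (trans (inEdges-sym E x y) yx∉E))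
          -- Rotating P₁ at w and its successor z′ gives P₂ = w ... x y z′ ... v, in which x
          -- directly precedes y.
          z′ = proj₁ (successor (last P₁) (full P₁ w) w≢v)
          w→z′ : Next w z′ (list P₁)
          w→z′ = proj₂ (successor (last P₁) (full P₁ w) w≢v)
          y~z′ : Adj G y z′
          y~z′ = proj₁ (Step.outside By P₁ tight₁ w→z′ Bw)
          wz′∉E : inEdges E w z′ ≡ false
          wz′∉E = proj₂ (Step.outside By P₁ tight₁ w→z′ Bw)
          R₂ = rotate P₁ w→z′ y~z′
          P₂ : Spanning G w v
          P₂ = Rotation.path R₂
          cov₂ : Covers E (list P₂)
          cov₂ = rotate-covers cov₁ wz′∉E R₂
          x→y′ : Next x y (list P₂)
          x→y′ with Rotation.first R₂ y→x
          ... | inj₁ y≡w = ⊥-elim (w≢y (sym y≡w))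
          ... | inj₂ q   = q
          -- P₂ starts at w and x lies outside B, so tightness at the step x y would demand w ~ y.
          impossible : Tight {E = E} P₂ → ⊥
          impossible tight₂ = true≢false (proj₁ (Step.outside Bw P₂ tight₂ x→y′ Bx))
            (trans (symmetric G w y) y≁w)

      from-open : HamCycle G E ⊎ Missing 3≤n E⊆G u v → HamCycle G E
      from-open (inj₁ C) = C
      from-open (inj₂ (P₀ , cov₀)) with ore-tight P₀ cov₀ (almost Bu)
      ... | inj₁ C = C
      ... | inj₂ tight₀ with ore-tight (First.P₁ P₀ cov₀ tight₀) (First.cov₁ P₀ cov₀ tight₀) (almost By)
      ...   | inj₁ C = C
      ...   | inj₂ tight₁ with ore-tight (First.Second.P₂ P₀ cov₀ tight₀ tight₁)
                                 (First.Second.cov₂ P₀ cov₀ tight₀ tight₁) (almost Bw)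
      ...     | inj₁ C = C
      ...     | inj₂ tight₂ = ⊥-elim (First.Second.impossible P₀ cov₀ tight₀ tight₁ tight₂)

  -- Splitting a graph into parts

  open Inverse

  -- The sum identity is built by the same recursion as the bijection; `three-part-≅` uses it to
  -- count the complement of B after N has been split off.
  record Split {n} (P : Fin n → Bool) (a b : ℕ) : Set where
    field
      parts : Fin n ↔ (Fin a ⊎ Fin b)
      ∈-left  : ∀ i → P (from parts (inj₁ i)) ≡ true
      ∈-right : ∀ i → P (from parts (inj₂ i)) ≡ false
      ∑-split : ∀ (g : Fin n → ℕ) →
        ∑ g ≡ ∑ (g ∘ from parts ∘ inj₁) + ∑ (g ∘ from parts ∘ inj₂)

    left : Fin a → Fin n
    left = from parts ∘ inj₁

    right : Fin b → Fin n
    right = from parts ∘ inj₂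

  split-true : ∀ {n} {P : Fin (suc n) → Bool} {a b} → P zero ≡ true → Split (P ∘ suc) a b → Split P (suc a) b
  split-true {n} {P} {a} {b} P0 S = record
    { parts = mk↔ₛ′ to′ from′ to-from from-to
    ; ∈-left = λ { zero → P0 ; (suc a) → Split.∈-left S a } ; ∈-right = Split.∈-right S
    ; ∑-split = λ g → trans (cong (g zero +_) (Split.∑-split S (g ∘ suc))) (sym (+-assoc (g zero) _ _)) }
    where
    f = Split.parts S
    A = Fin (suc a) ⊎ Fin b
    to′ : Fin (suc n) → A
    to′ zero    = inj₁ zero
    to′ (suc i) = Sum.map suc id (to f i)
    from′ : A → Fin (suc n)
    from′ (inj₁ zero)    = zero
    from′ (inj₁ (suc a)) = suc (from f (inj₁ a))
    from′ (inj₂ b)       = suc (from f (inj₂ b))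
    to-from : ∀ x → to′ (from′ x) ≡ x
    to-from (inj₁ zero)    = refl
    to-from (inj₁ (suc a)) = cong (Sum.map suc id) (strictlyInverseˡ f (inj₁ a))
    to-from (inj₂ b)       = cong (Sum.map suc id) (strictlyInverseˡ f (inj₂ b))
    from-map : ∀ x → from′ (Sum.map suc id x) ≡ suc (from f x)
    from-map (inj₁ a) = refl
    from-map (inj₂ b) = refl
    from-to : ∀ i → from′ (to′ i) ≡ i
    from-to zero    = refl
    from-to (suc i) = trans (from-map (to f i)) (cong suc (strictlyInverseʳ f i))
  split-false : ∀ {n} {P : Fin (suc n) → Bool} {a b} → P zero ≡ false → Split (P ∘ suc) a b → Split P a (suc b)
  split-false {n} {P} {a} {b} P0 S = record
    { parts = mk↔ₛ′ to′ from′ to-from from-to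
    ; ∈-left = Split.∈-left S ; ∈-right = λ { zero → P0 ; (suc b) → Split.∈-right S b }
    ; ∑-split = λ g → trans (cong (g zero +_) (Split.∑-split S (g ∘ suc)))
        (solve 3 (λ a b c → a :+ (b :+ c) := b :+ (a :+ c)) refl (g zero)
          (∑ (g ∘ suc ∘ from f ∘ inj₁)) (∑ (g ∘ suc ∘ from f ∘ inj₂))) }
    where
    open +-*-Solver
    f = Split.parts S
    A = Fin a ⊎ Fin (suc b)
    to′ : Fin (suc n) → A
    to′ zero    = inj₂ zero
    to′ (suc i) = Sum.map id suc (to f i)
    from′ : A → Fin (suc n)
    from′ (inj₁ a)       = suc (from f (inj₁ a))
    from′ (inj₂ zero)    = zero
    from′ (inj₂ (suc b)) = suc (from f (inj₂ b))
    to-from : ∀ x → to′ (from′ x) ≡ x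
    to-from (inj₁ a)       = cong (Sum.map id suc) (strictlyInverseˡ f (inj₁ a))
    to-from (inj₂ zero)    = refl
    to-from (inj₂ (suc b)) = cong (Sum.map id suc) (strictlyInverseˡ f (inj₂ b))
    from-map : ∀ x → from′ (Sum.map id suc x) ≡ suc (from f x)
    from-map (inj₁ a) = refl
    from-map (inj₂ b) = refl
    from-to : ∀ i → from′ (to′ i) ≡ i
    from-to zero    = refl
    from-to (suc i) = trans (from-map (to f i)) (cong suc (strictlyInverseʳ f i))

  split : ∀ {n} (P : Fin n → Bool) → Split P (# P) (# (not ∘ P))
  split {zero} P = record
    { parts = mk↔ₛ′ (λ ()) (λ { (inj₁ ()) ; (inj₂ ()) }) (λ { (inj₁ ()) ; (inj₂ ()) }) (λ ())
    ; ∈-left = λ () ; ∈-right = λ () ; ∑-split = λ _ → refl }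
  split {suc n} P = insert (P zero) refl
    where
    insert : ∀ β → P zero ≡ β → Split P (# P) (# (not ∘ P))
    insert true P0 = subst₂ (Split P)
      (cong (λ β → 𝟙 β + # (P ∘ suc)) (sym P0)) (cong (λ β → 𝟙 (not β) + # (not ∘ P ∘ suc)) (sym P0))
      (split-true P0 (split (P ∘ suc)))
    insert false P0 = subst₂ (Split P)
      (cong (λ β → 𝟙 β + # (P ∘ suc)) (sym P0)) (cong (λ β → 𝟙 (not β) + # (not ∘ P ∘ suc)) (sym P0))
      (split-false P0 (split (P ∘ suc)))

  ≅-trans : ∀ {l m n} {G₁ : Graph l} {G₂ : Graph m} {G₃ : Graph n} → G₁ ≅ G₂ → G₂ ≅ G₃ → G₁ ≅ G₃
  ≅-trans (f , p) (g , q) = ↔-trans f g , λ u v → trans (p u v) (q (to f u) (to f v))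

  induced : ∀ {m n} → Graph n → (Fin m → Fin n) → Graph m
  induced G e = record
    { adj = λ u v → adj G (e u) (e v)
    ; symmetric = λ u v → symmetric G (e u) (e v)
    ; irreflexive = λ v → irreflexive G (e v) }

  complete-≅ : ∀ {m n} {G : Graph m} → (∀ {u v} → u ≢ v → Adj G u v) → m ≡ n → G ≅ complete n
  complete-≅ {G = G} all refl = ↔-refl , agree
    where
    agree : ∀ u v → adj G u v ≡ not (u == v)
    agree u v with u Fin.≟ v
    ... | yes refl = irreflexive G u
    ... | no u≢v   = all u≢v

  edgeless-≅ : ∀ {m n} {G : Graph m} → (∀ u v → adj G u v ≡ false) → m ≡ n → G ≅ edgeless n
  edgeless-≅ none refl = ↔-refl , none

  ⊎↔+ : ∀ {m n} → (Fin m ⊎ Fin n) ↔ Fin (m + n)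
  ⊎↔+ = ↔-sym Fin.+↔⊎

  combine-cong : ∀ c {m m′ n n′} {G₁ : Graph m} {G₁′ : Graph m′} {G₂ : Graph n} {G₂′ : Graph n′} →
    G₁ ≅ G₁′ → G₂ ≅ G₂′ → combine c G₁ G₂ ≅ combine c G₁′ G₂′
  combine-cong c {m} {m′} {n} {n′} {G₁} {G₁′} {G₂} {G₂′} (f , p) (g , q) =
    ↔-trans Fin.+↔⊎ (↔-trans (f ⊎-↔ g) ⊎↔+) , agree
    where
    agree : ∀ u v → adj (combine c G₁ G₂) u v ≡
      adj (combine c G₁′ G₂′) (join m′ n′ (Sum.map (to f) (to g) (splitAt m u)))
                              (join m′ n′ (Sum.map (to f) (to g) (splitAt m v)))
    agree u v
      rewrite Fin.splitAt-join m′ n′ (Sum.map (to f) (to g) (splitAt m u))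
            | Fin.splitAt-join m′ n′ (Sum.map (to f) (to g) (splitAt m v))
      with splitAt m u | splitAt m v
    ... | inj₁ a | inj₁ b = p a b
    ... | inj₁ a | inj₂ b = refl
    ... | inj₂ a | inj₁ b = refl
    ... | inj₂ a | inj₂ b = q a b

  -- Join and disjoint union differ only in the constant value of adjacency across the parts, so one
  -- lemma peels off both layers of H and L.
  split-≅ : ∀ c {n} (G : Graph n) {P : Fin n → Bool} {a b} (S : Split P a b) →
    (∀ u v → P u ≡ true → P v ≡ false → adj G u v ≡ c) →
    G ≅ combine c (induced G (Split.left S)) (induced G (Split.right S))
  split-≅ c {n} G {P} {m₁} {m₂} S cross = ↔-trans parts ⊎↔+ , λ u v →
      trans (cong₂ (adj G) (sym (strictlyInverseʳ parts u)) (sym (strictlyInverseʳ parts v)))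
            (agree (to parts u) (to parts v))
    where
    open Split S
    agree : ∀ s t → adj G (from parts s) (from parts t) ≡
      adj (combine c (induced G left) (induced G right)) (join m₁ m₂ s) (join m₁ m₂ t)
    agree s t
      rewrite Fin.splitAt-join m₁ m₂ s | Fin.splitAt-join m₁ m₂ t
      with s | t
    ... | inj₁ a | inj₁ b = refl
    ... | inj₁ a | inj₂ b = cross _ _ (∈-left a) (∈-right b)
    ... | inj₂ a | inj₁ b = trans (symmetric G _ _) (cross _ _ (∈-left b) (∈-right a))
    ... | inj₂ a | inj₂ b = refl

  module _ {n} {P : Fin n → Bool} {a b} (S : Split P a b) where
    open Split S

    left-injective : ∀ {i j} → left i ≡ left j → i ≡ j
    left-injective {i} {j} p = inj₁-injective (trans (sym (strictlyInverseˡ parts (inj₁ i)))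
      (trans (cong (to parts) p) (strictlyInverseˡ parts (inj₁ j))))

    right-injective : ∀ {i j} → right i ≡ right j → i ≡ j
    right-injective {i} {j} p = inj₂-injective (trans (sym (strictlyInverseˡ parts (inj₂ i)))
      (trans (cong (to parts) p) (strictlyInverseˡ parts (inj₂ j))))

  -- The extremal graphs

  open Split

  -- N is joined to everything, which gives the outer join; no edges run between the rest of B and
  -- the complement of B, which gives the union. That complement is reached through two nested
  -- splittings, so its shape is requested for every injective enumeration e.
  three-part-≅ : ∀ {n a b c c′} (G : Graph n) (N B : Fin n → Bool) {X : Graph c′} →
    (∀ v → N v ≡ true → B v ≡ true) → Clique G B →
    (∀ {u v} → N u ≡ true → B v ≡ false → Adj G u v) →
    (∀ {u v} → N u ≡ false → B u ≡ true → B v ≡ false → adj G u v ≡ false) →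
    # N ≡ a → # (not ∘ B) ≡ c → a + b + c ≡ n →
    (∀ {c″} (e : Fin c″ → Fin n) → (∀ {i j} → e i ≡ e j → i ≡ j) → (∀ i → B (e i) ≡ false) →
       c″ ≡ c → induced G e ≅ X) →
    G ≅ complete a ∨ (complete b ∪ X)
  three-part-≅ {n} {a} {b} {c} G N B {X} N⊂B B-clique N~T M≁T #N #T abc T≅X =
    ≅-trans {G₁ = G} {G₂ = combine true (induced G (left S)) R} {G₃ = complete a ∨ (complete b ∪ X)} (split-≅ true G S N-joined)
      (combine-cong true {G₂′ = complete b ∪ X}
        (complete-≅ {G = induced G (left S)} (λ i≢j → B-clique (i≢j ∘ left-injective S)
          (N⊂B _ (∈-left S _)) (N⊂B _ (∈-left S _))) #N)
        (≅-trans {G₁ = R} {G₂ = combine false (induced R (left S′)) (induced R (right S′))} {G₃ = complete b ∪ X}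
          (split-≅ false R S′ (λ u v Bu Bv → M≁T (∈-right S u) Bu Bv))
          (combine-cong false {G₁′ = complete b} {G₂′ = X}
            (complete-≅ {G = induced R (left S′)} (λ i≢j → B-clique
              (i≢j ∘ left-injective S′ ∘ right-injective S) (∈-left S′ _) (∈-left S′ _)) #M)
            (T≅X (right S ∘ right S′) (right-injective S′ ∘ right-injective S) (∈-right S′) #T′))))
    where
    S = split N
    R = induced G (right S)
    B′ : Fin (# (not ∘ N)) → Bool
    B′ = B ∘ right S
    S′ = split B′
    N-joined : ∀ u v → N u ≡ true → N v ≡ false → adj G u v ≡ true
    N-joined u v Nu Nv with B v in Bv
    ... | true  = B-clique (λ { refl → true≢false Nu Nv }) (N⊂B u Nu) Bv
    ... | false = N~T Nu Bv
    #T′ : # (not ∘ B′) ≡ c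
    #T′ = begin
      # (not ∘ B′)                                          ≡⟨⟩
      0 + # (not ∘ B′)                                      ≡⟨ cong (_+ # (not ∘ B′)) none-left ⟨
      ∑ (λ i → 𝟙 (not (B (left S i)))) + # (not ∘ B′)       ≡⟨ ∑-split S (𝟙 ∘ not ∘ B) ⟨
      # (not ∘ B)                                           ≡⟨ #T ⟩
      c                                                     ∎
      where
      open ≡-Reasoning
      none-left : ∑ (λ i → 𝟙 (not (B (left S i)))) ≡ 0
      none-left = trans (ℕΣ.sum-cong-≗ (λ i → cong (λ β → 𝟙 (not β)) (N⊂B _ (∈-left S i))))
                    (trans (∑-const (# N) 0) (*-zeroʳ (# N)))
    #M : # B′ ≡ b
    #M = +-cancelʳ-≡ c _ _ (+-cancelˡ-≡ a _ _ (begin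
      a + (# B′ + c)                 ≡⟨ cong₂ (λ i j → i + (# B′ + j)) #N #T′ ⟨
      # N + (# B′ + # (not ∘ B′))    ≡⟨ cong (# N +_) (#-not B′) ⟩
      # N + # (not ∘ N)              ≡⟨ #-not N ⟩
      n                              ≡⟨ abc ⟨
      a + b + c                      ≡⟨ +-assoc a b c ⟩
      a + (b + c)                    ∎))
      where open ≡-Reasoning

  #-not-not : ∀ {n} (P : Fin n → Bool) → # (not ∘ not ∘ P) ≡ # P
  #-not-not P = ℕΣ.sum-cong-≗ (λ i → cong 𝟙 (Bool.not-involutive (P i)))

  -- How large r has to be: for Y to become a clique, for B to be joined to Y,
  -- for Y and B to contain more than half of the vertices, and for `clique`.
  bound₁ bound₂ bound₃ bound₄ bound : ℕ → ℕ → ℕ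
  bound₁ k s = 3 * (1 + s + k)
  bound₂ k s = suc ((2 + s) * (k + 3 * s))
  bound₃ k s = k + 2 + 6 * s
  bound₄ k s = D * x + D * s + suc D * suc (D * x)
    where
    D = k + s
    x = suc (s * D)
  bound k s = bound₁ k s + bound₂ k s + bound₃ k s + bound₄ k s

  -- The case analysis

  module Main (k s r : ℕ) (2≤s : 2 ≤ s) (large : bound k s ≤ r) (G : Graph (suc (r + s)))
              (deg≥ : ∀ v → k + s ≤ degree G v) (none : NoSupersolution G r) where

    n : ℕ
    n = suc (r + s)

    3≤n : 3 ≤ n
    3≤n = s≤s (≤-trans 2≤s (m≤n+m s r))

    r≥₁ : bound₁ k s ≤ r
    r≥₁ = ≤-trans (≤-trans (m≤m+n _ (bound₂ k s)) (≤-trans (m≤m+n _ (bound₃ k s)) (m≤m+n _ (bound₄ k s)))) large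
    r≥₂ : bound₂ k s ≤ r
    r≥₂ = ≤-trans (≤-trans (m≤n+m _ (bound₁ k s)) (≤-trans (m≤m+n _ (bound₃ k s)) (m≤m+n _ (bound₄ k s)))) large
    r≥₃ : bound₃ k s ≤ r
    r≥₃ = ≤-trans (≤-trans (m≤n+m _ (bound₁ k s + bound₂ k s)) (m≤m+n _ (bound₄ k s))) large
    r≥₄ : bound₄ k s ≤ r
    r≥₄ = ≤-trans (m≤n+m _ (bound₁ k s + bound₂ k s + bound₃ k s)) large

    -- Y: vertices of degree at least 2r/3.  B: vertices of degree at least r/(s+2).
    Y B : Fin n → Bool
    Y = not ∘ low G r 2 3
    B = not ∘ low G r 1 (1 + suc s)

    #¬Y : # (not ∘ Y) ≤ 3 * s
    #¬Y = begin
      # (not ∘ Y)            ≡⟨ #-not-not (low G r 2 3) ⟩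
      # low G r 2 3          ≡⟨ *-identityʳ _ ⟨
      # low G r 2 3 * 1      ≤⟨ #low≤ {r} {s} G none 2 1 ⟩
      s * 3                  ≡⟨ *-comm s 3 ⟩
      3 * s                  ∎
      where open ≤-Reasoning

    -- Weights 1 and s + 2 give |T| (s + 1) ≤ s (s + 2) < (s + 1)². The threshold r / (s + 2) is
    -- chosen for this inequality.
    #T≤s : # (not ∘ B) ≤ s
    #T≤s = ≤-pred (*-cancelʳ-< (suc s) (# (not ∘ B)) (suc s) (begin-strict
      # (not ∘ B) * suc s                    ≡⟨ cong (_* suc s) (#-not-not (low G r 1 (1 + suc s))) ⟩
      # low G r 1 (1 + suc s) * suc s        ≤⟨ #low≤ {r} {s} G none 1 (suc s) ⟩
      s * (1 + suc s)                        <⟨ n<1+n _ ⟩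
      suc (s * (1 + suc s))                  ≡⟨ solve 1 (λ s → con 1 :+ s :* (con 2 :+ s) := (con 1 :+ s) :* (con 1 :+ s)) refl s ⟩
      suc s * suc s                          ∎))
      where open ≤-Reasoning
            open +-*-Solver

    half : ∀ (P : Fin n → Bool) → # (not ∘ P) ≤ 3 * s → n + k + 2 ≤ # P + # P
    half P few = +-cancelʳ-≤ (6 * s) _ _ (begin
      n + k + 2 + 6 * s                     ≡⟨ solve 3 (λ n k s → n :+ k :+ con 2 :+ con 6 :* s := n :+ (k :+ con 2 :+ con 6 :* s)) refl n k s ⟩
      n + bound₃ k s                        ≤⟨ +-monoʳ-≤ n (≤-trans r≥₃ (≤-trans (m≤m+n r s) (n≤1+n _))) ⟩
      n + n                                 ≡⟨ cong₂ _+_ (#-not P) (#-not P) ⟨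
      (# P + # (not ∘ P)) + (# P + # (not ∘ P))
        ≤⟨ +-mono-≤ (+-monoʳ-≤ (# P) few) (+-monoʳ-≤ (# P) few) ⟩
      (# P + 3 * s) + (# P + 3 * s)         ≡⟨ solve 2 (λ p s → (p :+ con 3 :* s) :+ (p :+ con 3 :* s) := p :+ p :+ con 6 :* s) refl (# P) s ⟩
      # P + # P + 6 * s                     ∎)
      where open ≤-Reasoning
            open +-*-Solver

    Y-half : n + k + 2 ≤ # Y + # Y
    Y-half = half Y #¬Y

    B-half : n + k + 2 ≤ # B + # B
    B-half = half B (≤-trans #T≤s (m≤m+n s (s + (s + 0))))

    -- Two degrees of at least 2 r / 3 add up to r + r / 3 or more, while n + k = r + (1 + s + k).
    Y-sums : ∀ {x y} → Y x ≡ true → Y y ≡ true → n + k ≤ degree G x + degree G y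
    Y-sums {x} {y} Yx Yy = *-cancelˡ-≤ 3 (begin
      3 * (n + k)                        ≡⟨ solve 3 (λ r s k → con 3 :* (con 1 :+ (r :+ s) :+ k) := con 3 :* r :+ con 3 :* (con 1 :+ s :+ k)) refl r s k ⟩
      3 * r + bound₁ k s                 ≤⟨ +-monoʳ-≤ (3 * r) r≥₁ ⟩
      3 * r + r                          ≡⟨ solve 1 (λ r → con 3 :* r :+ r := con 2 :* r :+ con 2 :* r) refl r ⟩
      2 * r + 2 * r                      ≤⟨ +-mono-≤ (low⁻ G r 2 3 x (not⁻ Yx)) (low⁻ G r 2 3 y (not⁻ Yy)) ⟩
      3 * degree G x + 3 * degree G y    ≡⟨ *-distribˡ-+ 3 (degree G x) (degree G y) ⟨
      3 * (degree G x + degree G y)      ∎)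
      where open ≤-Reasoning
            open +-*-Solver

    B-degree : ∀ x → B x ≡ true → k + suc (# (not ∘ Y)) ≤ degree G x
    B-degree x Bx = ≮⇒≥ λ small → <-irrefl refl (begin-strict
      (2 + s) * (k + 3 * s)         <⟨ r≥₂ ⟩
      r                             ≡⟨ *-identityˡ r ⟨
      1 * r                         ≤⟨ low⁻ G r 1 (2 + s) x (not⁻ Bx) ⟩
      (2 + s) * degree G x          ≤⟨ *-monoʳ-≤ (2 + s) (≤-trans (≤-pred (≤-trans small (≤-reflexive (+-suc k _)))) (+-monoʳ-≤ k #¬Y)) ⟩
      (2 + s) * (k + 3 * s)         ∎)
      where open ≤-Reasoning

    record Closure : Set where
      field
        graph   : Graph n
        ⊆graph  : G ⊆ graph
        reduces : Reduces k G graph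
        clique′ : Clique graph B

    -- Degrees of order r / (s + 2) are too small to join the vertices of B to each other directly.
    -- Y is the bridge: it becomes a clique by its own degree sums and then absorbs B.
    closure : Closure
    closure = record
      { graph = proj₁ absorbed
      ; ⊆graph = λ p → proj₁ (proj₂ absorbed) (⊆-extend G QY p)
      ; reduces = λ {E} E≤k E⊆G C → extend-reduces 3≤n k G QY sums E≤k E⊆G
          (proj₁ (proj₂ (proj₂ absorbed)) E≤k (λ e → ⊆-extend G QY (E⊆G e)) C)
      ; clique′ = proj₂ (proj₂ (proj₂ absorbed)) }
      where
      QY : Fin n → Fin n → Bool
      QY x y = Y x ∧ Y y
      G₁ : Graph n
      G₁ = extend G QY
      sums : ∀ {x y} → QY x y ≡ true → x ≢ y → adj G x y ≡ false → n + k ≤ degree G x + degree G y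
      sums {x} {y} q _ _ with ∧-split {Y x} {Y y} q
      ... | Yx , Yy = Y-sums Yx Yy
      absorbed = absorb 3≤n k G₁ Y B (λ x≢y Yx Yy → extend⁺ G QY x≢y (∧-join Yx Yy))
        (λ x Bx _ → ≤-trans (B-degree x Bx) (degree-mono {G = G} {G₁} (λ {a} {b} → ⊆-extend G QY {a} {b}) x))
        Y-half

    open Closure closure

    degree≤ : ∀ v → degree G v ≤ degree graph v
    degree≤ = degree-mono {G = G} {graph} (λ {a} {b} → ⊆graph {a} {b})

    edgeHamiltonian : Closable 3≤n k G → EdgeHamiltonian k G
    edgeHamiltonian = closable⇒edgeHamiltonian 3≤n k

    edgeHamiltonian′ : Closable 3≤n k graph → EdgeHamiltonian k G
    edgeHamiltonian′ c = edgeHamiltonian (reduces-closable 3≤n k (λ {a} {b} → ⊆graph {a} {b}) reduces c)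

    few-low : # (not ∘ B) < s → EdgeHamiltonian k G
    few-low t<s = edgeHamiltonian′ (clique-closable 3≤n k graph B clique′
      (λ x _ → ≤-trans (+-monoʳ-≤ k t<s) (≤-trans (deg≥ x) (degree≤ x))) B-half)

    module Extremal (#T : # (not ∘ B) ≡ s) where

      #B : # B ≡ suc r
      #B = +-cancelʳ-≡ s _ _ (trans (cong (# B +_) (sym #T)) (#-not B))

      T-degree : ∀ x → B x ≡ false → k + # (not ∘ B) ≤ degree G x
      T-degree x _ = ≤-trans (≤-reflexive (cong (k +_) #T)) (deg≥ x)

      high-T : ∀ {u} → B u ≡ false → k + suc s ≤ degree G u → EdgeHamiltonian k G
      high-T {u} Bu u-degree = edgeHamiltonian′ (clique-closable⁺ 3≤n k graph B clique′
        (λ x Bx → ≤-trans (T-degree x Bx) (degree≤ x)) u Bu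
        (≤-trans (≤-reflexive (cong (λ t → k + suc t) #T)) (≤-trans u-degree (degree≤ u))) B-half)

      module Exact (exact : ∀ x → B x ≡ false → degree G x ≤ k + s) where

        -- The closure has this clique already, but the isomorphisms with H and L need it in G
        -- itself. The bound `exact` on the degrees outside B makes the spectral argument possible.
        B-clique : Clique G B
        B-clique = clique {r} {s} G none B #B (k + s) exact (s≤s r≥₄)

        -- Joined to u and to the rest of B, v has degree at least |B|. With k + |T| for u′ the sum
        -- reaches n + k, so u′v may be added, and this edge closes the graph.
        unequal : ∀ {u u′ v} → B u ≡ false → B u′ ≡ false → B v ≡ true → Adj G u v → adj G u′ v ≡ false →
                  EdgeHamiltonian k G
        unequal {u} {u′} {v} Bu Bu′ Bv u~v u′≁v = edgeHamiltonian
          (reduces-closable 3≤n k {G} {addEdge G u′ v} (λ {a} {b} → ⊆-extend G (pair u′ v) {a} {b})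
            (λ E≤k E⊆G → addEdge-back 3≤n G E⊆G (≤-trans (+-monoʳ-≤ n E≤k) enough))
            (addEdge-closable 3≤n k G B B-clique T-degree B-half Bu′ (λ { refl → true≢false Bv Bu′ }) u′≁v))
          where
          open ≤-Reasoning
          open +-*-Solver
          v-neighbour : ∀ {j} → v ≢ j → B j or (j == u) ≡ true → Adj G v j
          v-neighbour {j} v≢j p with insert⁻ B j p
          ... | inj₁ Bj   = B-clique v≢j Bv Bj
          ... | inj₂ refl = trans (symmetric G v j) u~v
          enough : n + k ≤ degree G u′ + degree G v
          enough = begin
            n + k                         ≡⟨ cong (_+ k) (#-not B) ⟨
            # B + # (not ∘ B) + k         ≡⟨ solve 3 (λ b t k → b :+ t :+ k := k :+ t :+ b) refl (# B) (# (not ∘ B)) k ⟩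
            k + # (not ∘ B) + # B         ≤⟨ +-mono-≤ (T-degree u′ Bu′) (≤-pred (≤-trans
                                               (≤-reflexive (sym (#-insert B Bu)))
                                               (neighbours≤degree G _ v v-neighbour))) ⟩
            degree G u′ + degree G v      ∎

        module Uniform (uniform : ∀ {u u′ v} → B u ≡ false → B u′ ≡ false → B v ≡ true → Adj G u v → Adj G u′ v) where

          k+s<#B : k + s < # B
          k+s<#B = subst (k + s <_) (sym #B) (s≤s (≤-trans (≤-trans (≤-reflexive (+-comm k s))
            (≤-trans (n≤1+n (s + k)) (m≤m+n (1 + s + k) _))) r≥₁))

          -- u has at most k + s neighbours, fewer than |B| = r + 1. By uniformity the v found here
          -- has no neighbour outside B at all.
          isolated : ∀ {u} → B u ≡ false → ∃[ v ] B v ≡ true × adj G u v ≡ false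
          isolated {u} Bu with any? (λ v → (B v Bool.≟ true) ×-dec (adj G u v Bool.≟ false))
          ... | yes found = found
          ... | no none-found = ⊥-elim (<⇒≱ k+s<#B (≤-trans #B≤ (exact u Bu)))
            where
            covered : ∀ b c → (b ≡ true → c ≡ false → ⊥) → 𝟙 b ≤ 𝟙 c
            covered false _ _ = z≤n
            covered true true _ = ≤-refl
            covered true false h = ⊥-elim (h refl refl)
            #B≤ : # B ≤ degree G u
            #B≤ = ≤-trans (∑-mono-≤ (λ v → covered (B v) (adj G u v) (λ Bv u≁v → none-found (v , Bv , u≁v))))
                    (≤-reflexive (sym (degree≡∑ G u)))

          mixed : ∀ {u y w} → B u ≡ false → B y ≡ false → B w ≡ false → Adj G u y → w ≢ y → adj G y w ≡ false →
                  EdgeHamiltonian k G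
          mixed {u} Bu By Bw u~y w≢y y≁w with isolated Bu
          ... | v , Bv , u≁v = edgeHamiltonian (mixed-closable 3≤n k G B B-clique T-degree B-half Bv v-isolated
                                 Bu By Bw u~y w≢y y≁w)
            where
            v-isolated : ∀ x → B x ≡ false → adj G v x ≡ false
            v-isolated x Bx with adj G v x in v~x
            ... | false = refl
            ... | true  = ⊥-elim (true≢false (uniform Bx Bu Bv (trans (symmetric G x v) v~x)) u≁v)

          module Anchor {u₀} (Bu₀ : B u₀ ≡ false) where

            -- By uniformity this is the neighbourhood in B of every vertex outside B, whichever u₀
            -- is taken.
            N : Fin n → Bool
            N v = B v ∧ adj G u₀ v

            N⊂B : ∀ v → N v ≡ true → B v ≡ true
            N⊂B v Nv = proj₁ (∧-split {B v} Nv)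

            N~T : ∀ {u v} → N u ≡ true → B v ≡ false → Adj G u v
            N~T {u} {v} Nu Bv with ∧-split {B u} Nu
            ... | Bu , u₀~u = trans (symmetric G u v) (uniform Bu₀ Bv Bu u₀~u)

            M≁T : ∀ {u v} → N u ≡ false → B u ≡ true → B v ≡ false → adj G u v ≡ false
            M≁T {u} {v} Nu Bu Bv with adj G u v in u~v
            ... | false = refl
            ... | true  = ⊥-elim (true≢false
                  (∧-join Bu (uniform Bv Bu₀ Bu (trans (symmetric G v u) u~v))) Nu)

            deg-u₀ : degree G u₀ ≡ k + s
            deg-u₀ = ≤-antisym (exact u₀ Bu₀) (deg≥ u₀)

            -- All neighbours of u₀ lie in N, so |N| is its degree k + s.
            edgeless-T : (∀ {u v} → B u ≡ false → B v ≡ false → adj G u v ≡ false) → G ≅ H n k (k + s)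
            edgeless-T T-edgeless = three-part-≅ G N B N⊂B B-clique N~T M≁T
              (trans (ℕΣ.sum-cong-≗ (λ j → pointwise (B j) (adj G u₀ j) (T-edgeless Bu₀)))
                (trans (sym (degree≡∑ G u₀)) deg-u₀))
              #T sizes
              (λ e _ e∈T c≡s → edgeless-≅ {G = induced G e} (λ u v → T-edgeless (e∈T u) (e∈T v)) (trans c≡s (sym (m+n∸m≡n k s))))
              where
              pointwise : ∀ β α → (β ≡ false → α ≡ false) → 𝟙 (β ∧ α) ≡ 𝟙 α
              pointwise true  α _ = refl
              pointwise false α h rewrite h refl = refl
              open ≤-Reasoning
              open +-*-Solver
              b : ℕ
              b = (n + k) ∸ 2 * (k + s)
              2δ≤ : 2 * (k + s) ≤ n + k
              2δ≤ = begin
                2 * (k + s)        ≡⟨ cong (2 *_) (+-comm k s) ⟩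
                2 * (s + k)        ≤⟨ *-mono-≤ (n≤1+n 2) (n≤1+n (s + k)) ⟩
                3 * (1 + s + k)    ≤⟨ r≥₁ ⟩
                r                  ≤⟨ m≤m+n r s ⟩
                r + s              ≤⟨ n≤1+n (r + s) ⟩
                n                  ≤⟨ m≤m+n n k ⟩
                n + k              ∎
              sizes : k + s + b + s ≡ n
              sizes = +-cancelʳ-≡ k _ _ (begin-equality
                k + s + b + s + k  ≡⟨ solve 3 (λ k s b → k :+ s :+ b :+ s :+ k := b :+ con 2 :* (k :+ s)) refl k s b ⟩
                b + 2 * (k + s)    ≡⟨ m∸n+n≡m 2δ≤ ⟩
                n + k              ∎)

            -- Here u₀ has s - 1 neighbours outside B, which leaves k + 1 of its k + s neighbours
            -- for N.
            complete-T : (∀ {u v} → u ≢ v → B u ≡ false → B v ≡ false → Adj G u v) → G ≅ L n k (k + s)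
            complete-T T-complete = three-part-≅ G N B N⊂B B-clique N~T M≁T #N #T sizes
              (λ e e-inj e∈T c≡s → complete-≅ {G = induced G e} (λ i≢j → T-complete (i≢j ∘ e-inj) (e∈T _) (e∈T _))
                (trans c≡s (sym (m+n∸m≡n k s))))
              where
              open ≤-Reasoning
              open +-*-Solver
              pointwise : ∀ j → 𝟙 (N j) + 𝟙 (not (B j)) ≡ 𝟙 (j == u₀) * 1 + 𝟙 (adj G u₀ j)
              pointwise j = cases (j ≟ u₀) (B j) refl
                where
                cases : Dec (j ≡ u₀) → ∀ β → B j ≡ β → 𝟙 (N j) + 𝟙 (not (B j)) ≡ 𝟙 (j == u₀) * 1 + 𝟙 (adj G u₀ j)
                cases (yes refl) β _ rewrite Bu₀ | ==-refl j | irreflexive G j = refl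
                cases (no j≢u₀) true Bj rewrite Bj | ≢⇒== j≢u₀ = +-identityʳ _
                cases (no j≢u₀) false Bj rewrite Bj | ≢⇒== j≢u₀ | T-complete (j≢u₀ ∘ sym) Bu₀ Bj = refl
              #N : # N ≡ k + 1
              #N = +-cancelʳ-≡ s _ _ (begin-equality
                # N + s                      ≡⟨ cong (# N +_) #T ⟨
                # N + # (not ∘ B)            ≡⟨ ℕΣ.∑-distrib-+ (𝟙 ∘ N) (𝟙 ∘ not ∘ B) ⟨
                ∑ (λ j → 𝟙 (N j) + 𝟙 (not (B j)))
                  ≡⟨ ℕΣ.sum-cong-≗ pointwise ⟩
                ∑ (λ j → 𝟙 (j == u₀) * 1 + 𝟙 (adj G u₀ j))
                  ≡⟨ ℕΣ.∑-distrib-+ (λ j → 𝟙 (j == u₀) * 1) (λ j → 𝟙 (adj G u₀ j)) ⟩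
                ∑ (λ j → 𝟙 (j == u₀) * 1) + ∑ (λ j → 𝟙 (adj G u₀ j))
                  ≡⟨ cong₂ _+_ (∑-point u₀ (λ _ → 1)) (trans (sym (degree≡∑ G u₀)) deg-u₀) ⟩
                1 + (k + s)                  ≡⟨ solve 2 (λ k s → con 1 :+ (k :+ s) := k :+ con 1 :+ s) refl k s ⟩
                k + 1 + s                    ∎)
              b : ℕ
              b = n ∸ (k + s + 1)
              δ+1≤n : k + s + 1 ≤ n
              δ+1≤n = begin
                k + s + 1          ≡⟨ solve 2 (λ k s → k :+ s :+ con 1 := con 1 :+ s :+ k) refl k s ⟩
                1 + s + k          ≤⟨ m≤m+n (1 + s + k) _ ⟩
                3 * (1 + s + k)    ≤⟨ r≥₁ ⟩
                r                  ≤⟨ m≤m+n r s ⟩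
                r + s              ≤⟨ n≤1+n (r + s) ⟩
                n                  ∎
              sizes : k + 1 + b + s ≡ n
              sizes = trans (solve 3 (λ k s b → k :+ con 1 :+ b :+ s := b :+ (k :+ s :+ con 1)) refl k s b) (m∸n+n≡m δ+1≤n)

          anchor : ∃[ u ] B u ≡ false
          anchor with any? (λ u → B u Bool.≟ false)
          ... | yes found = found
          ... | no none-found = ⊥-elim (<⇒≱ (≤-trans (s≤s z≤n) 2≤s) (≤-trans (≤-reflexive (sym #T))
                (≤-reflexive (trans (ℕΣ.sum-cong-≗ (λ j → empty (B j) (λ Bj → none-found (j , Bj))))
                  (trans (∑-const n 0) (*-zeroʳ n))))))
            where
            empty : ∀ β → (β ≡ false → ⊥) → 𝟙 (not β) ≡ 0
            empty true  _ = refl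
            empty false h = ⊥-elim (h refl)

          conclude : EdgeHamiltonian k G ⊎ (G ≅ H n k (k + s)) ⊎ (G ≅ L n k (k + s))
          conclude with any? (λ u → any? λ y → any? λ w → (B u Bool.≟ false) ×-dec (B y Bool.≟ false) ×-dec
                         (B w Bool.≟ false) ×-dec (adj G u y Bool.≟ true) ×-dec ¬? (w ≟ y) ×-dec (adj G y w Bool.≟ false))
          ... | yes (u , y , w , Bu , By , Bw , u~y , w≢y , y≁w) = inj₁ (mixed Bu By Bw u~y w≢y y≁w)
          ... | no not-mixed with any? (λ u → any? λ y → (B u Bool.≟ false) ×-dec (B y Bool.≟ false) ×-dec (adj G u y Bool.≟ true))
          ...   | no no-edge = inj₂ (inj₁ (Anchor.edgeless-T (proj₂ anchor) nonadjacent))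
            where
            nonadjacent : ∀ {u v} → B u ≡ false → B v ≡ false → adj G u v ≡ false
            nonadjacent {u} {v} Bu Bv with adj G u v in u~v
            ... | false = refl
            ... | true  = ⊥-elim (no-edge (u , v , Bu , Bv , u~v))
          ...   | yes (u , y , Bu , By , u~y) = inj₂ (inj₂ (Anchor.complete-T (proj₂ anchor) all))
            where
            spread : ∀ {u y w} → B u ≡ false → B y ≡ false → B w ≡ false → Adj G u y → w ≢ y → Adj G y w
            spread {u} {y} {w} Bu By Bw u~y w≢y with adj G y w in y~w
            ... | true  = refl
            ... | false = ⊥-elim (not-mixed (u , y , w , Bu , By , Bw , u~y , w≢y , y~w))
            all : ∀ {i j} → i ≢ j → B i ≡ false → B j ≡ false → Adj G i j
            all {i} {j} i≢j Bi Bj with i ≟ y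
            ... | yes refl = spread Bu Bi Bj u~y (i≢j ∘ sym)
            -- The edge uy makes y adjacent to i, and the edge yi then makes i adjacent to j.
            ... | no i≢y   = spread By Bi Bj (spread Bu By Bi u~y i≢y) (i≢j ∘ sym)

        exact-result : EdgeHamiltonian k G ⊎ (G ≅ H n k (k + s)) ⊎ (G ≅ L n k (k + s))
        exact-result with any? (λ u → any? λ u′ → any? λ v → (B u Bool.≟ false) ×-dec (B u′ Bool.≟ false) ×-dec
                            (B v Bool.≟ true) ×-dec (adj G u v Bool.≟ true) ×-dec (adj G u′ v Bool.≟ false))
        ... | yes (u , u′ , v , Bu , Bu′ , Bv , u~v , u′≁v) = inj₁ (unequal Bu Bu′ Bv u~v u′≁v)
        ... | no none-found = Uniform.conclude uniform
          where
          uniform : ∀ {u u′ v} → B u ≡ false → B u′ ≡ false → B v ≡ true → Adj G u v → Adj G u′ v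
          uniform {u} {u′} {v} Bu Bu′ Bv u~v with adj G u′ v in u′~v
          ... | true  = refl
          ... | false = ⊥-elim (none-found (u , u′ , v , Bu , Bu′ , Bv , u~v , u′~v))

      extremal-result : EdgeHamiltonian k G ⊎ (G ≅ H n k (k + s)) ⊎ (G ≅ L n k (k + s))
      extremal-result with any? (λ u → (B u Bool.≟ false) ×-dec (k + suc s ≤? degree G u))
      ... | yes (u , Bu , u-degree) = inj₁ (high-T Bu u-degree)
      ... | no none-found = Exact.exact-result (λ x Bx → ≤-pred (≤-trans
            (≰⇒> λ h → none-found (x , Bx , h)) (≤-reflexive (+-suc k s))))

    result : EdgeHamiltonian k G ⊎ (G ≅ H n k (k + s)) ⊎ (G ≅ L n k (k + s))
    result = [ inj₁ ∘ few-low , Extremal.extremal-result ]′ (m≤n⇒m<n∨m≡n #T≤s)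

  -- Translating the hypotheses

  minDegree≤degree : ∀ {n} (G : Graph n) v → minDegree G ≤ degree G v
  minDegree≤degree {n} G v = All.lookup (Extrema.min≤xs n (map (degree G) (allFin n)))
    (∈-map⁺ (degree G) (∈-allFin v))

  eigenvalue-bound : ∀ k s r →
    ℤ.+ suc (r + s) ℤ.- ℤ.+ (k + s) ℤ.+ ℤ.+ k ℤ.- ℤ.+ 1 ≡ ℤ.+ r
  eigenvalue-bound k s r = solve 3 (λ r s k → con (ℤ.+ 1) :+ (r :+ s) :- (k :+ s) :+ k :- con (ℤ.+ 1) := r) refl (ℤ.+ r) (ℤ.+ s) (ℤ.+ k)
    where
    open ℤ-Solver.+-*-Solver

  -- With n written as r + s + 1 the main argument contains no subtraction in its bounds on r.
  large-split : ∀ {b s n} → suc (b + s) ≤ n → ∃[ r ] b ≤ r × n ≡ suc (r + s)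
  large-split {b} {s} {n} p with m≤n⇒∃[o]m+o≡n p
  ... | o , refl = b + o , m≤m+n b o , cong suc (solve 3 (λ b s o → b :+ s :+ o := b :+ o :+ s) refl b s o)
    where open +-*-Solver

  edgeHamiltonian-or-extremal : ∀ k s → 2 ≤ s → (n : ℕ) → suc (bound k s + s) ≤ n →
    (G : Graph n) → k + s ≤ minDegree G →
    (ρ : ℝ) → IsSpectralRadius G ρ →
    fromℤ (ℤ.+ n ℤ.- ℤ.+ (k + s) ℤ.+ ℤ.+ k ℤ.- ℤ.+ 1) ≤ʳ ρ →
    EdgeHamiltonian k G ⊎ (G ≅ H n k (k + s)) ⊎ (G ≅ L n k (k + s))
  edgeHamiltonian-or-extremal k s 2≤s n n₀≤n = go (large-split n₀≤n)
    where
    go : ∃[ r ] bound k s ≤ r × n ≡ suc (r + s) → (G : Graph n) → k + s ≤ minDegree G →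
      (ρ : ℝ) → IsSpectralRadius G ρ →
      fromℤ (ℤ.+ n ℤ.- ℤ.+ (k + s) ℤ.+ ℤ.+ k ℤ.- ℤ.+ 1) ≤ʳ ρ →
      EdgeHamiltonian k G ⊎ (G ≅ H n k (k + s)) ⊎ (G ≅ L n k (k + s))
    go (r , large , refl) G δ≤ ρ ρ-max ρ≥ =
      Main.result k s r 2≤s large G (λ v → ≤-trans δ≤ (minDegree≤degree G v))
        (¬supersolution G ρ ρ-max r (subst (λ z → fromℤ z ≤ʳ ρ) (eigenvalue-bound k s r) ρ≥))

open import Data.Integer.Base using (+_; _+_; _-_)
open import Data.Nat.Base as ℕ using (ℕ; _≤_)
import Data.Nat.Properties as ℕ
open import Data.Product.Base using (∃-syntax; _,_)
open import Data.Sum.Base using (_⊎_)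
open import Relation.Binary.PropositionalEquality using (_≡_; refl)
open Proof using (bound; edgeHamiltonian-or-extremal)

theorem2p1 : (k δ : ℕ) → k ℕ.+ 2 ≤ δ →
    ∃[ n₀ ] ((n : ℕ) → n₀ ≤ n →
    (G : Graph n) → δ ≤ minDegree G →
    (ρ : ℝ) → IsSpectralRadius G ρ →
    fromℤ (+ n - + δ + + k - + 1) ≤ʳ ρ →
    EdgeHamiltonian k G ⊎ (G ≅ H n k δ) ⊎ (G ≅ L n k δ))
theorem2p1 k δ k+2≤δ = go (ℕ.m≤n⇒∃[o]m+o≡n (ℕ.≤-trans (ℕ.m≤m+n k 2) k+2≤δ))
  where
  go : ∃[ s ] k ℕ.+ s ≡ δ → _
  -- This value of n₀ says that r = n - s - 1 is at least `bound k s`.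
  go (s , refl) = ℕ.suc (bound k s ℕ.+ s) , edgeHamiltonian-or-extremal k s (ℕ.+-cancelˡ-≤ k 2 s k+2≤δ)
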